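{- For a prime $p$, let $F^{\mathrm{PR}}(p)$ denote the number of pairs $(g,h)$ with $g,h\in\{1,\ldots,p-1\}$, $g$ a primitive root modulo $p$, such that $g^{h}\equiv h\pmod p$. Then there exist a constant $c>0$ and $x_0$ such that for all $x\ge x_0$ there are at least $c\,x/\ln x$ primes $p\le x$ with \[ F^{\mathrm{PR}}(p)=\phi(p-1)+O\left(p^{5/6}\right). \] More specifically, there exist a constant $c>0$ and $x_0$ such that for all $x\ge x_0$ there are at least $c\,x/\ln x$ primes $p\le x$ with \[ \left|F^{\mathrm{PR}}(p)-\phi(p-1)\right|\le p^{0.8313}\, d(p-1)^{3}\,(2+\ln p). \]
   Context: $\phi$ is Euler's totient function and $d(n)$ is the number of positive divisors of $n$. The implied constant in the $O$-term is absolute. -}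

module Defs where

infix 4 _≡_mod_ _≡?_mod_

open import Data.Nat as ℕ using (ℕ; zero; suc; _∸_; _^_)
open import Data.Nat.Divisibility using (_∣_; _∣?_)
open import Data.Nat.GCD using (gcd)
open import Data.Nat.Primality using (Prime)
open import Data.Integer as ℤ using (ℤ; +_; ∣_∣)
open import Data.Rational as ℚ using (ℚ; 0ℚ; 1ℚ)
open import Data.List using (List; length; filter; applyUpTo; cartesianProduct)
open import Data.List.Relation.Unary.All using (All; all?)
open import Data.List.Relation.Unary.Unique.Propositional using (Unique)
open import Data.Product using (Σ; Σ-syntax; _×_; _,_; proj₁; proj₂)
open import Data.Sum using (_⊎_)
open import Relation.Nullary using (¬_; Dec)
open import Relation.Nullary.Negation using ()
open import Relation.Nullary.Decidable using (_×-dec_; ¬?)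

_≡_mod_ : ℕ → ℕ → ℕ → Set
a ≡ b mod m = m ∣ ∣ (+ a) ℤ.- (+ b) ∣

_≡?_mod_ : (a b m : ℕ) → Dec (a ≡ b mod m)
a ≡? b mod m = m ∣? ∣ (+ a) ℤ.- (+ b) ∣

range1 : ℕ → List ℕ
range1 n = applyUpTo suc n

IsPrimitiveRoot : ℕ → ℕ → Set
IsPrimitiveRoot p g =
  (g ^ (p ∸ 1) ≡ 1 mod p) × All (λ k → ¬ (g ^ k ≡ 1 mod p)) (range1 (p ∸ 2))

isPrimitiveRoot? : (p g : ℕ) → Dec (IsPrimitiveRoot p g)
isPrimitiveRoot? p g =
  ((g ^ (p ∸ 1)) ≡? 1 mod p) ×-dec all? (λ k → ¬? ((g ^ k) ≡? 1 mod p)) (range1 (p ∸ 2))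

GoodPair : ℕ → ℕ × ℕ → Set
GoodPair p (g , h) = IsPrimitiveRoot p g × (g ^ h ≡ h mod p)

goodPair? : (p : ℕ) → (gh : ℕ × ℕ) → Dec (GoodPair p gh)
goodPair? p (g , h) = isPrimitiveRoot? p g ×-dec ((g ^ h) ≡? h mod p)

FPR : ℕ → ℕ
FPR p = length (filter (goodPair? p) (cartesianProduct (range1 (p ∸ 1)) (range1 (p ∸ 1))))

φ : ℕ → ℕ
φ n = length (filter (λ k → gcd k n ℕ.≟ 1) (range1 n))

d : ℕ → ℕ
d n = length (filter (λ k → k ∣? n) (range1 n))

ℕ→ℚ : ℕ → ℚ
ℕ→ℚ n = (+ n) ℚ./ 1

_^ℚ_ : ℚ → ℕ → ℚ
q ^ℚ zero = 1ℚ
q ^ℚ suc k = q ℚ.* (q ^ℚ k)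

expTerm : ℚ → ℕ → ℚ
expTerm q zero = 1ℚ
expTerm q (suc k) = expTerm q k ℚ.* q ℚ.* ((+ 1) ℚ./ suc k)

expPartial : ℚ → ℕ → ℚ
expPartial q zero = 0ℚ
expPartial q (suc N) = expPartial q N ℚ.+ expTerm q N

-- q ≤ ln n  (for n ≥ 1):  either q ≤ 0, or exp q ≤ n, the latter
-- expressed as: every partial sum of the (increasing) series for exp q is ≤ n.
_≤ln_ : ℚ → ℕ → Set
q ≤ln n = (q ℚ.≤ 0ℚ) ⊎ (∀ N → expPartial q N ℚ.≤ ℕ→ℚ n)

-- c·x ≤ N·ln x  (i.e. N ≥ c x / ln x):  every rational s with N·s < c·x
-- satisfies s ≤ ln x.
XOverLnBound : ℚ → ℕ → ℕ → Set
XOverLnBound c x N = ∀ (s : ℚ) → ℕ→ℚ N ℚ.* s ℚ.< c ℚ.* ℕ→ℚ x → s ≤ln x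

ManyPrimes : (ℕ → Set) → Set
ManyPrimes P =
  Σ[ c ∈ ℚ ] (0ℚ ℚ.< c) × (Σ[ x₀ ∈ ℕ ] (∀ x → x₀ ℕ.≤ x →
    Σ[ ps ∈ List ℕ ] Unique ps
      × All (λ p → Prime p × p ℕ.≤ x × P p) ps
      × XOverLnBound c x (length ps)))

Err : ℕ → ℕ
Err p = ∣ (+ FPR p) ℤ.- (+ φ (p ∸ 1)) ∣

-- |F^PR(p) - φ(p-1)| ≤ C p^{5/6}, i.e. Err^6 ≤ C^6 p^5
BoundO : ℕ → ℕ → Set
BoundO C p = Err p ^ 6 ℕ.≤ (C ^ 6) ℕ.* (p ^ 5)

-- |F^PR(p) - φ(p-1)| ≤ p^{0.8313} d(p-1)^3 (2 + ln p).
-- With L = Err p, K = p^8313 · (d(p-1)^3)^10000 this is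
-- L^10000 ≤ K (2 + ln p)^10000, equivalently: every rational s ≥ 0 with
-- K s^10000 < L^10000 satisfies s ≤ 2 + ln p, i.e. s - 2 ≤ ln p.
BoundExplicit : ℕ → Set
BoundExplicit p =
  ∀ (s : ℚ) → 0ℚ ℚ.≤ s →
    ℕ→ℚ ((p ^ 8313) ℕ.* ((d (p ∸ 1) ^ 3) ^ 10000)) ℚ.* (s ^ℚ 10000)
      ℚ.< ℕ→ℚ (Err p ^ 10000) →
    (s ℚ.- ℕ→ℚ 2) ≤ln p

{-# OPTIONS --safe #-}
-- Let n = p - 1, fix a primitive root γ and write ind for the discrete logarithm to the base γ.  A pair
-- (γ^u, h) is counted by FPR exactly when u is coprime to n and u h ≡ ind h (mod n).  Sieving out the
-- coprimality and summing over u first, FPR p - φ n becomes a signed sum over a b ∣ n of b times the excess,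
-- over its expected size, of the number of h with gcd (h , n / a) = b and a b ∣ ind h: this counts
-- the elements of an interval lying in a coset of the subgroup of order n / (a b).
--
-- For b ≤ p^0.32 the excess is O(√p log p).  This is the Pólya–Vinogradov inequality, obtained here without
-- characters: two distinct points x + b, x + b' lie in a common coset for few x, which bounds the
-- variance of coset counts in intervals, and a dyadic smoothing passes to sharp intervals.
-- For larger b an upper bound suffices.  Put m = n / b.  The r-fold products of the N elements of a coset in
-- [1, m] are, up to the divisor function, distinct elements of [1, m^r] in one coset, which bounds N^r; take
-- r = 3 up to m = p^0.4 and r = 2 up to p^0.655.  Near the critical size m = p^(2/3) multiply the N elements by all
-- l ≤ p^0.14: the products over-populate many different cosets, contradicting the variance bound.  For m ≤ p^0.3 a
-- fixed point forces p ∣ m^(2m) - k^(2m) for some k < m, which happens for at most O(x^0.9) primes p ≤ x.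
--
-- So the error is at most p^0.831 for all primes p ≤ x outside a set of size O(x^0.9), and Chebyshev's lower bound for
-- the number of primes, from k C(n , k) ∣ lcm(1, ..., n), finishes the proof.
module Submission where

-- The two basic estimates balance at the exponent 5/6. Up to logarithms and divisor functions, an
-- excess of order √p gives an error b √p, and the product set with r = 2 gives √(p m), where b m =
-- p - 1; both are p^(5/6) when m = p^(2/3). The explicit bound asks for 0.8313 < 5/6, so something
-- must be gained exactly there, and this is what multiplying the coset elements by small l
-- achieves. At the other end, a single h with gcd (h , n / a) = b and a b ∣ ind h already
-- contributes b, which is close to p when m is small. Such h must be absent altogether; this is why
-- some primes are discarded. All sizes are measured against an integer t with t^1000 ≤ p < (t +
-- 1)^1000, so that real exponents become integers counted in thousandths; a constant, a logarithm
-- or a value of the divisor function costs one or two powers of t. The resulting exponent 0.831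
-- lies below both 5/6 and 0.8313 and yields both stated bounds, the first with constant 1.

open import Defs

-- Finite sums over lists and 0-1 indicators, in ℕ for counting and in ℤ for signed sums.

module Summation where

  open import Data.Nat as ℕ using (ℕ; zero; suc; z≤n; s≤s)
  import Data.Nat.Properties as ℕP
  open import Data.Integer as ℤ using (ℤ)
  import Data.Integer.Properties as ℤP
  open import Algebra.Structures using (IsCommutativeSemiring)
  open import Data.List using (List; []; _∷_; _++_; length; filter; map; upTo; cartesianProduct)
  import Data.List.Properties as ListP
  open import Data.List.Membership.Propositional using (_∈_)
  open import Data.List.Membership.Propositional.Properties using (∈-applyUpTo⁻; ∈-applyUpTo⁺; ∈-upTo⁻)
  open import Data.List.Relation.Unary.Any using (here; there)
  open import Data.Product using (_×_; _,_; proj₁; proj₂)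
  open import Data.Empty using (⊥-elim)
  open import Function using (_∘_; id)
  open import Relation.Nullary using (¬_; Dec; yes; no)
  open import Relation.Nullary.Decidable using (_×-dec_)
  open import Relation.Unary using (Pred; Decidable)
  open import Relation.Binary.PropositionalEquality
  open import Level using (0ℓ)
  open import Data.Nat.Divisibility using (_∣_; _∣?_; divides; m∣m*n)

  range1⁻ : ∀ {n x} → x ∈ range1 n → 1 ℕ.≤ x × x ℕ.≤ n
  range1⁻ x∈ with ∈-applyUpTo⁻ suc x∈
  ... | i , i<n , refl = s≤s z≤n , i<n

  range1⁺ : ∀ {n x} → 1 ℕ.≤ x → x ℕ.≤ n → x ∈ range1 n
  range1⁺ {n} {suc x} _ x≤n = ∈-applyUpTo⁺ suc x≤n

  module Sums (C : Set) (_+_ _*_ : C → C → C) (0# 1# : C)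
              (isCS : IsCommutativeSemiring _≡_ _+_ _*_ 0# 1#) where

    open IsCommutativeSemiring isCS
      using (+-assoc; +-comm; +-identityˡ; +-identityʳ; *-identityˡ; *-identityʳ; *-assoc; *-comm; distribˡ; distribʳ; zeroˡ; zeroʳ)
    open ≡-Reasoning

    ∑ : {A : Set} → List A → (A → C) → C
    ∑ []       f = 0#
    ∑ (x ∷ xs) f = f x + ∑ xs f

    𝟙 : {P : Set} → Dec P → C
    𝟙 (yes _) = 1#
    𝟙 (no _)  = 0#

    𝟙-yes : {P : Set} (P? : Dec P) → P → 𝟙 P? ≡ 1#
    𝟙-yes (yes _) _ = refl
    𝟙-yes (no ¬p) p = ⊥-elim (¬p p)

    𝟙-no : {P : Set} (P? : Dec P) → ¬ P → 𝟙 P? ≡ 0#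
    𝟙-no (yes p) ¬p = ⊥-elim (¬p p)
    𝟙-no (no _)  _  = refl

    𝟙-cong : {P Q : Set} (P? : Dec P) (Q? : Dec Q) → (P → Q) → (Q → P) → 𝟙 P? ≡ 𝟙 Q?
    𝟙-cong (yes p) Q? f g = sym (𝟙-yes Q? (f p))
    𝟙-cong (no ¬p) Q? f g = sym (𝟙-no Q? (¬p ∘ g))

    𝟙-× : {P Q : Set} (P? : Dec P) (Q? : Dec Q) → 𝟙 (P? ×-dec Q?) ≡ 𝟙 P? * 𝟙 Q?
    𝟙-× (yes p) (yes q) = sym (*-identityˡ _)
    𝟙-× (yes p) (no ¬q) = sym (*-identityˡ _)
    𝟙-× (no ¬p) Q?      = sym (zeroˡ _)

    𝟙-*-cong : {P : Set} (P? : Dec P) {x y : C} → (P → x ≡ y) → 𝟙 P? * x ≡ 𝟙 P? * y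
    𝟙-*-cong (yes p) eq = cong (1# *_) (eq p)
    𝟙-*-cong (no ¬p) eq = trans (zeroˡ _) (sym (zeroˡ _))

    module _ {A : Set} where

      ∑-cong : (xs : List A) {f g : A → C} → (∀ {x} → x ∈ xs → f x ≡ g x) → ∑ xs f ≡ ∑ xs g
      ∑-cong []       eq = refl
      ∑-cong (x ∷ xs) eq = cong₂ _+_ (eq (here refl)) (∑-cong xs (eq ∘ there))

      ∑-zero : (xs : List A) {f : A → C} → (∀ {x} → x ∈ xs → f x ≡ 0#) → ∑ xs f ≡ 0#
      ∑-zero []       eq = refl
      ∑-zero (x ∷ xs) eq = trans (cong₂ _+_ (eq (here refl)) (∑-zero xs (eq ∘ there))) (+-identityˡ 0#)

      ∑-+ : (xs : List A) {f g : A → C} → ∑ xs (λ x → f x + g x) ≡ ∑ xs f + ∑ xs g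
      ∑-+ []               = sym (+-identityˡ 0#)
      ∑-+ (x ∷ xs) {f} {g} = begin
        (f x + g x) + ∑ xs (λ x → f x + g x)  ≡⟨ cong ((f x + g x) +_) (∑-+ xs) ⟩
        (f x + g x) + (∑ xs f + ∑ xs g)  ≡⟨ +-assoc _ _ _ ⟩
        f x + (g x + (∑ xs f + ∑ xs g))  ≡⟨ cong (f x +_) (+-assoc _ _ _) ⟨
        f x + ((g x + ∑ xs f) + ∑ xs g)  ≡⟨ cong (λ z → f x + (z + ∑ xs g)) (+-comm _ _) ⟩
        f x + ((∑ xs f + g x) + ∑ xs g)  ≡⟨ cong (f x +_) (+-assoc _ _ _) ⟩
        f x + (∑ xs f + (g x + ∑ xs g))  ≡⟨ +-assoc _ _ _ ⟨
        (f x + ∑ xs f) + (g x + ∑ xs g)  ∎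

      ∑-*ˡ : (xs : List A) (c : C) {f : A → C} → ∑ xs (λ x → c * f x) ≡ c * ∑ xs f
      ∑-*ˡ []       c     = sym (zeroʳ c)
      ∑-*ˡ (x ∷ xs) c {f} = trans (cong ((c * f x) +_) (∑-*ˡ xs c)) (sym (distribˡ c (f x) (∑ xs f)))

      ∑-*ʳ : (xs : List A) (c : C) {f : A → C} → ∑ xs (λ x → f x * c) ≡ ∑ xs f * c
      ∑-*ʳ xs c {f} = trans (∑-cong xs (λ {x} _ → *-comm (f x) c)) (trans (∑-*ˡ xs c) (*-comm c (∑ xs f)))

      ∑-++ : (xs ys : List A) {f : A → C} → ∑ (xs ++ ys) f ≡ ∑ xs f + ∑ ys f
      ∑-++ []       ys     = sym (+-identityˡ _)
      ∑-++ (x ∷ xs) ys {f} = trans (cong (f x +_) (∑-++ xs ys)) (sym (+-assoc _ _ _))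

      ∑-filter : {P : Pred A 0ℓ} (P? : Decidable P) (xs : List A) {f : A → C} →
                 ∑ (filter P? xs) f ≡ ∑ xs (λ x → 𝟙 (P? x) * f x)
      ∑-filter P? []       = refl
      ∑-filter P? (x ∷ xs) {f} with P? x
      ... | yes _ = cong₂ _+_ (sym (*-identityˡ _)) (∑-filter P? xs)
      ... | no _  = trans (∑-filter P? xs) (trans (sym (+-identityˡ _)) (cong (_+ ∑ xs (λ y → 𝟙 (P? y) * f y)) (sym (zeroˡ (f x)))))

    ∑-map : {A B : Set} (h : A → B) (xs : List A) {f : B → C} → ∑ (map h xs) f ≡ ∑ xs (f ∘ h)
    ∑-map h []       = refl
    ∑-map h (x ∷ xs) = cong (_ +_) (∑-map h xs)

    ∑-swap : {A B : Set} (xs : List A) (ys : List B) {f : A → B → C} →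
             ∑ xs (λ x → ∑ ys (f x)) ≡ ∑ ys (λ y → ∑ xs (λ x → f x y))
    ∑-swap []       ys     = sym (∑-zero ys (λ _ → refl))
    ∑-swap (x ∷ xs) ys {f} = trans (cong (∑ ys (f x) +_) (∑-swap xs ys)) (sym (∑-+ ys))

    ∑-cartesianProduct : {A B : Set} (xs : List A) (ys : List B) {f : A × B → C} →
                         ∑ (cartesianProduct xs ys) f ≡ ∑ xs (λ x → ∑ ys (λ y → f (x , y)))
    ∑-cartesianProduct []       ys     = refl
    ∑-cartesianProduct (x ∷ xs) ys {f} =
      trans (∑-++ (map (x ,_) ys) (cartesianProduct xs ys)) (cong₂ _+_ (∑-map (x ,_) ys) (∑-cartesianProduct xs ys))

    -- A 0-1 matching between the supports of f and g transports one sum into the other.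
    ∑-reindex : {A B : Set} (xs : List A) (ys : List B) {f : A → C} {g : B → C}
                {R : A → B → Set} (R? : ∀ x y → Dec (R x y)) →
                (∀ {x} → x ∈ xs → ∑ ys (λ y → 𝟙 (R? x y)) * f x ≡ f x) →
                (∀ {y} → y ∈ ys → ∑ xs (λ x → 𝟙 (R? x y)) * g y ≡ g y) →
                (∀ {x y} → x ∈ xs → y ∈ ys → R x y → f x ≡ g y) →
                ∑ xs f ≡ ∑ ys g
    ∑-reindex xs ys {f} {g} R? left right agree = begin
      ∑ xs f  ≡⟨ ∑-cong xs left ⟨
      ∑ xs (λ x → ∑ ys (λ y → 𝟙 (R? x y)) * f x)  ≡⟨ ∑-cong xs (λ {x} _ → ∑-*ʳ ys (f x)) ⟨
      ∑ xs (λ x → ∑ ys (λ y → 𝟙 (R? x y) * f x))  ≡⟨ ∑-cong xs (λ x∈ → ∑-cong ys (λ y∈ → 𝟙-*-cong (R? _ _) (agree x∈ y∈))) ⟩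
      ∑ xs (λ x → ∑ ys (λ y → 𝟙 (R? x y) * g y))  ≡⟨ ∑-swap xs ys ⟩
      ∑ ys (λ y → ∑ xs (λ x → 𝟙 (R? x y) * g y))  ≡⟨ ∑-cong ys (λ {y} _ → ∑-*ʳ xs (g y)) ⟩
      ∑ ys (λ y → ∑ xs (λ x → 𝟙 (R? x y)) * g y)  ≡⟨ ∑-cong ys right ⟩
      ∑ ys g  ∎

    ∑-upTo-suc : (n : ℕ) {f : ℕ → C} → ∑ (upTo (suc n)) f ≡ ∑ (upTo n) f + f n
    ∑-upTo-suc n {f} = begin
      ∑ (upTo (suc n)) f  ≡⟨ cong (λ l → ∑ l f) (ListP.applyUpTo-∷ʳ id n) ⟨
      ∑ (upTo n ++ n ∷ []) f  ≡⟨ ∑-++ (upTo n) (n ∷ []) ⟩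
      ∑ (upTo n) f + (f n + 0#)  ≡⟨ cong (∑ (upTo n) f +_) (+-identityʳ (f n)) ⟩
      ∑ (upTo n) f + f n  ∎

    ∑-range1-suc : (n : ℕ) {f : ℕ → C} → ∑ (range1 (suc n)) f ≡ ∑ (range1 n) f + f (suc n)
    ∑-range1-suc n {f} = begin
      ∑ (range1 (suc n)) f  ≡⟨ cong (λ l → ∑ l f) (ListP.applyUpTo-∷ʳ suc n) ⟨
      ∑ (range1 n ++ suc n ∷ []) f  ≡⟨ ∑-++ (range1 n) (suc n ∷ []) ⟩
      ∑ (range1 n) f + (f (suc n) + 0#)  ≡⟨ cong (∑ (range1 n) f +_) (+-identityʳ (f (suc n))) ⟩
      ∑ (range1 n) f + f (suc n)  ∎

    ∑-range1 : (n : ℕ) {f : ℕ → C} → ∑ (range1 n) f ≡ ∑ (upTo n) (f ∘ suc)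
    ∑-range1 zero = refl
    ∑-range1 (suc n) {f} = trans (∑-range1-suc n) (trans (cong (_+ f (suc n)) (∑-range1 n)) (sym (∑-upTo-suc n)))

    ∑-upTo-+ : (a b : ℕ) {f : ℕ → C} → ∑ (upTo (a ℕ.+ b)) f ≡ ∑ (upTo a) f + ∑ (upTo b) (λ i → f (a ℕ.+ i))
    ∑-upTo-+ a zero    {f} = trans (cong (λ c → ∑ (upTo c) f) (ℕP.+-identityʳ a)) (sym (+-identityʳ _))
    ∑-upTo-+ a (suc b) {f} = begin
      ∑ (upTo (a ℕ.+ suc b)) f  ≡⟨ cong (λ c → ∑ (upTo c) f) (ℕP.+-suc a b) ⟩
      ∑ (upTo (suc (a ℕ.+ b))) f  ≡⟨ ∑-upTo-suc (a ℕ.+ b) ⟩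
      ∑ (upTo (a ℕ.+ b)) f + f (a ℕ.+ b)  ≡⟨ cong (_+ f (a ℕ.+ b)) (∑-upTo-+ a b) ⟩
      (∑ (upTo a) f + ∑ (upTo b) (λ i → f (a ℕ.+ i))) + f (a ℕ.+ b)  ≡⟨ +-assoc _ _ _ ⟩
      ∑ (upTo a) f + (∑ (upTo b) (λ i → f (a ℕ.+ i)) + f (a ℕ.+ b))  ≡⟨ cong (∑ (upTo a) f +_) (∑-upTo-suc b) ⟨
      ∑ (upTo a) f + ∑ (upTo (suc b)) (λ i → f (a ℕ.+ i))  ∎

    -- Lets the residue systems 1, ..., n and 0, ..., n - 1 be exchanged for each other.
    ∑-upTo-ends : (n : ℕ) {f : ℕ → C} → f 0 ≡ f n → ∑ (range1 n) f ≡ ∑ (upTo n) f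
    ∑-upTo-ends zero    eq     = refl
    ∑-upTo-ends (suc n) {f} eq = begin
      ∑ (range1 (suc n)) f  ≡⟨ ∑-range1-suc n ⟩
      ∑ (range1 n) f + f (suc n)  ≡⟨ cong₂ _+_ (∑-range1 n) (sym eq) ⟩
      ∑ (upTo n) (f ∘ suc) + f 0  ≡⟨ +-comm _ _ ⟩
      f 0 + ∑ (upTo n) (f ∘ suc)  ≡⟨ cong (f 0 +_) (∑-range1 n) ⟨
      f 0 + ∑ (range1 n) f  ≡⟨⟩
      ∑ (upTo (suc n)) f  ∎

    ∑-𝟙-upTo : (n : ℕ) {P : ℕ → Set} (P? : Decidable P) {y : ℕ} → y ℕ.< n → P y →
               (∀ {x} → x ℕ.< n → P x → x ≡ y) → ∑ (upTo n) (𝟙 ∘ P?) ≡ 1#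
    ∑-𝟙-upTo (suc n) P? {y} y<n py uniq with y ℕ.≟ n
    ... | yes refl = begin
      ∑ (upTo (suc n)) (𝟙 ∘ P?)  ≡⟨ ∑-upTo-suc n ⟩
      ∑ (upTo n) (𝟙 ∘ P?) + 𝟙 (P? n)  ≡⟨ cong₂ _+_ (∑-zero (upTo n) (λ x∈ → 𝟙-no (P? _) (λ px →
          let x<n = ∈-upTo⁻ x∈ in ℕP.<⇒≢ x<n (uniq (ℕP.m<n⇒m<1+n x<n) px)))) (𝟙-yes (P? n) py) ⟩
      0# + 1#  ≡⟨ +-identityˡ 1# ⟩
      1#  ∎
    ... | no y≢n = begin
      ∑ (upTo (suc n)) (𝟙 ∘ P?)  ≡⟨ ∑-upTo-suc n ⟩
      ∑ (upTo n) (𝟙 ∘ P?) + 𝟙 (P? n)  ≡⟨ cong₂ _+_ (∑-𝟙-upTo n P? (ℕP.≤∧≢⇒< (ℕ.s≤s⁻¹ y<n) y≢n) py (uniq ∘ ℕP.m<n⇒m<1+n))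
          (𝟙-no (P? n) (λ pn → y≢n (sym (uniq ℕP.≤-refl pn)))) ⟩
      1# + 0#  ≡⟨ +-identityʳ 1# ⟩
      1#  ∎

    ∑-𝟙-range1 : (n : ℕ) {P : ℕ → Set} (P? : Decidable P) {y : ℕ} → 1 ℕ.≤ y → y ℕ.≤ n → P y →
                 (∀ {x} → 1 ℕ.≤ x → x ℕ.≤ n → P x → x ≡ y) → ∑ (range1 n) (𝟙 ∘ P?) ≡ 1#
    ∑-𝟙-range1 n P? {suc y} _ y≤n py uniq = trans (∑-range1 n)
      (∑-𝟙-upTo n (P? ∘ suc) y≤n py (λ x<n px → ℕP.suc-injective (uniq (s≤s z≤n) x<n px)))

    module _ (N : ℕ) {f : ℕ → C} (periodic : ∀ x → f (N ℕ.+ x) ≡ f x) where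

      -- Moving the window by one step drops `f b` and gains `f (N + b)`, which are equal.
      ∑-shift : (b : ℕ) → ∑ (upTo N) (λ x → f (b ℕ.+ x)) ≡ ∑ (upTo N) f
      ∑-shift zero    = refl
      ∑-shift (suc b) = begin
        ∑ (upTo N) (λ x → f (suc (b ℕ.+ x)))  ≡⟨ ∑-cong (upTo N) (λ {x} _ → cong f (ℕP.+-suc b x)) ⟨
        ∑ (upTo N) (λ x → f (b ℕ.+ suc x))  ≡⟨ ∑-range1 N ⟨
        ∑ (range1 N) (λ x → f (b ℕ.+ x))  ≡⟨ ∑-upTo-ends N (sym (trans (cong f (ℕP.+-comm b N)) (trans (periodic b) (cong f (sym (ℕP.+-identityʳ b)))))) ⟩
        ∑ (upTo N) (λ x → f (b ℕ.+ x))  ≡⟨ ∑-shift b ⟩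
        ∑ (upTo N) f  ∎

    ∑-blocks : (N : ℕ) {f : ℕ → C} → (∀ x → f (N ℕ.+ x) ≡ f x) → (b : ℕ) →
               ∑ (upTo (b ℕ.* N)) f ≡ ∑ (upTo b) (λ _ → ∑ (upTo N) f)
    ∑-blocks N periodic zero    = refl
    ∑-blocks N {f} periodic (suc b) = begin
      ∑ (upTo (N ℕ.+ b ℕ.* N)) f  ≡⟨ ∑-upTo-+ N (b ℕ.* N) ⟩
      ∑ (upTo N) f + ∑ (upTo (b ℕ.* N)) (λ i → f (N ℕ.+ i))  ≡⟨ cong (∑ (upTo N) f +_) (∑-cong (upTo (b ℕ.* N)) (λ {x} _ → periodic x)) ⟩
      ∑ (upTo N) f + ∑ (upTo (b ℕ.* N)) f  ≡⟨ cong (∑ (upTo N) f +_) (∑-blocks N periodic b) ⟩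
      ∑ (upTo N) f + ∑ (upTo b) (λ _ → ∑ (upTo N) f)  ≡⟨ +-comm _ _ ⟩
      ∑ (upTo b) (λ _ → ∑ (upTo N) f) + ∑ (upTo N) f  ≡⟨ ∑-upTo-suc b ⟨
      ∑ (upTo (suc b)) (λ _ → ∑ (upTo N) f)  ∎

    module _ (a m : ℕ) .{{_ : ℕ.NonZero a}} (f : ℕ → C) where

      private
        g : ℕ → C
        g u = 𝟙 (a ∣? u) * f u

        agree : ∀ {u v} → u ≡ a ℕ.* v → g u ≡ f (a ℕ.* v)
        agree {v = v} refl = trans (cong (_* f (a ℕ.* v)) (𝟙-yes (a ∣? (a ℕ.* v)) (m∣m*n v))) (*-identityˡ _)

        left : ∀ u (vs : List ℕ) → (∀ v → u ≡ a ℕ.* v → ∑ vs (λ v → 𝟙 (u ℕ.≟ a ℕ.* v)) ≡ 1#) →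
               ∑ vs (λ v → 𝟙 (u ℕ.≟ a ℕ.* v)) * g u ≡ g u
        left u vs one with a ∣? u
        ... | yes (divides q eq) = trans (cong (_* (1# * f u)) (one q (trans eq (ℕP.*-comm q a)))) (*-identityˡ _)
        ... | no _ = trans (cong (∑ vs (λ v → 𝟙 (u ℕ.≟ a ℕ.* v)) *_) (zeroˡ (f u))) (trans (zeroʳ _) (sym (zeroˡ (f u))))

      ∑-multiples-upTo : ∑ (upTo (a ℕ.* m)) g ≡ ∑ (upTo m) (λ v → f (a ℕ.* v))
      ∑-multiples-upTo = ∑-reindex (upTo (a ℕ.* m)) (upTo m) (λ u v → u ℕ.≟ a ℕ.* v)
        (λ {u} u∈ → left u (upTo m) (λ v eq → ∑-𝟙-upTo m (λ v → u ℕ.≟ a ℕ.* v)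
           (ℕP.*-cancelˡ-< a v m (subst (ℕ._< a ℕ.* m) eq (∈-upTo⁻ u∈))) eq (λ _ eq' → ℕP.*-cancelˡ-≡ _ _ a (trans (sym eq') eq))))
        (λ {v} v∈ → trans (cong (_* f (a ℕ.* v)) (∑-𝟙-upTo (a ℕ.* m) (λ u → u ℕ.≟ a ℕ.* v)
           (ℕP.*-monoʳ-< a (∈-upTo⁻ v∈)) refl (λ _ eq → eq))) (*-identityˡ _))
        (λ _ _ → agree)

      ∑-multiples-range1 : ∑ (range1 (a ℕ.* m)) g ≡ ∑ (range1 m) (λ v → f (a ℕ.* v))
      ∑-multiples-range1 = ∑-reindex (range1 (a ℕ.* m)) (range1 m) (λ u v → u ℕ.≟ a ℕ.* v)
        (λ {u} u∈ → left u (range1 m) (λ v eq → ∑-𝟙-range1 m (λ v → u ℕ.≟ a ℕ.* v)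
           (pos v (subst (1 ℕ.≤_) eq (proj₁ (range1⁻ u∈)))) (ℕP.*-cancelˡ-≤ a (subst (ℕ._≤ a ℕ.* m) eq (proj₂ (range1⁻ u∈)))) eq
           (λ _ _ eq' → ℕP.*-cancelˡ-≡ _ _ a (trans (sym eq') eq))))
        (λ {v} v∈ → trans (cong (_* f (a ℕ.* v)) (∑-𝟙-range1 (a ℕ.* m) (λ u → u ℕ.≟ a ℕ.* v)
           (ℕP.*-mono-≤ {1} {a} (ℕ.>-nonZero⁻¹ a) (proj₁ (range1⁻ v∈))) (ℕP.*-monoʳ-≤ a (proj₂ (range1⁻ v∈))) refl (λ _ _ eq → eq))) (*-identityˡ _))
        (λ _ _ → agree)
        where
        pos : ∀ v → 1 ℕ.≤ a ℕ.* v → 1 ℕ.≤ v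
        pos zero    le = ⊥-elim (ℕP.<-irrefl refl (subst (1 ℕ.≤_) (ℕP.*-zeroʳ a) le))
        pos (suc v) _  = s≤s z≤n

  module N = Sums ℕ ℕ._+_ ℕ._*_ 0 1 ℕP.+-*-isCommutativeSemiring
  module Z = Sums ℤ ℤ._+_ ℤ._*_ ℤ.0ℤ ℤ.1ℤ ℤP.+-*-isCommutativeSemiring

  open N using (∑; 𝟙)

  length-filter : {A : Set} {P : Pred A 0ℓ} (P? : Decidable P) (xs : List A) → length (filter P? xs) ≡ ∑ xs (𝟙 ∘ P?)
  length-filter P? []       = refl
  length-filter P? (x ∷ xs) with P? x
  ... | yes _ = cong suc (length-filter P? xs)
  ... | no _  = length-filter P? xs

  ∑-const : {A : Set} (xs : List A) (c : ℕ) → ∑ xs (λ _ → c) ≡ length xs ℕ.* c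
  ∑-const []       c = refl
  ∑-const (x ∷ xs) c = cong (c ℕ.+_) (∑-const xs c)

  ∑-mono : {A : Set} (xs : List A) {f g : A → ℕ} → (∀ {x} → x ∈ xs → f x ℕ.≤ g x) → ∑ xs f ℕ.≤ ∑ xs g
  ∑-mono []       le = z≤n
  ∑-mono (x ∷ xs) le = ℕP.+-mono-≤ (le (here refl)) (∑-mono xs (le ∘ there))

  ∑-bound : {A : Set} (xs : List A) {f : A → ℕ} (B : ℕ) → (∀ {x} → x ∈ xs → f x ℕ.≤ B) → ∑ xs f ℕ.≤ length xs ℕ.* B
  ∑-bound xs B le = ℕP.≤-trans (∑-mono xs le) (ℕP.≤-reflexive (∑-const xs B))

  ∈⇒≤∑ : {A : Set} {xs : List A} {x : A} (f : A → ℕ) → x ∈ xs → f x ℕ.≤ ∑ xs f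
  ∈⇒≤∑ f (here refl) = ℕP.m≤m+n _ _
  ∈⇒≤∑ f (there x∈)  = ℕP.≤-trans (∈⇒≤∑ f x∈) (ℕP.m≤n+m _ _)

  𝟙-mono : {P Q : Set} (P? : Dec P) (Q? : Dec Q) → (P → Q) → 𝟙 P? ℕ.≤ 𝟙 Q?
  𝟙-mono (yes p) (yes q) f = ℕP.≤-refl
  𝟙-mono (yes p) (no ¬q) f = ⊥-elim (¬q (f p))
  𝟙-mono (no _)  Q?      f = z≤n

  𝟙≤1 : {P : Set} (P? : Dec P) → 𝟙 P? ℕ.≤ 1
  𝟙≤1 (yes _) = ℕP.≤-refl
  𝟙≤1 (no _)  = z≤n

  𝟙≤ : {P : Set} (P? : Dec P) {x : ℕ} → (P → 1 ℕ.≤ x) → 𝟙 P? ℕ.≤ x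
  𝟙≤ (yes p) f = f p
  𝟙≤ (no _)  f = z≤n

  pos-𝟙 : {P : Set} (P? : Dec P) → ℤ.+ (𝟙 P?) ≡ Z.𝟙 P?
  pos-𝟙 (yes _) = refl
  pos-𝟙 (no _)  = refl

  pos-∑ : {A : Set} (xs : List A) (f : A → ℕ) → ℤ.+ (∑ xs f) ≡ Z.∑ xs (λ x → ℤ.+ (f x))
  pos-∑ []       f = refl
  pos-∑ (x ∷ xs) f = cong (ℤ._+_ (ℤ.+ (f x))) (pos-∑ xs f)

  ∣∑∣≤ : {A : Set} (xs : List A) {f : A → ℤ} (B : ℕ) → (∀ {x} → x ∈ xs → ℤ.∣ f x ∣ ℕ.≤ B) → ℤ.∣ Z.∑ xs f ∣ ℕ.≤ length xs ℕ.* B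
  ∣∑∣≤ []       B le = z≤n
  ∣∑∣≤ (x ∷ xs) {f} B le = ℕP.≤-trans (ℤP.∣i+j∣≤∣i∣+∣j∣ (f x) (Z.∑ xs f)) (ℕP.+-mono-≤ (le (here refl)) (∣∑∣≤ xs {f} B (le ∘ there)))

  ∑-𝟙≤1 : (n : ℕ) {P : ℕ → Set} (P? : Decidable P) → (∀ {x y} → x ℕ.< n → y ℕ.< n → P x → P y → x ≡ y) →
           ∑ (upTo n) (𝟙 ∘ P?) ℕ.≤ 1
  ∑-𝟙≤1 n P? uniq with ℕP.anyUpTo? P? n
  ... | yes (y , y<n , py) = ℕP.≤-reflexive (N.∑-𝟙-upTo n P? y<n py (λ x<n px → uniq x<n y<n px py))
  ... | no none = ℕP.≤-trans (ℕP.≤-reflexive (N.∑-zero (upTo n) (λ x∈ → N.𝟙-no (P? _) (λ px → none (_ , ∈-upTo⁻ x∈ , px))))) z≤n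

-- Partial sums of the exponential series against powers of two.

module Exponential where

  open import Data.Nat as ℕ using (ℕ; zero; suc; _^_)
  open import Data.Nat using () renaming (_+_ to _⊕_; _*_ to _⊛_)
  import Data.Nat.Properties as ℕP
  open import Data.Nat.Tactic.RingSolver using (solve-∀)
  open import Data.Integer as ℤ using (ℤ)
  import Data.Integer.Properties as ℤP
  open import Data.Rational
  open import Data.Rational.Properties
  open import Data.Rational.Unnormalised as ℚᵘ using (ℚᵘ; mkℚᵘ)
  import Data.Rational.Unnormalised.Properties as ℚᵘP
  open import Relation.Binary.PropositionalEquality hiding (J)

  private
    raw : ℕ → ℚᵘ
    raw n = mkℚᵘ (ℤ.+ n) 0

    toℚᵘ-ℕ→ℚ : ∀ n → toℚᵘ (ℕ→ℚ n) ℚᵘ.≃ raw n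
    toℚᵘ-ℕ→ℚ n = toℚᵘ-fromℚᵘ (raw n)

  ℕ→ℚ-mono : ∀ {m n} → m ℕ.≤ n → ℕ→ℚ m ≤ ℕ→ℚ n
  ℕ→ℚ-mono {m} {n} m≤n = toℚᵘ-cancel-≤ (ℚᵘP.≤-respˡ-≃ (ℚᵘP.≃-sym (toℚᵘ-ℕ→ℚ m)) (ℚᵘP.≤-respʳ-≃ (ℚᵘP.≃-sym (toℚᵘ-ℕ→ℚ n))
    (ℚᵘ.*≤* (subst₂ ℤ._≤_ (sym (ℤP.*-identityʳ (ℤ.+ m))) (sym (ℤP.*-identityʳ (ℤ.+ n))) (ℤ.+≤+ m≤n)))))

  ℕ→ℚ-* : ∀ m n → ℕ→ℚ (m ℕ.* n) ≡ ℕ→ℚ m * ℕ→ℚ n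
  ℕ→ℚ-* m n = toℚᵘ-injective (ℚᵘP.≃-trans (toℚᵘ-ℕ→ℚ (m ℕ.* n)) (ℚᵘP.≃-trans (ℚᵘ.*≡* (cong₂ ℤ._*_ (ℤP.pos-* m n) refl))
    (ℚᵘP.≃-trans (ℚᵘP.*-cong (ℚᵘP.≃-sym (toℚᵘ-ℕ→ℚ m)) (ℚᵘP.≃-sym (toℚᵘ-ℕ→ℚ n))) (ℚᵘP.≃-sym (toℚᵘ-homo-* (ℕ→ℚ m) (ℕ→ℚ n))))))

  ℕ→ℚ-+ : ∀ m n → ℕ→ℚ (m ℕ.+ n) ≡ ℕ→ℚ m + ℕ→ℚ n
  ℕ→ℚ-+ m n = toℚᵘ-injective (ℚᵘP.≃-trans (toℚᵘ-ℕ→ℚ (m ℕ.+ n)) (ℚᵘP.≃-trans (ℚᵘ.*≡* (cong (ℤ._* ℤ.1ℤ) (trans (ℤP.pos-+ m n) (sym (cong₂ ℤ._+_ (ℤP.*-identityʳ (ℤ.+ m)) (ℤP.*-identityʳ (ℤ.+ n)))))))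
    (ℚᵘP.≃-trans (ℚᵘP.+-cong (ℚᵘP.≃-sym (toℚᵘ-ℕ→ℚ m)) (ℚᵘP.≃-sym (toℚᵘ-ℕ→ℚ n))) (ℚᵘP.≃-sym (toℚᵘ-homo-+ (ℕ→ℚ m) (ℕ→ℚ n))))))

  ℕ→ℚ-inverse : ∀ k → ℕ→ℚ (suc k) * ((ℤ.+ 1) / suc k) ≡ 1ℚ
  ℕ→ℚ-inverse k = toℚᵘ-injective (ℚᵘP.≃-trans (toℚᵘ-homo-* (ℕ→ℚ (suc k)) ((ℤ.+ 1) / suc k))
    (ℚᵘP.≃-trans (ℚᵘP.*-cong (toℚᵘ-ℕ→ℚ (suc k)) (toℚᵘ-fromℚᵘ (mkℚᵘ (ℤ.+ 1) k)))
      (ℚᵘ.*≡* (cong ℤ.+_ (ring k)))))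
    where
    ring : ∀ k → suc k ℕ.* 1 ℕ.* 1 ≡ 1 ℕ.* (1 ℕ.* suc k)
    ring = solve-∀

  0≤ℕ→ℚ : ∀ n → 0ℚ ≤ ℕ→ℚ n
  0≤ℕ→ℚ n = ℕ→ℚ-mono {0} {n} ℕ.z≤n

  *-mono-≤-nonNeg : ∀ {p q r s} → 0ℚ ≤ q → 0ℚ ≤ r → p ≤ q → r ≤ s → p * r ≤ q * s
  *-mono-≤-nonNeg {p} {q} {r} {s} 0≤q 0≤r p≤q r≤s =
    ≤-trans (*-monoʳ-≤-nonNeg r {{nonNegative 0≤r}} p≤q) (*-monoˡ-≤-nonNeg q {{nonNegative 0≤q}} r≤s)

  -- multiset i k counts multisets of size k from i symbols; its generating function in k is (1 - x)^(-i).
  multiset : ℕ → ℕ → ℕ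
  multiset i       zero    = 1
  multiset zero    (suc k) = 0
  multiset (suc i) (suc k) = multiset i (suc k) ℕ.+ multiset (suc i) k

  private
    -- The ratio (i + k) / (k + 1) of consecutive coefficients of (1 - x)^(-i), with the denominator
    -- cleared.
    multiset-suc : ∀ i k → suc k ⊛ multiset i (suc k) ≡ (i ⊕ k) ⊛ multiset i k
    multiset-suc zero    zero    = refl
    multiset-suc zero    (suc k) = trans (ℕP.*-zeroʳ (suc (suc k))) (sym (ℕP.*-zeroʳ (suc k)))
    multiset-suc (suc i) zero    = begin
      1 ⊛ (multiset i 1 ⊕ 1)  ≡⟨ ring₁ (multiset i 1) ⟩
      1 ⊛ multiset i 1 ⊕ 1  ≡⟨ cong (_⊕ 1) (multiset-suc i 0) ⟩
      (i ⊕ 0) ⊛ 1 ⊕ 1  ≡⟨ ring₂ i ⟩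
      (suc i ⊕ 0) ⊛ 1  ∎
      where
      open ≡-Reasoning
      ring₁ : ∀ x → 1 ⊛ (x ⊕ 1) ≡ 1 ⊛ x ⊕ 1
      ring₁ = solve-∀
      ring₂ : ∀ i → (i ⊕ 0) ⊛ 1 ⊕ 1 ≡ (suc i ⊕ 0) ⊛ 1
      ring₂ = solve-∀
    multiset-suc (suc i) (suc j) = begin
      suc (suc j) ⊛ (multiset i (suc (suc j)) ⊕ (x ⊕ y))  ≡⟨ ℕP.*-distribˡ-+ (suc (suc j)) (multiset i (suc (suc j))) (x ⊕ y) ⟩
      suc (suc j) ⊛ multiset i (suc (suc j)) ⊕ suc (suc j) ⊛ (x ⊕ y) ≡⟨ cong (_⊕ suc (suc j) ⊛ (x ⊕ y)) (multiset-suc i (suc j)) ⟩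
      (i ⊕ suc j) ⊛ x ⊕ suc (suc j) ⊛ (x ⊕ y)  ≡⟨ ring₁ i j x y ⟩
      i ⊛ x ⊕ suc j ⊛ x ⊕ suc (suc j) ⊛ (x ⊕ y)  ≡⟨ cong (λ z → i ⊛ x ⊕ z ⊕ suc (suc j) ⊛ (x ⊕ y)) cancelled ⟩
      i ⊛ x ⊕ i ⊛ y ⊕ suc (suc j) ⊛ (x ⊕ y)  ≡⟨ ring₂ i j x y ⟩
      (suc i ⊕ suc j) ⊛ (x ⊕ y)  ∎
      where
      open ≡-Reasoning
      x = multiset i (suc j)
      y = multiset (suc i) j
      ring₁ : ∀ i j x y → (i ⊕ suc j) ⊛ x ⊕ suc (suc j) ⊛ (x ⊕ y) ≡ i ⊛ x ⊕ suc j ⊛ x ⊕ suc (suc j) ⊛ (x ⊕ y)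
      ring₁ = solve-∀
      ring₂ : ∀ i j x y → i ⊛ x ⊕ i ⊛ y ⊕ suc (suc j) ⊛ (x ⊕ y) ≡ (suc i ⊕ suc j) ⊛ (x ⊕ y)
      ring₂ = solve-∀
      ring₃ : ∀ i j y → (suc i ⊕ j) ⊛ y ≡ i ⊛ y ⊕ suc j ⊛ y
      ring₃ = solve-∀
      cancelled : suc j ⊛ x ≡ i ⊛ y
      cancelled = ℕP.+-cancelʳ-≡ (suc j ⊛ y) (suc j ⊛ x) (i ⊛ y) (trans (sym (ℕP.*-distribˡ-+ (suc j) x y)) (trans (multiset-suc (suc i) j) (ring₃ i j y)))

    -- 2^N times the sum of `multiset i k` / 2^k over k < N: a truncation of (1 - 1/2)^(-i) with
    -- denominators cleared.
    partial : ℕ → ℕ → ℕ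
    partial i zero    = 0
    partial i (suc N) = 2 ⊛ (partial i N ⊕ multiset i N)

    partial-pascal : ∀ i N → partial (suc i) (suc N) ≡ partial i (suc N) ⊕ partial (suc i) N
    partial-pascal i zero    = refl
    partial-pascal i (suc N) = trans (cong (λ z → 2 ⊛ (z ⊕ (multiset i (suc N) ⊕ multiset (suc i) N))) (partial-pascal i N))
      (ring (partial i (suc N)) (partial (suc i) N) (multiset i (suc N)) (multiset (suc i) N))
      where
      ring : ∀ a b c d → 2 ⊛ ((a ⊕ b) ⊕ (c ⊕ d)) ≡ 2 ⊛ (a ⊕ c) ⊕ 2 ⊛ (b ⊕ d)
      ring = solve-∀

    -- The truncated series is at most 2^i. Pascal's rule for `multiset` passes to the truncations,
    -- and each of its two summands is at most half of the bound.
    partial≤ : ∀ i N → partial i N ℕ.≤ 2 ^ (i ⊕ N)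
    partial≤ i       zero          = ℕ.z≤n
    partial≤ zero    (suc zero)    = ℕP.≤-refl
    partial≤ zero    (suc (suc N)) = ℕP.*-monoʳ-≤ 2 (ℕP.≤-trans (ℕP.≤-reflexive (ℕP.+-identityʳ _)) (partial≤ zero (suc N)))
    partial≤ (suc i) (suc N)       = ℕP.≤-trans (ℕP.≤-reflexive (partial-pascal i N)) (ℕP.≤-trans (ℕP.+-mono-≤ (partial≤ i (suc N)) (partial≤ (suc i) N))
      (ℕP.≤-reflexive (trans (cong (λ e → 2 ^ (i ⊕ suc N) ⊕ 2 ^ e) (sym (ℕP.+-suc i N))) (cong (2 ^ (i ⊕ suc N) ⊕_) (sym (ℕP.+-identityʳ (2 ^ (i ⊕ suc N))))))))

  -- For 2q ≤ i the series of exp q is dominated termwise by that of (1 - 1/2)^(-i) = 2^i.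
  module _ (q : ℚ) (i : ℕ) (0≤q : 0ℚ ≤ q) (2q≤i : ℕ→ℚ 2 * q ≤ ℕ→ℚ i) where

    private
      open ≤-Reasoning

      recip : ℕ → ℚ
      recip k = (ℤ.+ 1) / suc k

      0≤recip : ∀ k → 0ℚ ≤ recip k
      0≤recip k = nonNegative⁻¹ (recip k) {{normalize-nonNeg 1 (suc k)}}

      -- From k to k + 1 the left side is multiplied by 2 q / (k + 1) ≤ i / (k + 1), the right side
      -- by (i + k) / (k + 1).
      term≤ : ∀ k → expTerm q k * ℕ→ℚ (2 ^ k) ≤ ℕ→ℚ (multiset i k)
      term≤ zero    = ≤-refl
      term≤ (suc k) = begin
        E * q * recip k * ℕ→ℚ (2 ℕ.* 2 ^ k)  ≡⟨ cong (E * q * recip k *_) (ℕ→ℚ-* 2 (2 ^ k)) ⟩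
        E * q * recip k * (ℕ→ℚ 2 * ℕ→ℚ (2 ^ k))  ≡⟨ rearrange E q (recip k) (ℕ→ℚ 2) (ℕ→ℚ (2 ^ k)) ⟩
        E * ℕ→ℚ (2 ^ k) * (ℕ→ℚ 2 * q * recip k)  ≤⟨ *-mono-≤-nonNeg (0≤ℕ→ℚ (multiset i k)) 0≤2qr (term≤ k) (*-monoʳ-≤-nonNeg (recip k) {{nonNegative (0≤recip k)}} 2q≤i) ⟩
        ℕ→ℚ (multiset i k) * (ℕ→ℚ i * recip k)  ≡⟨ *-assoc (ℕ→ℚ (multiset i k)) (ℕ→ℚ i) (recip k) ⟨
        ℕ→ℚ (multiset i k) * ℕ→ℚ i * recip k  ≡⟨ cong (_* recip k) (ℕ→ℚ-* (multiset i k) i) ⟨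
        ℕ→ℚ (multiset i k ℕ.* i) * recip k  ≤⟨ *-monoʳ-≤-nonNeg (recip k) {{nonNegative (0≤recip k)}} (ℕ→ℚ-mono count≤) ⟩
        ℕ→ℚ (multiset i (suc k) ℕ.* suc k) * recip k  ≡⟨ cong (_* recip k) (ℕ→ℚ-* (multiset i (suc k)) (suc k)) ⟩
        ℕ→ℚ (multiset i (suc k)) * ℕ→ℚ (suc k) * recip k  ≡⟨ *-assoc (ℕ→ℚ (multiset i (suc k))) (ℕ→ℚ (suc k)) (recip k) ⟩
        ℕ→ℚ (multiset i (suc k)) * (ℕ→ℚ (suc k) * recip k)  ≡⟨ cong (ℕ→ℚ (multiset i (suc k)) *_) (ℕ→ℚ-inverse k) ⟩
        ℕ→ℚ (multiset i (suc k)) * 1ℚ  ≡⟨ *-identityʳ (ℕ→ℚ (multiset i (suc k))) ⟩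
        ℕ→ℚ (multiset i (suc k))  ∎
        where
        E = expTerm q k
        count≤ : multiset i k ℕ.* i ℕ.≤ multiset i (suc k) ℕ.* suc k
        count≤ = ℕP.≤-trans (ℕP.≤-reflexive (ℕP.*-comm (multiset i k) i)) (ℕP.≤-trans (ℕP.*-monoˡ-≤ (multiset i k) (ℕP.m≤m+n i k))
          (ℕP.≤-reflexive (trans (sym (multiset-suc i k)) (ℕP.*-comm (suc k) (multiset i (suc k))))))
        0≤2q : 0ℚ ≤ ℕ→ℚ 2 * q
        0≤2q = *-mono-≤-nonNeg {0ℚ} {ℕ→ℚ 2} {0ℚ} {q} (0≤ℕ→ℚ 2) ≤-refl (0≤ℕ→ℚ 2) 0≤q
        0≤2qr : 0ℚ ≤ ℕ→ℚ 2 * q * recip k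
        0≤2qr = *-mono-≤-nonNeg {0ℚ} {ℕ→ℚ 2 * q} {0ℚ} {recip k} 0≤2q ≤-refl 0≤2q (0≤recip k)
        rearrange : ∀ e q r t u → e * q * r * (t * u) ≡ e * u * (t * q * r)
        rearrange e q r t u = trans (cong (e * q * r *_) (*-comm t u)) (trans (sym (*-assoc (e * q * r) u t)) (trans (cong (_* t) (trans (*-assoc (e * q) r u) (trans (*-assoc e q (r * u)) (trans (cong (e *_) (trans (sym (*-assoc q r u)) (*-comm (q * r) u))) (sym (*-assoc e u (q * r)))))))
          (trans (*-assoc (e * u) (q * r) t) (cong (e * u *_) (trans (*-comm (q * r) t) (sym (*-assoc t q r)))))))

      partial-sum≤ : ∀ N → expPartial q N * ℕ→ℚ (2 ^ N) ≤ ℕ→ℚ (partial i N)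
      partial-sum≤ zero    = ≤-refl
      partial-sum≤ (suc N) = begin
        (S + E) * ℕ→ℚ (2 ℕ.* 2 ^ N)  ≡⟨ cong ((S + E) *_) (ℕ→ℚ-* 2 (2 ^ N)) ⟩
        (S + E) * (ℕ→ℚ 2 * ℕ→ℚ (2 ^ N))  ≡⟨ cong ((S + E) *_) (*-comm (ℕ→ℚ 2) (ℕ→ℚ (2 ^ N))) ⟩
        (S + E) * (ℕ→ℚ (2 ^ N) * ℕ→ℚ 2)  ≡⟨ *-assoc (S + E) (ℕ→ℚ (2 ^ N)) (ℕ→ℚ 2) ⟨
        (S + E) * ℕ→ℚ (2 ^ N) * ℕ→ℚ 2  ≡⟨ cong (_* ℕ→ℚ 2) (*-distribʳ-+ (ℕ→ℚ (2 ^ N)) S E) ⟩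
        (S * ℕ→ℚ (2 ^ N) + E * ℕ→ℚ (2 ^ N)) * ℕ→ℚ 2  ≤⟨ *-monoʳ-≤-nonNeg (ℕ→ℚ 2) {{nonNegative (0≤ℕ→ℚ 2)}} (+-mono-≤ (partial-sum≤ N) (term≤ N)) ⟩
        (ℕ→ℚ (partial i N) + ℕ→ℚ (multiset i N)) * ℕ→ℚ 2  ≡⟨ cong (_* ℕ→ℚ 2) (ℕ→ℚ-+ (partial i N) (multiset i N)) ⟨
        ℕ→ℚ (partial i N ℕ.+ multiset i N) * ℕ→ℚ 2  ≡⟨ *-comm (ℕ→ℚ (partial i N ℕ.+ multiset i N)) (ℕ→ℚ 2) ⟩
        ℕ→ℚ 2 * ℕ→ℚ (partial i N ℕ.+ multiset i N)  ≡⟨ ℕ→ℚ-* 2 (partial i N ℕ.+ multiset i N) ⟨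
        ℕ→ℚ (2 ℕ.* (partial i N ℕ.+ multiset i N))  ∎
        where
        S = expPartial q N
        E = expTerm q N

    expPartial≤2^ : ∀ N → expPartial q N ≤ ℕ→ℚ (2 ^ i)
    expPartial≤2^ N = *-cancelʳ-≤-pos (ℕ→ℚ (2 ^ N)) {{normalize-pos (2 ^ N) 1 {{_}} {{ℕP.m^n≢0 2 N}}}} (begin
      expPartial q N * ℕ→ℚ (2 ^ N)  ≤⟨ partial-sum≤ N ⟩
      ℕ→ℚ (partial i N)  ≤⟨ ℕ→ℚ-mono (partial≤ i N) ⟩
      ℕ→ℚ (2 ^ (i ℕ.+ N))  ≡⟨ cong ℕ→ℚ (ℕP.^-distribˡ-+-* 2 i N) ⟩
      ℕ→ℚ (2 ^ i ℕ.* 2 ^ N)  ≡⟨ ℕ→ℚ-* (2 ^ i) (2 ^ N) ⟩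
      ℕ→ℚ (2 ^ i) * ℕ→ℚ (2 ^ N)  ∎)

open Summation
open N
open Exponential using (ℕ→ℚ-mono; ℕ→ℚ-*; ℕ→ℚ-inverse; 0≤ℕ→ℚ; *-mono-≤-nonNeg; expPartial≤2^)
open import Data.Nat
open import Data.Nat.Properties
open import Data.Nat.Divisibility
open import Data.Nat.DivMod using (_/_; _%_; m≡m%n+[m/n]*n; m%n<n; m/n*n≤m)
open import Data.Nat.GCD using (gcd; gcd[m,n]∣m; gcd[m,n]∣n; gcd-greatest; gcd-GCD; c*gcd[m,n]≡gcd[cm,cn]; module Bézout)
open import Data.Nat.Coprimality as Coprimality using (Coprime; coprime-divisor; coprime-Bézout; coprime⇒gcd≡1; gcd≡1⇒coprime)
open import Data.Nat.Primality
open import Data.Nat.Primality.Factorisation using (factorise)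
open import Data.Nat.ListAction using (product)
open import Data.Nat.ListAction.Properties using (product-↭; ∈⇒∣product)
open import Data.Nat.Induction using (<-wellFounded)
open import Data.Nat.Tactic.RingSolver using (solve-∀)
open import Induction.WellFounded using (Acc; acc)
open import Data.Integer as ℤ using (ℤ)
import Data.Integer.Properties as ℤP
import Data.Integer.Divisibility.Signed as S
import Data.Integer.Tactic.RingSolver as ℤSolver
open import Data.Rational as ℚ using (ℚ; 0ℚ; 1ℚ)
import Data.Rational.Properties as ℚP
open import Data.List using (List; []; _∷_; _++_; length; filter; map; upTo; replicate; applyUpTo; cartesianProduct)
open import Data.List.Properties using (length-map; length-++; length-replicate; length-applyUpTo)
open import Data.List.Membership.Propositional using (_∈_)
open import Data.List.Membership.Propositional.Properties using (∈-upTo⁻; ∈-upTo⁺; ∈-applyUpTo⁻; ∈-applyUpTo⁺; ∈-filter⁺; ∈-filter⁻; ∈-++⁻; ∈-map⁻)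
open import Data.List.Membership.Propositional.Properties.WithK using (unique∧set⇒bag)
open import Data.List.Relation.Binary.BagAndSetEquality using (∼bag⇒↭)
open import Data.List.Relation.Unary.All as All using (All; []; _∷_)
open import Data.List.Relation.Unary.All.Properties using (all-filter)
open import Data.List.Relation.Unary.Any using (here; there)
open import Data.List.Relation.Unary.Unique.Propositional using (Unique)
import Data.List.Relation.Unary.Unique.Propositional.Properties as Unique
open import Data.Product using (Σ; Σ-syntax; ∃; _×_; _,_; proj₁; proj₂)
open import Data.Sum using (_⊎_; inj₁; inj₂; [_,_]′)
open import Data.Empty using (⊥; ⊥-elim)
open import Data.Unit using (tt)
open import Function using (_∘_; id; mk⇔)
open import Relation.Nullary using (¬_; Dec; yes; no)
open import Relation.Nullary.Decidable using (_×-dec_; ¬?; decidable-stable)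
open import Relation.Binary.PropositionalEquality hiding (J)

-- Divisors and sieving

^-distribʳ-* : ∀ k m n → (m * n) ^ k ≡ m ^ k * n ^ k
^-distribʳ-* zero    m n = refl
^-distribʳ-* (suc k) m n = trans (cong (m * n *_) (^-distribʳ-* k m n)) ([m*n]*[o*p]≡[m*o]*[n*p] m n (m ^ k) (n ^ k))

^-cancelˡ-≤ : ∀ k .{{_ : NonZero k}} {m n} → m ^ k ≤ n ^ k → m ≤ n
^-cancelˡ-≤ k {m} {n} le with m ≤? n
... | yes m≤n = m≤n
... | no  m≰n = ⊥-elim (<⇒≱ (^-monoˡ-< k (≰⇒> m≰n)) le)

n<2^n : ∀ n → n < 2 ^ n
n<2^n zero    = s≤s z≤n
n<2^n (suc n) = ≤-trans (s≤s (n<2^n n)) (≤-trans (+-monoˡ-≤ (2 ^ n) (m^n>0 2 n)) (≤-reflexive (cong ((2 ^ n) +_) (sym (+-identityʳ (2 ^ n))))))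

abstract
  log : ∀ b → 2 ≤ b → ∀ x → 1 ≤ x → ∃ λ k → b ^ k ≤ x × x < b ^ suc k
  log b b≥2 (suc zero)    _ = 0 , ≤-refl , ≤-trans b≥2 (≤-reflexive (sym (*-identityʳ b)))
  log b b≥2 (suc (suc x)) _ = let (k , lo , hi) = log b b≥2 (suc x) (s≤s z≤n) in
    [ (λ sx< → k , m≤n⇒m≤1+n lo , sx<)
    , (λ eq → suc k , ≤-reflexive (sym eq) , subst (_< b ^ suc (suc k)) (sym eq) (^-monoʳ-< b b≥2 (n<1+n (suc k)))) ]′ (m≤n⇒m<n∨m≡n hi)

prime≥2 : ∀ {q} → Prime q → 2 ≤ q
prime≥2 pq = nonTrivial⇒n>1 _ {{prime⇒nonTrivial pq}}

prime∤⇒coprime : ∀ {q n} → Prime q → ¬ q ∣ n → Coprime q n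
prime∤⇒coprime pq q∤n (d∣q , d∣n) with prime⇒irreducible pq d∣q
... | inj₁ d≡1 = d≡1
... | inj₂ refl = ⊥-elim (q∤n d∣n)

coprime-*⁺ : ∀ {u a b} → Coprime u a → Coprime u b → Coprime u (a * b)
coprime-*⁺ ca cb (d∣u , d∣ab) = cb (d∣u , coprime-divisor (λ (e∣d , e∣a) → ca (∣-trans e∣d d∣u , e∣a)) d∣ab)

coprime-*⁻ʳ : ∀ {u} a {b} → Coprime u (a * b) → Coprime u b
coprime-*⁻ʳ a c (d∣u , d∣b) = c (d∣u , ∣n⇒∣m*n a d∣b)

coprime-*-∣ : ∀ {a b u} → Coprime a b → a ∣ u → b ∣ u → a * b ∣ u
coprime-*-∣ {a} {b} c a∣u (divides k refl) =
  subst (_∣ k * b) (*-comm b a) (subst (b * a ∣_) (*-comm b k) (*-monoʳ-∣ b (coprime-divisor c (subst (a ∣_) (*-comm k b) a∣u))))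

extract-power : ∀ q → 2 ≤ q → ∀ z → 1 ≤ z → ∃ λ a → ∃ λ z' → z ≡ q ^ a * z' × ¬ q ∣ z'
extract-power q q≥2 z z≥1 = go z z≥1 (<-wellFounded z)
  where
  go : ∀ z → 1 ≤ z → Acc _<_ z → ∃ λ a → ∃ λ z' → z ≡ q ^ a * z' × ¬ q ∣ z'
  go z z≥1 (acc rs) with q ∣? z
  ... | no q∤z = 0 , z , sym (+-identityʳ z) , q∤z
  ... | yes (divides zero refl) = ⊥-elim (<-irrefl refl z≥1)
  ... | yes (divides (suc k) refl)
      with a , z' , eq , q∤z' ← go (suc k) (s≤s z≤n) (rs (m<m*n (suc k) q q≥2)) =
    suc a , z' , trans (*-comm (suc k) q) (trans (cong (q *_) eq) (sym (*-assoc q (q ^ a) z'))) , q∤z'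

-- The cofactor of z decides: either it contains a factor q, or it is coprime to q and, dividing a
-- power of q, equals 1.
∣-prime-power : ∀ {q} → Prime q → ∀ a {z} → z ∣ q ^ suc a → z ∣ q ^ a ⊎ z ≡ q ^ suc a
∣-prime-power {q} pq a {z} (divides y eq) with q ∣? y
... | yes (divides y' refl) = inj₁ (divides y' (*-cancelˡ-≡ (q ^ a) (y' * z) q {{prime⇒nonZero pq}}
        (trans eq (trans (cong (_* z) (*-comm y' q)) (*-assoc q y' z)))))
... | no q∤y = inj₂ (sym (trans eq (trans (cong (_* z) (y≡1 (suc a) (divides z (trans eq (*-comm y z))))) (*-identityˡ z))))
  where
  y≡1 : ∀ k → y ∣ q ^ k → y ≡ 1
  y≡1 zero    y∣1 = ∣1⇒≡1 y∣1
  y≡1 (suc k) y∣  = y≡1 k (coprime-divisor (Coprimality.sym (prime∤⇒coprime pq q∤y)) y∣)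

divisors : ℕ → List ℕ
divisors n = filter (_∣? n) (range1 n)

∈-divisors⁺ : ∀ {n k} → 1 ≤ n → k ∣ n → k ∈ divisors n
∈-divisors⁺ {n} {zero}  n≥1 k∣n = ⊥-elim (<-irrefl (sym (0∣⇒≡0 k∣n)) n≥1)
∈-divisors⁺ {n} {suc k} n≥1 k∣n = ∈-filter⁺ (_∣? n) (range1⁺ (s≤s z≤n) (∣⇒≤ {{>-nonZero n≥1}} k∣n)) k∣n

d≡∑ : ∀ n → d n ≡ ∑ (range1 n) (λ k → 𝟙 (k ∣? n))
d≡∑ n = length-filter (_∣? n) (range1 n)

∑-𝟙∣ : ∀ n c → 1 ≤ c → c ≤ n → ∑ (range1 n) (λ k → 𝟙 (k ∣? c)) ≡ d c
∑-𝟙∣ n c c≥1 c≤n with ≤⇒≤′ c≤n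
... | ≤′-refl = sym (d≡∑ c)
... | ≤′-step {n = n'} c≤n' = trans (∑-range1-suc n')
        (trans (cong₂ _+_ (∑-𝟙∣ n' c c≥1 (≤′⇒≤ c≤n')) (𝟙-no (suc n' ∣? c) (λ s → <⇒≱ (s≤s (≤′⇒≤ c≤n')) (∣⇒≤ {{>-nonZero c≥1}} s))))
               (+-identityʳ (d c)))

d-mono-∣ : ∀ {a b} → 1 ≤ b → a ∣ b → d a ≤ d b
d-mono-∣ {zero}  {b} b≥1 a∣b = z≤n
d-mono-∣ {suc a} {b} b≥1 a∣b = ≤-trans
  (≤-reflexive (sym (∑-𝟙∣ b (suc a) (s≤s z≤n) (∣⇒≤ {{>-nonZero b≥1}} a∣b))))
  (≤-trans (∑-mono (range1 b) (λ {k} _ → 𝟙-mono (k ∣? suc a) (k ∣? b) (λ k∣ → ∣-trans k∣ a∣b))) (≤-reflexive (sym (d≡∑ b))))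

∑-𝟙≡≤1 : ∀ n c → ∑ (range1 n) (λ z → 𝟙 (z ≟ c)) ≤ 1
∑-𝟙≡≤1 n c = ≤-trans (≤-reflexive (∑-range1 n)) (∑-𝟙≤1 n (λ z → suc z ≟ c) (λ _ _ e e' → suc-injective (trans e (sym e'))))

-- Take u = gcd z a; then z / u is coprime to a / u and must divide b.
∣*⇒split : ∀ {a b z} → 1 ≤ a → z ∣ a * b → ∃ λ u → ∃ λ v → u ∣ a × v ∣ b × z ≡ u * v
∣*⇒split {a} {b} {z} a≥1 z∣ab with gcd[m,n]∣m z a | gcd[m,n]∣n z a
... | divides v eqz | divides a' eqa = g , v , gcd[m,n]∣n z a , v∣b , trans eqz (*-comm v g)
  where
  g = gcd z a
  instance g≢0 : NonZero g
           g≢0 = ≢-nonZero (λ g≡0 → <-irrefl (sym (trans eqa (trans (cong (a' *_) g≡0) (*-zeroʳ a')))) a≥1)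
  cop : Coprime v a'
  cop {e} (e∣v , e∣a') = ∣1⇒≡1 (*-cancelʳ-∣ g (subst (e * g ∣_) (sym (*-identityˡ g))
    (gcd-greatest (subst (e * g ∣_) (sym eqz) (*-monoˡ-∣ g e∣v)) (subst (e * g ∣_) (sym eqa) (*-monoˡ-∣ g e∣a')))))
  v∣b : v ∣ b
  v∣b = coprime-divisor cop (*-cancelʳ-∣ g (subst₂ _∣_ eqz
    (trans (cong (_* b) eqa) (trans (*-assoc a' g b) (trans (cong (a' *_) (*-comm g b)) (sym (*-assoc a' b g))))) z∣ab))

-- Products of a divisor of a and a divisor of b cover the divisors of a b, which gives an
-- inequality for arbitrary a and b, coprime or not.
d-submultiplicative : ∀ a b → 1 ≤ a → 1 ≤ b → d (a * b) ≤ d a * d b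
d-submultiplicative a b a≥1 b≥1 = begin
  d (a * b)  ≡⟨ d≡∑ (a * b) ⟩
  ∑ zs (λ z → 𝟙 (z ∣? (a * b)))  ≤⟨ ∑-mono zs (λ {z} _ → 𝟙≤ (z ∣? (a * b)) (λ z∣ab → hit (∣*⇒split a≥1 z∣ab))) ⟩
  ∑ zs (λ z → ∑ (divisors a) (λ u → ∑ (divisors b) (λ v → 𝟙 (z ≟ u * v))))  ≡⟨ ∑-swap zs (divisors a) ⟩
  ∑ (divisors a) (λ u → ∑ zs (λ z → ∑ (divisors b) (λ v → 𝟙 (z ≟ u * v))))  ≤⟨ ∑-bound (divisors a) (d b) (λ {u} _ → inner u) ⟩
  d a * d b  ∎
  where
  open ≤-Reasoning
  zs = range1 (a * b)
  inner : ∀ u → ∑ zs (λ z → ∑ (divisors b) (λ v → 𝟙 (z ≟ u * v))) ≤ d b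
  inner u = begin
    ∑ zs (λ z → ∑ (divisors b) (λ v → 𝟙 (z ≟ u * v)))  ≡⟨ ∑-swap zs (divisors b) ⟩
    ∑ (divisors b) (λ v → ∑ zs (λ z → 𝟙 (z ≟ u * v)))  ≤⟨ ∑-bound (divisors b) 1 (λ {v} _ → ∑-𝟙≡≤1 (a * b) (u * v)) ⟩
    d b * 1  ≡⟨ *-identityʳ (d b) ⟩
    d b  ∎
  hit : ∀ {z} → (∃ λ u → ∃ λ v → u ∣ a × v ∣ b × z ≡ u * v) → 1 ≤ ∑ (divisors a) (λ u → ∑ (divisors b) (λ v → 𝟙 (z ≟ u * v)))
  hit {z} (u , v , u∣a , v∣b , eq) = begin
    1  ≡⟨ 𝟙-yes (z ≟ u * v) eq ⟨
    𝟙 (z ≟ u * v)  ≤⟨ ∈⇒≤∑ (λ v → 𝟙 (z ≟ u * v)) (∈-divisors⁺ b≥1 v∣b) ⟩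
    ∑ (divisors b) (λ v → 𝟙 (z ≟ u * v))  ≤⟨ ∈⇒≤∑ (λ u → ∑ (divisors b) (λ v → 𝟙 (z ≟ u * v))) (∈-divisors⁺ a≥1 u∣a) ⟩
    ∑ (divisors a) (λ u → ∑ (divisors b) (λ v → 𝟙 (z ≟ u * v)))  ∎

d-prime-power : ∀ {q} → Prime q → ∀ a → d (q ^ a) ≤ suc a
d-prime-power pq zero = ≤-refl
d-prime-power {q} pq (suc a) = begin
  d (q ^ suc a)  ≡⟨ d≡∑ (q ^ suc a) ⟩
  ∑ zs (λ z → 𝟙 (z ∣? q ^ suc a))  ≤⟨ ∑-mono zs (λ {z} _ → 𝟙≤ (z ∣? q ^ suc a) (λ z∣ → hit z (∣-prime-power pq a z∣))) ⟩
  ∑ zs (λ z → 𝟙 (z ∣? q ^ a) + 𝟙 (z ≟ q ^ suc a))  ≡⟨ ∑-+ zs ⟩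
  ∑ zs (λ z → 𝟙 (z ∣? q ^ a)) + ∑ zs (λ z → 𝟙 (z ≟ q ^ suc a))  ≤⟨ +-mono-≤ (≤-reflexive (∑-𝟙∣ (q ^ suc a) (q ^ a) (m^n>0 q a) (^-monoʳ-≤ q (n≤1+n a)))) (∑-𝟙≡≤1 (q ^ suc a) (q ^ suc a)) ⟩
  d (q ^ a) + 1  ≤⟨ +-monoˡ-≤ 1 (d-prime-power pq a) ⟩
  suc a + 1  ≡⟨ +-comm (suc a) 1 ⟩
  suc (suc a)  ∎
  where
  open ≤-Reasoning
  instance _ = prime⇒nonZero pq
  zs = range1 (q ^ suc a)
  hit : ∀ z → z ∣ q ^ a ⊎ z ≡ q ^ suc a → 1 ≤ 𝟙 (z ∣? q ^ a) + 𝟙 (z ≟ q ^ suc a)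
  hit z (inj₁ z∣) = ≤-trans (≤-reflexive (sym (𝟙-yes (z ∣? q ^ a) z∣))) (m≤m+n _ _)
  hit z (inj₂ eq) = ≤-trans (≤-reflexive (sym (𝟙-yes (z ≟ q ^ suc a) eq))) (m≤n+m _ _)

-- The divisors of n and their multiples by q are disjoint sets of divisors of q n. This pays for
-- the doubling of the list in the sieve.
d-double : ∀ {q} → Prime q → ∀ n → 1 ≤ n → ¬ q ∣ n → 2 * d n ≤ d (q * n)
d-double {q} pq n n≥1 q∤n = begin
  2 * d n  ≡⟨ cong (d n +_) (+-identityʳ (d n)) ⟩
  d n + d n  ≡⟨ cong₂ _+_ (∑-𝟙∣ (q * n) n n≥1 (m≤n*m n q)) multiples ⟨
  ∑ zs (λ z → 𝟙 (z ∣? n)) + ∑ zs (λ z → 𝟙 (q ∣? z) * 𝟙 (z ∣? (q * n)))  ≡⟨ ∑-+ zs ⟨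
  ∑ zs (λ z → 𝟙 (z ∣? n) + 𝟙 (q ∣? z) * 𝟙 (z ∣? (q * n)))  ≤⟨ ∑-mono zs (λ {z} _ → disjoint z) ⟩
  ∑ zs (λ z → 𝟙 (z ∣? (q * n)))  ≡⟨ d≡∑ (q * n) ⟨
  d (q * n)  ∎
  where
  open ≤-Reasoning
  instance _ = prime⇒nonZero pq
  zs = range1 (q * n)
  multiples : ∑ zs (λ z → 𝟙 (q ∣? z) * 𝟙 (z ∣? (q * n))) ≡ d n
  multiples = trans (∑-multiples-range1 q n (λ z → 𝟙 (z ∣? (q * n))))
    (trans (∑-cong (range1 n) (λ {v} _ → 𝟙-cong ((q * v) ∣? (q * n)) (v ∣? n) (*-cancelˡ-∣ q) (*-monoʳ-∣ q))) (sym (d≡∑ n)))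
  disjoint : ∀ z → 𝟙 (z ∣? n) + 𝟙 (q ∣? z) * 𝟙 (z ∣? (q * n)) ≤ 𝟙 (z ∣? (q * n))
  disjoint z with z ∣? n | q ∣? z
  ... | yes z∣n | yes q∣z = ⊥-elim (q∤n (∣-trans q∣z z∣n))
  ... | yes z∣n | no _    = ≤-reflexive (sym (𝟙-yes (z ∣? (q * n)) (∣n⇒∣m*n q z∣n)))
  ... | no _    | yes _   = ≤-reflexive (+-identityʳ _)
  ... | no _    | no _    = z≤n

-- With q = ⌊a / K⌋: a + 1 ≤ (q + 1) K ≤ K 2^q, and q K ≤ a. This prices a power of a small prime in
-- the divisor bound.
suc^≤ : ∀ K .{{_ : NonZero K}} a → suc a ^ K ≤ K ^ K * 2 ^ a
suc^≤ K a = begin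
  suc a ^ K  ≤⟨ ^-monoˡ-≤ K step ⟩
  (K * 2 ^ q) ^ K  ≡⟨ ^-distribʳ-* K K (2 ^ q) ⟩
  K ^ K * (2 ^ q) ^ K  ≡⟨ cong ((K ^ K) *_) (^-*-assoc 2 q K) ⟩
  K ^ K * 2 ^ (q * K)  ≤⟨ *-monoʳ-≤ (K ^ K) (^-monoʳ-≤ 2 (m/n*n≤m a K)) ⟩
  K ^ K * 2 ^ a  ∎
  where
  open ≤-Reasoning
  q = a / K
  step : suc a ≤ K * 2 ^ q
  step = begin
    suc a  ≡⟨ cong suc (m≡m%n+[m/n]*n a K) ⟩
    suc (a % K) + q * K  ≤⟨ +-monoˡ-≤ (q * K) (m%n<n a K) ⟩
    suc q * K  ≤⟨ *-monoˡ-≤ K (n<2^n q) ⟩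
    2 ^ q * K  ≡⟨ *-comm (2 ^ q) K ⟩
    K * 2 ^ q  ∎

RoughFrom : ℕ → ℕ → Set
RoughFrom B z = ∀ q → Prime q → q ∣ z → B ≤ q

module _ (K : ℕ) .{{_ : NonZero K}} where

  private
    -- Each prime factor q, counted with multiplicity, at most doubles d; in the K-th power this
    -- costs 2^K ≤ q.
    rough-bound : ∀ ps → All Prime ps → (∀ {q} → q ∈ ps → 2 ^ K ≤ q) → d (product ps) ^ K ≤ product ps
    rough-bound []       []         le = ≤-reflexive (^-zeroˡ K)
    rough-bound (q ∷ ps) (pq ∷ pps) le = begin
      d (q * product ps) ^ K  ≤⟨ ^-monoˡ-≤ K (d-submultiplicative q (product ps) (<⇒≤ (prime≥2 pq)) (productOfPrimes≥1 pps)) ⟩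
      (d q * d (product ps)) ^ K  ≤⟨ ^-monoˡ-≤ K (*-monoˡ-≤ (d (product ps)) (subst (λ r → d r ≤ 2) (*-identityʳ q) (d-prime-power pq 1))) ⟩
      (2 * d (product ps)) ^ K  ≡⟨ ^-distribʳ-* K 2 (d (product ps)) ⟩
      2 ^ K * d (product ps) ^ K  ≤⟨ *-mono-≤ (le (here refl)) (rough-bound ps pps (le ∘ there)) ⟩
      q * product ps  ∎
      where open ≤-Reasoning

    -- Small primes are removed one at a time, each costing a factor K ^ K.
    bound-from : ∀ i B → B + i ≡ 2 ^ K → Σ[ C ∈ ℕ ] (∀ z → 1 ≤ z → RoughFrom B z → d z ^ K ≤ C * z)
    bound-from zero B eq = 1 , base
      where
      base : ∀ z → 1 ≤ z → RoughFrom B z → d z ^ K ≤ 1 * z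
      base z z≥1 rough with factorise z {{>-nonZero z≥1}}
      ... | record { factors = ps ; isFactorisation = refl ; factorsPrime = pps } =
        ≤-trans (rough-bound ps pps (λ q∈ → subst (_≤ _) (trans (sym (+-identityʳ B)) eq) (rough _ (All.lookup pps q∈) (∈⇒∣product q∈))))
                (≤-reflexive (sym (+-identityʳ _)))
    bound-from (suc i) B eq with bound-from i (suc B) (trans (sym (+-suc B i)) eq)
    ... | C , bound = K ^ K * C , step
      where
      open ≤-Reasoning
      weaken : ∀ z → RoughFrom B z → ¬ (Prime B × B ∣ z) → RoughFrom (suc B) z
      weaken z rough ¬B∣z q pq q∣z = ≤∧≢⇒< (rough q pq q∣z) (λ { refl → ¬B∣z (pq , q∣z) })
      step : ∀ z → 1 ≤ z → RoughFrom B z → d z ^ K ≤ K ^ K * C * z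
      step z z≥1 rough with prime? B
      ... | no ¬pB = begin
        d z ^ K  ≤⟨ bound z z≥1 (weaken z rough (¬pB ∘ proj₁)) ⟩
        C * z  ≤⟨ *-monoˡ-≤ z (m≤n*m C (K ^ K) {{m^n≢0 K K}}) ⟩
        K ^ K * C * z  ∎
      ... | yes pB with extract-power B (prime≥2 pB) z z≥1
      ... | a , z' , refl , B∤z' = begin
        d (B ^ a * z') ^ K  ≤⟨ ^-monoˡ-≤ K (d-submultiplicative (B ^ a) z' (m^n>0 B a) z'≥1) ⟩
        (d (B ^ a) * d z') ^ K  ≤⟨ ^-monoˡ-≤ K (*-monoˡ-≤ (d z') (d-prime-power pB a)) ⟩
        (suc a * d z') ^ K  ≡⟨ ^-distribʳ-* K (suc a) (d z') ⟩
        suc a ^ K * d z' ^ K  ≤⟨ *-mono-≤ (suc^≤ K a) (bound z' z'≥1 (weaken z' (λ q pq q∣ → rough q pq (∣n⇒∣m*n (B ^ a) q∣)) (B∤z' ∘ proj₂))) ⟩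
        (K ^ K * 2 ^ a) * (C * z')  ≤⟨ *-monoˡ-≤ (C * z') (*-monoʳ-≤ (K ^ K) (^-monoˡ-≤ a (prime≥2 pB))) ⟩
        (K ^ K * B ^ a) * (C * z')  ≡⟨ [m*n]*[o*p]≡[m*o]*[n*p] (K ^ K) (B ^ a) C z' ⟩
        K ^ K * C * (B ^ a * z')  ∎
        where
        instance _ = prime⇒nonZero pB
        z'≥1 : 1 ≤ z'
        z'≥1 = n≢0⇒n>0 (λ { refl → B∤z' (B ∣0) })

  divisor-bound : Σ[ C ∈ ℕ ] (∀ z → 1 ≤ z → d z ^ K ≤ C * z)
  divisor-bound with bound-from (2 ^ K) 0 refl
  ... | C , bound = C , λ z z≥1 → bound z z≥1 (λ _ _ _ → z≤n)

-- The divisor bound with exponent R (R + 1): once t ≥ C, it gives d z ^ (R (R + 1)) ≤ C z ≤ t^(R +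
-- 1), and an (R + 1)-th root is taken.
d-small : ∀ R .{{_ : NonZero R}} → Σ[ t₀ ∈ ℕ ] (∀ t → t₀ ≤ t → ∀ z → 1 ≤ z → z ≤ t ^ R → d z ^ R ≤ t)
d-small R with divisor-bound (R * suc R) {{m*n≢0 R (suc R)}}
... | C , bound = C , λ t C≤t z z≥1 z≤ → ^-cancelˡ-≤ (suc R) (begin
  (d z ^ R) ^ suc R  ≡⟨ ^-*-assoc (d z) R (suc R) ⟩
  d z ^ (R * suc R)  ≤⟨ bound z z≥1 ⟩
  C * z  ≤⟨ *-mono-≤ C≤t z≤ ⟩
  t * t ^ R  ∎)
  where open ≤-Reasoning

-- A signed list of divisors of n that detects coprimality to n; it plays the role of the Möbius function.
IsSieve : ℕ → List (ℤ × ℕ) → Set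
IsSieve n l = (∀ {s a} → (s , a) ∈ l → ℤ.∣ s ∣ ≤ 1 × a ∣ n) × length l ≤ d n
            × (∀ u → Z.∑ l (λ (s , a) → s ℤ.* Z.𝟙 (a ∣? u)) ≡ Z.𝟙 (gcd u n ≟ 1))

private
  flip : ℕ → ℤ × ℕ → ℤ × ℕ
  flip q (s , a) = ℤ.- s , q * a

  -- Inclusion-exclusion one prime at a time: a new prime q appends the entries with sign reversed
  -- and divisor multiplied by q, while a repeated prime leaves the list unchanged.
  sieve-product : ∀ ps → All Prime ps → Σ[ l ∈ List (ℤ × ℕ) ] IsSieve (product ps) l
  sieve-product [] [] = (ℤ.+ 1 , 1) ∷ [] , (λ { (here refl) → s≤s z≤n , ∣-refl }) , ≤-refl ,
    (λ u → trans (cong (λ z → (ℤ.+ 1 ℤ.* z) ℤ.+ ℤ.+ 0) (Z.𝟙-yes (1 ∣? u) (1∣ u)))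
                 (sym (Z.𝟙-yes (gcd u 1 ≟ 1) (∣1⇒≡1 (gcd[m,n]∣n u 1)))))
  sieve-product (q ∷ ps) (pq ∷ pps) with sieve-product ps pps | q ∣? product ps
  ... | l , div , len , detects | yes q∣n =
    l , (λ a∈ → proj₁ (div a∈) , ∣n⇒∣m*n q (proj₂ (div a∈))) ,
    ≤-trans len (d-mono-∣ (*-mono-≤ (<⇒≤ (prime≥2 pq)) (productOfPrimes≥1 pps)) (∣n⇒∣m*n q ∣-refl)) ,
    λ u → trans (detects u) (Z.𝟙-cong (gcd u n ≟ 1) (gcd u (q * n) ≟ 1)
      (λ g≡1 → let c = gcd≡1⇒coprime {u} {n} g≡1 in coprime⇒gcd≡1 {u} {q * n} (coprime-*⁺ (λ (e∣u , e∣q) → c (e∣u , ∣-trans e∣q q∣n)) c))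
      (λ g≡1 → coprime⇒gcd≡1 {u} {n} (coprime-*⁻ʳ q (gcd≡1⇒coprime {u} {q * n} g≡1))))
    where n = product ps
  ... | l , div , len , detects | no q∤n = l ++ map (flip q) l , div' , len' , detects'
    where
    n = product ps
    div' : ∀ {s a} → (s , a) ∈ l ++ map (flip q) l → ℤ.∣ s ∣ ≤ 1 × a ∣ q * n
    div' a∈ with ∈-++⁻ l a∈
    ... | inj₁ a∈l = proj₁ (div a∈l) , ∣n⇒∣m*n q (proj₂ (div a∈l))
    ... | inj₂ a∈m with ∈-map⁻ (flip q) a∈m
    ... | (s , a) , sa∈ , refl = ≤-trans (≤-reflexive (ℤP.∣-i∣≡∣i∣ s)) (proj₁ (div sa∈)) , *-monoʳ-∣ q (proj₂ (div sa∈))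
    len' : length (l ++ map (flip q) l) ≤ d (q * n)
    len' = begin
      length (l ++ map (flip q) l)  ≡⟨ length-++ l ⟩
      length l + length (map (flip q) l)  ≡⟨ cong (length l +_) (trans (length-map (flip q) l) (sym (+-identityʳ (length l)))) ⟩
      2 * length l  ≤⟨ *-monoʳ-≤ 2 len ⟩
      2 * d n  ≤⟨ d-double pq n (productOfPrimes≥1 pps) q∤n ⟩
      d (q * n)  ∎
      where open ≤-Reasoning
    detects' : ∀ u → Z.∑ (l ++ map (flip q) l) (λ (s , a) → s ℤ.* Z.𝟙 (a ∣? u)) ≡ Z.𝟙 (gcd u (q * n) ≟ 1)
    detects' u = begin
      Z.∑ (l ++ map (flip q) l) F  ≡⟨ Z.∑-++ l (map (flip q) l) ⟩
      Z.∑ l F ℤ.+ Z.∑ (map (flip q) l) F  ≡⟨ cong (λ w → Z.∑ l F ℤ.+ w) (Z.∑-map (flip q) l) ⟩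
      Z.∑ l F ℤ.+ Z.∑ l (λ (s , a) → ℤ.- s ℤ.* Z.𝟙 ((q * a) ∣? u))  ≡⟨ Z.∑-+ l ⟨
      Z.∑ l (λ (s , a) → s ℤ.* Z.𝟙 (a ∣? u) ℤ.+ ℤ.- s ℤ.* Z.𝟙 ((q * a) ∣? u)) ≡⟨ decide (q ∣? u) ⟩
      Z.𝟙 (gcd u (q * n) ≟ 1)  ∎
      where
      open ≡-Reasoning
      F : ℤ × ℕ → ℤ
      F (s , a) = s ℤ.* Z.𝟙 (a ∣? u)
      decide : Dec (q ∣ u) → Z.∑ l (λ (s , a) → s ℤ.* Z.𝟙 (a ∣? u) ℤ.+ ℤ.- s ℤ.* Z.𝟙 ((q * a) ∣? u)) ≡ Z.𝟙 (gcd u (q * n) ≟ 1)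
      -- Here q a ∣ u exactly when a ∣ u, so each entry cancels against its flipped copy.
      decide (yes q∣u) = trans
        (Z.∑-zero l (λ { {s , a} a∈ → trans (cong (λ z → s ℤ.* Z.𝟙 (a ∣? u) ℤ.+ ℤ.- s ℤ.* z)
            (Z.𝟙-cong ((q * a) ∣? u) (a ∣? u) (m*n∣⇒n∣ q a)
              (coprime-*-∣ (prime∤⇒coprime pq (λ q∣a → q∤n (∣-trans q∣a (proj₂ (div a∈))))) q∣u)))
            (trans (sym (ℤP.*-distribʳ-+ (Z.𝟙 (a ∣? u)) s (ℤ.- s))) (cong (ℤ._* Z.𝟙 (a ∣? u)) (ℤP.+-inverseʳ s))) }))
        (sym (Z.𝟙-no (gcd u (q * n) ≟ 1) (λ g≡1 → <-irrefl (sym (gcd≡1⇒coprime {u} {q * n} g≡1 (q∣u , m∣m*n n))) (prime≥2 pq))))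
      decide (no q∤u) = trans
        (Z.∑-cong l (λ { {s , a} _ → trans (cong (λ z → s ℤ.* Z.𝟙 (a ∣? u) ℤ.+ ℤ.- s ℤ.* z)
            (Z.𝟙-no ((q * a) ∣? u) (λ qa∣u → q∤u (m*n∣⇒m∣ q a qa∣u))))
            (trans (cong (λ w → s ℤ.* Z.𝟙 (a ∣? u) ℤ.+ w) (ℤP.*-zeroʳ (ℤ.- s))) (ℤP.+-identityʳ _)) }))
        (trans (detects u) (Z.𝟙-cong (gcd u n ≟ 1) (gcd u (q * n) ≟ 1)
          (λ g≡1 → coprime⇒gcd≡1 {u} {q * n} (coprime-*⁺ (Coprimality.sym (prime∤⇒coprime pq q∤u)) (gcd≡1⇒coprime {u} {n} g≡1)))
          (λ g≡1 → coprime⇒gcd≡1 {u} {n} (coprime-*⁻ʳ q (gcd≡1⇒coprime {u} {q * n} g≡1)))))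

sieve : ∀ n → 1 ≤ n → Σ[ l ∈ List (ℤ × ℕ) ] IsSieve n l
sieve n n≥1 with factorise n {{>-nonZero n≥1}}
... | record { factors = ps ; isFactorisation = refl ; factorsPrime = pps } = sieve-product ps pps

-- Congruences

_-ₙ_ : ℕ → ℕ → ℤ
a -ₙ b = (ℤ.+ a) ℤ.- (ℤ.+ b)

mod⇒∣ : ∀ {m a b} → a ≡ b mod m → (ℤ.+ m) S.∣ (a -ₙ b)
mod⇒∣ = S.∣ᵤ⇒∣

∣⇒mod : ∀ {m a b} → (ℤ.+ m) S.∣ (a -ₙ b) → a ≡ b mod m
∣⇒mod = S.∣⇒∣ᵤ

mod-refl : ∀ {m} a → a ≡ a mod m
mod-refl {m} a = subst (λ z → m ∣ ℤ.∣ z ∣) (sym (ℤP.+-inverseʳ (ℤ.+ a))) (m ∣0)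

mod-reflexive : ∀ {m a b} → a ≡ b → a ≡ b mod m
mod-reflexive {a = a} refl = mod-refl a

mod-sym : ∀ {m} a b → a ≡ b mod m → b ≡ a mod m
mod-sym {m} a b = subst (m ∣_) (ℤP.∣i-j∣≡∣j-i∣ (ℤ.+ a) (ℤ.+ b))

mod-trans : ∀ {m} a b c → a ≡ b mod m → b ≡ c mod m → a ≡ c mod m
mod-trans {m} a b c p q = ∣⇒mod {m} {a} {c} (subst ((ℤ.+ m) S.∣_) (eq (ℤ.+ a) (ℤ.+ b) (ℤ.+ c)) (S.∣m∣n⇒∣m+n (mod⇒∣ {m} {a} {b} p) (mod⇒∣ {m} {b} {c} q)))
  where
  eq : ∀ x y z → (x ℤ.- y) ℤ.+ (y ℤ.- z) ≡ x ℤ.- z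
  eq = ℤSolver.solve-∀

mod-+ : ∀ {m} a b c d → a ≡ b mod m → c ≡ d mod m → (a + c) ≡ (b + d) mod m
mod-+ {m} a b c d p q = ∣⇒mod {m} {a + c} {b + d} (subst ((ℤ.+ m) S.∣_)
  (trans (eq (ℤ.+ a) (ℤ.+ b) (ℤ.+ c) (ℤ.+ d)) (sym (cong₂ ℤ._-_ (ℤP.pos-+ a c) (ℤP.pos-+ b d))))
  (S.∣m∣n⇒∣m+n (mod⇒∣ {m} {a} {b} p) (mod⇒∣ {m} {c} {d} q)))
  where
  eq : ∀ x y z w → (x ℤ.- y) ℤ.+ (z ℤ.- w) ≡ (x ℤ.+ z) ℤ.- (y ℤ.+ w)
  eq = ℤSolver.solve-∀

mod-* : ∀ {m} a b c d → a ≡ b mod m → c ≡ d mod m → (a * c) ≡ (b * d) mod m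
mod-* {m} a b c d p q = ∣⇒mod {m} {a * c} {b * d} (subst ((ℤ.+ m) S.∣_)
  (trans (eq (ℤ.+ a) (ℤ.+ b) (ℤ.+ c) (ℤ.+ d)) (sym (cong₂ ℤ._-_ (ℤP.pos-* a c) (ℤP.pos-* b d))))
  (S.∣m∣n⇒∣m+n (S.∣m⇒∣m*n (ℤ.+ c) (mod⇒∣ {m} {a} {b} p)) (S.∣n⇒∣m*n (ℤ.+ b) (mod⇒∣ {m} {c} {d} q))))
  where
  eq : ∀ x y z w → (x ℤ.- y) ℤ.* z ℤ.+ y ℤ.* (z ℤ.- w) ≡ x ℤ.* z ℤ.- y ℤ.* w
  eq = ℤSolver.solve-∀

mod-^ : ∀ {m} a b k → a ≡ b mod m → (a ^ k) ≡ (b ^ k) mod m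
mod-^ a b zero    p = mod-refl 1
mod-^ a b (suc k) p = mod-* a b (a ^ k) (b ^ k) p (mod-^ a b k p)

mod-≤ : ∀ {m} a b → b ≤ a → m ∣ a ∸ b → a ≡ b mod m
mod-≤ {m} a b b≤a = subst (m ∣_) (sym (cong ℤ.∣_∣ (trans (ℤP.m-n≡m⊖n a b) (ℤP.⊖-≥ b≤a))))

mod-≤⁻ : ∀ {m} a b → b ≤ a → a ≡ b mod m → m ∣ a ∸ b
mod-≤⁻ {m} a b b≤a = subst (m ∣_) (cong ℤ.∣_∣ (trans (ℤP.m-n≡m⊖n a b) (ℤP.⊖-≥ b≤a)))

mod-+-multiple : ∀ {m} a k → m ∣ k → (k + a) ≡ a mod m
mod-+-multiple {m} a k m∣k = mod-≤ (k + a) a (m≤n+m a k) (subst (m ∣_) (sym (m+n∸n≡m k a)) m∣k)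

mod-0⁺ : ∀ {m} a → m ∣ a → a ≡ 0 mod m
mod-0⁺ a = mod-≤ a 0 z≤n

mod-0⁻ : ∀ {m} a → a ≡ 0 mod m → m ∣ a
mod-0⁻ a = mod-≤⁻ a 0 z≤n

mod-resp-∣ : ∀ {m} a b → a ≡ b mod m → m ∣ a → m ∣ b
mod-resp-∣ a b eq m∣a = mod-0⁻ b (mod-trans b a 0 (mod-sym a b eq) (mod-0⁺ a m∣a))

mod-% : ∀ {m} .{{_ : NonZero m}} a → (a % m) ≡ a mod m
mod-% {m} a = mod-sym a (a % m) (subst (λ z → z ≡ a % m mod m)
  (sym (trans (m≡m%n+[m/n]*n a m) (+-comm (a % m) _))) (mod-+-multiple (a % m) (a / m * m) (n∣m*n (a / m))))

private
  mod-unique-≤ : ∀ {m} a b → a < m → b ≤ a → a ≡ b mod m → a ≡ b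
  mod-unique-≤ {m} a b a<m b≤a eq = ≤-antisym (m∸n≡0⇒m≤n (small (mod-≤⁻ a b b≤a eq) (≤-<-trans (m∸n≤m a b) a<m))) b≤a
    where
    small : ∀ {k} → m ∣ k → k < m → k ≡ 0
    small {zero}  _   _   = refl
    small {suc k} m∣k k<m = ⊥-elim (<⇒≱ k<m (∣⇒≤ m∣k))

mod-unique : ∀ {m} a b → a < m → b < m → a ≡ b mod m → a ≡ b
mod-unique a b a<m b<m eq with ≤-total b a
... | inj₁ b≤a = mod-unique-≤ a b a<m b≤a eq
... | inj₂ a≤b = sym (mod-unique-≤ b a b<m a≤b (mod-sym a b eq))

mod-cancelʳ : ∀ {m} a b c → Coprime m c → (a * c) ≡ (b * c) mod m → a ≡ b mod m
mod-cancelʳ {m} a b c cop eq = coprime-divisor cop (subst (m ∣_) (trans (cong ℤ.∣_∣ lemma) (trans (ℤP.abs-* (a -ₙ b) (ℤ.+ c)) (*-comm _ c))) eq)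
  where
  dist : ∀ x y z → x ℤ.* z ℤ.- y ℤ.* z ≡ (x ℤ.- y) ℤ.* z
  dist = ℤSolver.solve-∀
  lemma : (a * c) -ₙ (b * c) ≡ (a -ₙ b) ℤ.* (ℤ.+ c)
  lemma = trans (cong₂ ℤ._-_ (ℤP.pos-* a c) (ℤP.pos-* b c)) (dist (ℤ.+ a) (ℤ.+ b) (ℤ.+ c))

mod-+-cancelˡ : ∀ {m} c a b → (c + a) ≡ (c + b) mod m → a ≡ b mod m
mod-+-cancelˡ {m} c a b = subst (λ z → m ∣ ℤ.∣ z ∣)
  (trans (cong₂ ℤ._-_ (ℤP.pos-+ c a) (ℤP.pos-+ c b)) (eq (ℤ.+ c) (ℤ.+ a) (ℤ.+ b)))
  where
  eq : ∀ x y z → (x ℤ.+ y) ℤ.- (x ℤ.+ z) ≡ y ℤ.- z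
  eq = ℤSolver.solve-∀

private
  abs-scale : ∀ k a b → ℤ.∣ (k * a) -ₙ (k * b) ∣ ≡ k * ℤ.∣ a -ₙ b ∣
  abs-scale k a b = trans (cong ℤ.∣_∣ (trans (cong₂ ℤ._-_ (ℤP.pos-* k a) (ℤP.pos-* k b)) (dist (ℤ.+ a) (ℤ.+ b) (ℤ.+ k)))) (ℤP.abs-* (ℤ.+ k) (a -ₙ b))
    where
    dist : ∀ x y z → z ℤ.* x ℤ.- z ℤ.* y ≡ z ℤ.* (x ℤ.- y)
    dist = ℤSolver.solve-∀

mod-*-scale : ∀ {m} k a b → a ≡ b mod m → (k * a) ≡ (k * b) mod (k * m)
mod-*-scale {m} k a b eq = subst (k * m ∣_) (sym (abs-scale k a b)) (*-monoʳ-∣ k eq)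

mod-*-unscale : ∀ {m} k .{{_ : NonZero k}} a b → (k * a) ≡ (k * b) mod (k * m) → a ≡ b mod m
mod-*-unscale {m} k a b eq = *-cancelˡ-∣ k (subst (k * m ∣_) (abs-scale k a b) eq)

-- Primitive roots and indices

inverse-mod : ∀ {m} c → Coprime m c → ∃ λ c' → (c' * c) ≡ 1 mod m
inverse-mod {m} c cop with coprime-Bézout cop
-- Here 1 + y c is a multiple of m, so y c ≡ -1; squaring removes the sign without leaving ℕ.
... | Bézout.+- x y eq = y * (c * y) , subst (λ z → z ≡ 1 mod m) (sym (reorder y c)) square
  where
  reorder : ∀ y c → y * (c * y) * c ≡ (y * c) * (y * c)
  reorder = solve-∀
  neg : (1 + y * c) ≡ 0 mod m
  neg = mod-0⁺ (1 + y * c) (subst (m ∣_) (sym eq) (n∣m*n x))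
  square : (y * c * (y * c)) ≡ 1 mod m
  square = mod-+-cancelˡ (y * c) (y * c * (y * c)) 1 (mod-trans (y * c + y * c * (y * c)) 0 (y * c + 1)
    (mod-trans _ ((y * c) * 0) 0 (subst (λ z → z ≡ y * c * 0 mod m) (trans (*-comm (y * c) (1 + y * c)) refl) (mod-* (y * c) (y * c) (1 + y * c) 0 (mod-refl (y * c)) neg)) (mod-reflexive (*-zeroʳ (y * c))))
    (mod-sym (y * c + 1) 0 (subst (λ z → z ≡ 0 mod m) (+-comm 1 (y * c)) neg)))
... | Bézout.-+ x y eq = y , subst (λ z → z ≡ 1 mod m) (trans (+-comm (x * m) 1) eq) (mod-+-multiple 1 (x * m) (n∣m*n x))

-- Monic integer polynomials, given by their coefficients below the leading one.
ev : List ℤ → ℤ → ℤ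
ev []       x = ℤ.1ℤ
ev (c ∷ cs) x = c ℤ.+ x ℤ.* ev cs x

-- Horner's scheme for division by x - r. The quotient is again monic, so its leading coefficient
-- stays implicit.
quotientBy : ℤ → List ℤ → List ℤ
quotientBy r []            = []
quotientBy r (c ∷ [])      = []
quotientBy r (c ∷ c' ∷ cs) = ev (c' ∷ cs) r ∷ quotientBy r (c' ∷ cs)

ev-quotientBy : ∀ x r c cs → ev (c ∷ cs) x ≡ ev (c ∷ cs) r ℤ.+ (x ℤ.- r) ℤ.* ev (quotientBy r (c ∷ cs)) x
ev-quotientBy x r c [] = lemma x r c
  where
  lemma : ∀ x r c → c ℤ.+ x ℤ.* ℤ.1ℤ ≡ c ℤ.+ r ℤ.* ℤ.1ℤ ℤ.+ (x ℤ.- r) ℤ.* ℤ.1ℤ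
  lemma = ℤSolver.solve-∀
ev-quotientBy x r c (c' ∷ cs) =
  trans (cong (λ e → c ℤ.+ x ℤ.* e) (ev-quotientBy x r c' cs)) (lemma x r c (ev (c' ∷ cs) r) (ev (quotientBy r (c' ∷ cs)) x))
  where
  lemma : ∀ x r c e q → c ℤ.+ x ℤ.* (e ℤ.+ (x ℤ.- r) ℤ.* q) ≡ c ℤ.+ r ℤ.* e ℤ.+ (x ℤ.- r) ℤ.* (e ℤ.+ x ℤ.* q)
  lemma = ℤSolver.solve-∀

length-quotientBy : ∀ r c cs → length (quotientBy r (c ∷ cs)) ≡ length cs
length-quotientBy r c []        = refl
length-quotientBy r c (c' ∷ cs) = cong suc (length-quotientBy r c' cs)

ev-power : ∀ k x → ev (replicate k ℤ.0ℤ) (ℤ.+ x) ≡ ℤ.+ (x ^ k)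
ev-power zero    x = refl
ev-power (suc k) x = trans (ℤP.+-identityˡ _) (trans (cong (ℤ.+ x ℤ.*_) (ev-power k x)) (sym (ℤP.pos-* x (x ^ k))))

-- Values at most 1 whose sum reaches the number of entries leave no room for a 0.
∑-full : {A : Set} {xs : List A} {f : A → ℕ} → (∀ {x} → x ∈ xs → f x ≤ 1) → length xs ≤ ∑ xs f → ∀ {x} → x ∈ xs → 1 ≤ f x
∑-full {xs = y ∷ xs} {f} le tot (here refl) = +-cancelʳ-≤ (length xs) 1 (f y)
  (≤-trans tot (+-monoʳ-≤ (f y) (≤-trans (∑-bound xs 1 (le ∘ there)) (≤-reflexive (*-identityʳ _)))))
∑-full {xs = y ∷ xs} {f} le tot (there x∈) = ∑-full (le ∘ there)
  (+-cancelˡ-≤ 1 (length xs) _ (≤-trans tot (+-monoˡ-≤ (∑ xs f) (le (here refl))))) x∈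

prime-divisor : ∀ m → 2 ≤ m → ∃ λ q → Prime q × q ∣ m
prime-divisor m m≥2 with factorise m {{>-nonZero (<⇒≤ m≥2)}}
... | record { factors = [] ; isFactorisation = eq } = ⊥-elim (<-irrefl (sym eq) m≥2)
... | record { factors = q ∷ ps ; isFactorisation = eq ; factorsPrime = pq ∷ _ } = q , pq , subst (q ∣_) (sym eq) (m∣m*n (product ps))

module Order (n : ℕ) (pr : Prime (suc n)) where

  p : ℕ
  p = suc n

  infix 4 _~_
  _~_ : ℕ → ℕ → Set
  a ~ b = a ≡ b mod p

  n≥1 : 1 ≤ n
  n≥1 = s≤s⁻¹ (prime≥2 pr)

  ∤-range : ∀ {z} → 1 ≤ z → z ≤ n → ¬ p ∣ z
  ∤-range {suc z} _ z≤ p∣z = <⇒≱ (s≤s z≤) (∣⇒≤ p∣z)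

  ∤-* : ∀ {a b} → ¬ p ∣ a → ¬ p ∣ b → ¬ p ∣ a * b
  ∤-* {a} {b} p∤a p∤b p∣ab with euclidsLemma a b pr p∣ab
  ... | inj₁ p∣a = p∤a p∣a
  ... | inj₂ p∣b = p∤b p∣b

  ∤-^ : ∀ {a} k → ¬ p ∣ a → ¬ p ∣ a ^ k
  ∤-^ zero    p∤a = λ p∣1 → <-irrefl (sym (∣1⇒≡1 p∣1)) (prime≥2 pr)
  ∤-^ (suc k) p∤a = ∤-* p∤a (∤-^ k p∤a)

  ~-cancelʳ : ∀ a b c → ¬ p ∣ c → a * c ~ b * c → a ~ b
  ~-cancelʳ a b c p∤c = mod-cancelʳ a b c (prime∤⇒coprime pr p∤c)

  ~-cancelˡ : ∀ c a b → ¬ p ∣ c → c * a ~ c * b → a ~ b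
  ~-cancelˡ c a b p∤c eq = ~-cancelʳ a b c p∤c (subst₂ _~_ (*-comm c a) (*-comm c b) eq)

  %-range : ∀ z → ¬ p ∣ z → 1 ≤ z % p × z % p ≤ n
  %-range z p∤z = n≢0⇒n>0 (λ z%p≡0 → p∤z (m%n≡0⇒n∣m z p z%p≡0)) , s≤s⁻¹ (m%n<n z p)

  -- Multiplication by x permutes the nonzero residues; comparing the two products of all of them
  -- gives x^n P ~ P, and P is cancelled.
  fermat : ∀ x → ¬ p ∣ x → x ^ n ~ 1
  fermat x p∤x = ~-cancelʳ (x ^ n) 1 (P n) (∤P n ≤-refl) (mod-trans (x ^ n * P n) (product ys) (1 * P n)
    (mod-sym (product ys) (x ^ n * P n) (prod~ n)) (mod-reflexive (trans (product-↭ perm) (sym (*-identityˡ (P n))))))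
    where
    P : ℕ → ℕ
    P k = product (applyUpTo suc k)
    f : ℕ → ℕ
    f i = (x * suc i) % p
    ys : List ℕ
    ys = applyUpTo f n
    ∤P' : ∀ k i → i + k ≤ n → ¬ p ∣ product (applyUpTo (λ j → suc (i + j)) k)
    ∤P' zero    i le = ∤-^ 0 p∤x
    ∤P' (suc k) i le = ∤-* (∤-range (s≤s z≤n) (≤-trans (s≤s (≤-reflexive (+-identityʳ i))) (≤-trans (m<m+n i (s≤s z≤n)) le)))
      (λ p∣ → ∤P' k (suc i) (≤-trans (≤-reflexive (sym (+-suc i k))) le)
        (subst (p ∣_) (cong product (ext k (λ j → cong suc (+-suc i j)))) p∣))
      where
      ext : ∀ {g h : ℕ → ℕ} k → (∀ j → g j ≡ h j) → applyUpTo g k ≡ applyUpTo h k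
      ext zero    eq = refl
      ext (suc k) eq = cong₂ _∷_ (eq 0) (ext k (eq ∘ suc))
    ∤P : ∀ k → k ≤ n → ¬ p ∣ P k
    ∤P k k≤n = ∤P' k 0 k≤n
    prod~' : ∀ k (g : ℕ → ℕ) → product (applyUpTo (λ i → (x * g i) % p) k) ~ x ^ k * product (applyUpTo g k)
    prod~' zero    g = mod-refl 1
    prod~' (suc k) g = subst (λ z → (x * g 0) % p * product (applyUpTo (λ i → (x * g (suc i)) % p) k) ~ z)
      ([m*n]*[o*p]≡[m*o]*[n*p] x (g 0) (x ^ k) (product (applyUpTo (g ∘ suc) k)))
      (mod-* ((x * g 0) % p) (x * g 0) _ _ (mod-% (x * g 0)) (prod~' k (g ∘ suc)))
    prod~ : ∀ k → product (applyUpTo f k) ~ x ^ k * P k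
    prod~ k = prod~' k suc
    inj : ∀ {i j} → i < n → j < n → f i ≡ f j → i ≡ j
    inj {i} {j} i<n j<n eq = suc-injective (mod-unique (suc i) (suc j) (s≤s i<n) (s≤s j<n) (~-cancelˡ x (suc i) (suc j) p∤x
      (mod-trans (x * suc i) (f i) (x * suc j) (mod-sym (f i) (x * suc i) (mod-% (x * suc i)))
        (subst (_~ x * suc j) (sym eq) (mod-% (x * suc j))))))
    uniq : Unique ys
    uniq = Unique.applyUpTo⁺₁ f n (λ i<j j<n eq → <⇒≢ i<j (inj (<-trans i<j j<n) j<n eq))
    uniq' : Unique (range1 n)
    uniq' = Unique.applyUpTo⁺₁ suc n (λ i<j _ eq → <⇒≢ i<j (suc-injective eq))
    to : ∀ {z} → z ∈ ys → z ∈ range1 n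
    to z∈ with ∈-applyUpTo⁻ f z∈
    ... | i , i<n , refl = let (lo , hi) = %-range (x * suc i) (∤-* p∤x (∤-range (s≤s z≤n) i<n)) in range1⁺ lo hi
    from : ∀ {z} → z ∈ range1 n → z ∈ ys
    from {z} z∈ with range1⁻ z∈ | inverse-mod x (prime∤⇒coprime pr p∤x)
    ... | 1≤z , z≤ | x' , x'x~1 = subst (_∈ ys) fi≡z (∈-applyUpTo⁺ f i<n)
      where
      w = (x' * z) % p
      xx'z~z : x * (x' * z) ~ z
      xx'z~z = subst₂ _~_ (trans (cong (_* z) (*-comm x' x)) (*-assoc x x' z)) (*-identityˡ z) (mod-* (x' * x) 1 z z x'x~1 (mod-refl z))
      p∤x'z : ¬ p ∣ x' * z
      p∤x'z p∣ = ∤-range 1≤z z≤ (mod-resp-∣ (x * (x' * z)) z xx'z~z (∣n⇒∣m*n x p∣))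
      i = w ∸ 1
      w≥1 = proj₁ (%-range (x' * z) p∤x'z)
      si≡w : suc i ≡ w
      si≡w = m+[n∸m]≡n w≥1
      i<n : i < n
      i<n = ≤-trans (≤-reflexive si≡w) (proj₂ (%-range (x' * z) p∤x'z))
      fi≡z : f i ≡ z
      fi≡z = mod-unique (f i) z (m%n<n (x * suc i) p) (s≤s z≤) (mod-trans (f i) (x * suc i) z (mod-% (x * suc i))
        (mod-trans (x * suc i) (x * (x' * z)) z (mod-* x x (suc i) (x' * z) (mod-refl x) (subst (_~ x' * z) (sym si≡w) (mod-% (x' * z)))) xx'z~z))
    perm = ∼bag⇒↭ (unique∧set⇒bag uniq uniq' (mk⇔ to from))

  -- Division by x - r at the largest root r lowers the degree by one and keeps the smaller roots,
  -- which differ from r modulo p. The constant 1 has no root.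
  too-many-roots : ∀ k cs → length cs ≡ k → suc k ≤ n → (∀ i → 1 ≤ i → i ≤ suc k → (ℤ.+ p) S.∣ ev cs (ℤ.+ i)) → ⊥
  too-many-roots zero [] refl le roots = <-irrefl (sym (∣1⇒≡1 (S.∣⇒∣ᵤ (roots 1 ≤-refl ≤-refl)))) (prime≥2 pr)
  too-many-roots (suc k) (c ∷ cs) eq le roots =
    too-many-roots k (quotientBy r (c ∷ cs)) (trans (length-quotientBy r c cs) (suc-injective eq)) (<⇒≤ le) root'
    where
    r = ℤ.+ suc (suc k)
    root' : ∀ i → 1 ≤ i → i ≤ suc k → (ℤ.+ p) S.∣ ev (quotientBy r (c ∷ cs)) (ℤ.+ i)
    root' i 1≤i i≤ with euclidsLemma ℤ.∣ ℤ.+ i ℤ.- r ∣ ℤ.∣ ev (quotientBy r (c ∷ cs)) (ℤ.+ i) ∣ pr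
         (subst (p ∣_) (ℤP.abs-* (ℤ.+ i ℤ.- r) (ev (quotientBy r (c ∷ cs)) (ℤ.+ i)))
           (S.∣⇒∣ᵤ (S.∣m+n∣m⇒∣n (subst ((ℤ.+ p) S.∣_) (ev-quotientBy (ℤ.+ i) r c cs) (roots i 1≤i (m≤n⇒m≤1+n i≤)))
             (roots (suc (suc k)) (s≤s z≤n) ≤-refl))))
    ... | inj₂ p∣ = S.∣ᵤ⇒∣ p∣
    ... | inj₁ p∣ = ⊥-elim (<⇒≢ (s≤s i≤) (mod-unique i (suc (suc k)) (≤-trans (s≤s i≤) (m≤n⇒m≤1+n le)) (s≤s le) p∣))

  -- Otherwise the polynomial X^k - 1 would vanish at 1, ..., k + 1.
  nonroot : ∀ k → 1 ≤ k → k < n → ∃ λ x → ¬ p ∣ x × ¬ (x ^ k ~ 1)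
  nonroot (suc k) _ k<n with anyUpTo? (λ i → ¬? ((suc i ^ suc k) ≡? 1 mod p)) n
  ... | yes (i , i<n , ne) = suc i , ∤-range (s≤s z≤n) i<n , ne
  ... | no none = ⊥-elim (too-many-roots (suc k) (ℤ.-1ℤ ∷ replicate k ℤ.0ℤ) (cong suc (length-replicate k)) k<n root)
    where
    root : ∀ i → 1 ≤ i → i ≤ suc (suc k) → (ℤ.+ p) S.∣ ev (ℤ.-1ℤ ∷ replicate k ℤ.0ℤ) (ℤ.+ i)
    root (suc i) _ i≤ = subst ((ℤ.+ p) S.∣_) (sym eq) (mod⇒∣ {p} {suc i ^ suc k} {1}
      (decidable-stable ((suc i ^ suc k) ≡? 1 mod p) (λ ne → none (i , ≤-trans i≤ k<n , ne))))
      where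
      eq : ev (ℤ.-1ℤ ∷ replicate k ℤ.0ℤ) (ℤ.+ suc i) ≡ (suc i ^ suc k) -ₙ 1
      eq = trans (cong (λ e → ℤ.-1ℤ ℤ.+ ℤ.+ suc i ℤ.* e) (ev-power k (suc i)))
        (trans (ℤP.+-comm ℤ.-1ℤ (ℤ.+ suc i ℤ.* ℤ.+ (suc i ^ k))) (cong (λ e → e ℤ.- ℤ.1ℤ) (sym (ℤP.pos-* (suc i) (suc i ^ k)))))

  HasOrder : ℕ → ℕ → Set
  HasOrder g k = g ^ k ~ 1 × (∀ j → g ^ j ~ 1 → k ∣ j)

  ^-∣~1 : ∀ g i j → i ∣ j → g ^ i ~ 1 → g ^ j ~ 1
  ^-∣~1 g i j (divides k refl) eq = mod-trans (g ^ (k * i)) ((g ^ i) ^ k) 1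
    (mod-reflexive (trans (cong (g ^_) (*-comm k i)) (sym (^-*-assoc g i k))))
    (mod-trans ((g ^ i) ^ k) (1 ^ k) 1 (mod-^ (g ^ i) 1 k eq) (mod-reflexive (^-zeroˡ k)))

  ^-∸~1 : ∀ g D X Y → D + Y ≡ X → g ^ X ~ 1 → g ^ Y ~ 1 → g ^ D ~ 1
  ^-∸~1 g D X Y eq gX gY = mod-trans (g ^ D) (g ^ D * g ^ Y) 1
    (mod-sym (g ^ D * g ^ Y) (g ^ D) (subst (g ^ D * g ^ Y ~_) (*-identityʳ (g ^ D)) (mod-* (g ^ D) (g ^ D) (g ^ Y) 1 (mod-refl (g ^ D)) gY)))
    (mod-trans (g ^ D * g ^ Y) (g ^ X) 1 (mod-reflexive (trans (sym (^-distribˡ-+-* g D Y)) (cong (g ^_) eq))) gX)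

  ^-gcd~1 : ∀ g i j → g ^ i ~ 1 → g ^ j ~ 1 → g ^ gcd i j ~ 1
  ^-gcd~1 g i j gi gj with Bézout.identity (gcd-GCD i j)
  ... | Bézout.+- x y eq = ^-∸~1 g (gcd i j) (x * i) (y * j) eq (^-∣~1 g i (x * i) (n∣m*n x) gi) (^-∣~1 g j (y * j) (n∣m*n y) gj)
  ... | Bézout.-+ x y eq = ^-∸~1 g (gcd i j) (y * j) (x * i) eq (^-∣~1 g j (y * j) (n∣m*n y) gj) (^-∣~1 g i (x * i) (n∣m*n x) gi)

  -- If y^j ~ 1, the gcd of j and q^(a + 1) is also an exponent that sends y to 1; a proper divisor
  -- of q^(a + 1) would divide q^a.
  order-prime-power : ∀ {q} → Prime q → ∀ a y → y ^ (q ^ suc a) ~ 1 → ¬ (y ^ (q ^ a) ~ 1) → HasOrder y (q ^ suc a)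
  order-prime-power {q} pq a y one ≁one = one , divides-order
    where
    divides-order : ∀ j → y ^ j ~ 1 → q ^ suc a ∣ j
    divides-order j yj with ∣-prime-power pq a (gcd[m,n]∣n j (q ^ suc a))
    ... | inj₁ g∣  = ⊥-elim (≁one (^-∣~1 y (gcd j (q ^ suc a)) (q ^ a) g∣ (^-gcd~1 y j (q ^ suc a) yj one)))
    ... | inj₂ g≡  = subst (_∣ j) g≡ (gcd[m,n]∣m j (q ^ suc a))

  exists-order-prime-power : ∀ {q} → Prime q → ∀ a → q ^ suc a ∣ n → ∃ λ y → HasOrder y (q ^ suc a)
  -- Take x with x^(n / q) different from 1; the witness is x^(n / q^(a + 1)).
  exists-order-prime-power {q} pq a (divides n₁ eq) with nonroot (n₁ * q ^ a) k≥1 k<n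
    where
    instance _ = prime⇒nonZero pq
    n₁≥1 : 1 ≤ n₁
    n₁≥1 = n≢0⇒n>0 (λ { refl → <-irrefl (sym eq) n≥1 })
    k≥1 : 1 ≤ n₁ * q ^ a
    k≥1 = *-mono-≤ n₁≥1 (m^n>0 q a)
    k<n : n₁ * q ^ a < n
    k<n = subst (n₁ * q ^ a <_) (sym eq) (*-monoʳ-< n₁ {{>-nonZero n₁≥1}} (^-monoʳ-< q (prime≥2 pq) {a} {suc a} ≤-refl))
  ... | x , p∤x , ≁one = x ^ n₁ , order-prime-power pq a (x ^ n₁)
    (mod-trans ((x ^ n₁) ^ (q ^ suc a)) (x ^ n) 1 (mod-reflexive (trans (^-*-assoc x n₁ (q ^ suc a)) (cong (x ^_) (sym eq)))) (fermat x p∤x))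
    (λ one → ≁one (subst (_~ 1) (^-*-assoc x n₁ (q ^ a)) one))

  -- Raising (g h)^j ~ 1 to the power a removes g and forces b ∣ j; symmetrically a ∣ j.
  order-product : ∀ g h a b → Coprime a b → HasOrder g a → HasOrder h b → HasOrder (g * h) (a * b)
  order-product g h a b cop (ga , ord-g) (hb , ord-h) = one , λ j eq → coprime-*-∣ cop (ord-g' j eq) (ord-h' j eq)
    where
    half : ∀ {x y} → x ~ 1 → y ~ 1 → x * y ~ 1
    half {x} {y} = mod-* x 1 y 1
    one : (g * h) ^ (a * b) ~ 1
    one = subst (_~ 1) (sym (^-distribʳ-* (a * b) g h)) (half {g ^ (a * b)} {h ^ (a * b)} (^-∣~1 g a (a * b) (m∣m*n b) ga) (^-∣~1 h b (a * b) (n∣m*n a) hb))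
    cancel : ∀ x y → x * y ~ 1 → x ~ 1 → y ~ 1
    cancel x y xy x1 = mod-trans y (x * y) 1 (mod-sym (x * y) y (subst (x * y ~_) (*-identityˡ y) (mod-* x 1 y y x1 (mod-refl y)))) xy
    raise : ∀ j k → (g * h) ^ j ~ 1 → g ^ (j * k) * h ^ (j * k) ~ 1
    raise j k eq = subst (_~ 1) (^-distribʳ-* (j * k) g h) (^-∣~1 (g * h) j (j * k) (m∣m*n k) eq)
    ord-h' : ∀ j → (g * h) ^ j ~ 1 → b ∣ j
    ord-h' j eq = coprime-divisor (Coprimality.sym cop) (subst (b ∣_) (*-comm j a)
      (ord-h (j * a) (cancel (g ^ (j * a)) (h ^ (j * a)) (raise j a eq) (^-∣~1 g a (j * a) (n∣m*n j) ga))))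
    ord-g' : ∀ j → (g * h) ^ j ~ 1 → a ∣ j
    ord-g' j eq = coprime-divisor cop (subst (a ∣_) (*-comm j b)
      (ord-g (j * b) (cancel (h ^ (j * b)) (g ^ (j * b)) (subst (_~ 1) (*-comm (g ^ (j * b)) (h ^ (j * b))) (raise j b eq)) (^-∣~1 h b (j * b) (n∣m*n j) hb))))

  coprime-^ : ∀ {q u} a → Coprime u q → Coprime u (q ^ a)
  coprime-^ zero    c (_ , d∣1) = ∣1⇒≡1 d∣1
  coprime-^ (suc a) c = coprime-*⁺ c (coprime-^ a c)

  exists-order : ∀ m → 1 ≤ m → m ∣ n → ∃ λ g → HasOrder g m
  exists-order m m≥1 = go m m≥1 (<-wellFounded m)
    where
    Goal : ℕ → Set
    Goal m = ∃ λ g → HasOrder g m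
    step : ∀ m → (∀ m' → m' < m → 1 ≤ m' → m' ∣ n → Goal m') → m ∣ n → ∀ q → Prime q → q ∣ m →
           (∃ λ a → ∃ λ m' → m ≡ q ^ a * m' × ¬ q ∣ m') → Goal m
    step m rec m∣n q pq q∣m (zero , m' , eq , q∤m') = ⊥-elim (q∤m' (subst (q ∣_) (trans eq (+-identityʳ m')) q∣m))
    step m rec m∣n q pq q∣m (suc a , m' , eq , q∤m') = subst Goal (sym eq) (combine
        (exists-order-prime-power pq a (∣-trans (m∣m*n m') m∣n'))
        (rec m' (subst (m' <_) (sym eq) m'<m) m'≥1 (∣-trans (n∣m*n (q ^ suc a)) m∣n')))
      where
      m∣n' : q ^ suc a * m' ∣ n
      m∣n' = subst (_∣ n) eq m∣n
      m'≥1 : 1 ≤ m'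
      m'≥1 = n≢0⇒n>0 (λ m'≡0 → q∤m' (subst (q ∣_) (sym m'≡0) (q ∣0)))
      m'<m : m' < q ^ suc a * m'
      m'<m = subst (_< q ^ suc a * m') (*-identityˡ m') (*-monoˡ-< m' {{>-nonZero m'≥1}} (^-monoʳ-< q (prime≥2 pq) {0} {suc a} (s≤s z≤n)))
      combine : Goal (q ^ suc a) → Goal m' → Goal (q ^ suc a * m')
      combine (y , ord-y) (g , ord-g) = y * g , order-product y g (q ^ suc a) m'
        (Coprimality.sym (coprime-^ {q} {m'} (suc a) (Coprimality.sym (prime∤⇒coprime pq q∤m')))) ord-y ord-g
    go : ∀ m → 1 ≤ m → Acc _<_ m → m ∣ n → Goal m
    go m m≥1 (acc rs) m∣n with m ≟ 1
    ... | yes refl = 1 , mod-refl 1 , λ j _ → 1∣ j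
    ... | no m≢1 = let (q , pq , q∣m) = prime-divisor m (≤∧≢⇒< m≥1 (m≢1 ∘ sym)) in
      step m (λ m' m'<m m'≥1 → go m' m'≥1 (rs m'<m)) m∣n q pq q∣m (extract-power q (prime≥2 pq) m m≥1)

  abstract
    primitive-root : ∃ λ γ → HasOrder γ n
    primitive-root = exists-order n n≥1 ∣-refl

  γ : ℕ
  γ = proj₁ primitive-root

  ∤γ : ¬ p ∣ γ
  ∤γ p∣γ = <-irrefl (sym (∣1⇒≡1 (mod-resp-∣ (γ ^ n) 1 (proj₁ (proj₂ primitive-root)) (subst (λ k → p ∣ γ ^ k) (m+[n∸m]≡n n≥1) (∣m⇒∣m*n (γ ^ (n ∸ 1)) p∣γ))))) (prime≥2 pr)

  γ^~1⁺ : ∀ j → n ∣ j → γ ^ j ~ 1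
  γ^~1⁺ j n∣j = ^-∣~1 γ n j n∣j (proj₁ (proj₂ primitive-root))

  γ^~1⁻ : ∀ j → γ ^ j ~ 1 → n ∣ j
  γ^~1⁻ = proj₂ (proj₂ primitive-root)

  private
    γ^-cong-≤ : ∀ i j → j ≤ i → i ≡ j mod n → γ ^ i ~ γ ^ j
    γ^-cong-≤ i j j≤i eq = subst₂ _~_ (trans (sym (^-distribˡ-+-* γ j (i ∸ j))) (cong (γ ^_) (m+[n∸m]≡n j≤i))) (*-identityʳ (γ ^ j))
      (mod-* (γ ^ j) (γ ^ j) (γ ^ (i ∸ j)) 1 (mod-refl (γ ^ j)) (γ^~1⁺ (i ∸ j) (mod-≤⁻ i j j≤i eq)))

  γ^-cong : ∀ i j → i ≡ j mod n → γ ^ i ~ γ ^ j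
  γ^-cong i j eq with ≤-total j i
  ... | inj₁ j≤i = γ^-cong-≤ i j j≤i eq
  ... | inj₂ i≤j = mod-sym (γ ^ j) (γ ^ i) (γ^-cong-≤ j i i≤j (mod-sym i j eq))

  private
    γ^-inj-≤ : ∀ i j → j ≤ i → γ ^ i ~ γ ^ j → i ≡ j mod n
    γ^-inj-≤ i j j≤i eq = mod-≤ i j j≤i (γ^~1⁻ (i ∸ j) (~-cancelˡ (γ ^ j) (γ ^ (i ∸ j)) 1 (∤-^ j ∤γ)
      (subst₂ _~_ (sym (trans (sym (^-distribˡ-+-* γ j (i ∸ j))) (cong (γ ^_) (m+[n∸m]≡n j≤i)))) (sym (*-identityʳ (γ ^ j))) eq)))

  γ^-inj : ∀ i j → γ ^ i ~ γ ^ j → i ≡ j mod n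
  γ^-inj i j eq with ≤-total j i
  ... | inj₁ j≤i = γ^-inj-≤ i j j≤i eq
  ... | inj₂ i≤j = mod-sym j i (γ^-inj-≤ j i i≤j (mod-sym (γ ^ i) (γ ^ j) eq))

  private
    logs : ℕ → ℕ
    logs z = ∑ (upTo n) (λ i → 𝟙 ((γ ^ i) ≡? z mod p))

    logs≤1 : ∀ z → logs z ≤ 1
    logs≤1 z = ∑-𝟙≤1 n (λ i → (γ ^ i) ≡? z mod p) (λ {i} {j} i<n j<n ei ej →
      mod-unique i j i<n j<n (γ^-inj i j (mod-trans (γ ^ i) z (γ ^ j) ei (mod-sym (γ ^ j) z ej))))

    logs-total : length (range1 n) ≤ ∑ (range1 n) logs
    logs-total = ≤-reflexive (begin
      length (range1 n)  ≡⟨ length-applyUpTo suc n ⟩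
      n  ≡⟨ trans (sym (*-identityʳ n)) (cong (_* 1) (sym (length-applyUpTo id n))) ⟩
      length (upTo n) * 1  ≡⟨ ∑-const (upTo n) 1 ⟨
      ∑ (upTo n) (λ _ → 1)  ≡⟨ ∑-cong (upTo n) (λ {i} _ → sym (one i)) ⟩
      ∑ (upTo n) (λ i → ∑ (range1 n) (λ z → 𝟙 ((γ ^ i) ≡? z mod p)))  ≡⟨ ∑-swap (upTo n) (range1 n) ⟩
      ∑ (range1 n) logs  ∎)
      where
      open ≡-Reasoning
      one : ∀ i → ∑ (range1 n) (λ z → 𝟙 ((γ ^ i) ≡? z mod p)) ≡ 1
      one i = ∑-𝟙-range1 n (λ z → (γ ^ i) ≡? z mod p) (proj₁ rng) (proj₂ rng) (mod-sym ((γ ^ i) % p) (γ ^ i) (mod-% (γ ^ i)))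
        (λ {z} _ z≤ eq → mod-unique z ((γ ^ i) % p) (s≤s z≤) (m%n<n (γ ^ i) p)
          (mod-trans z (γ ^ i) ((γ ^ i) % p) (mod-sym (γ ^ i) z eq) (mod-sym ((γ ^ i) % p) (γ ^ i) (mod-% (γ ^ i)))))
        where rng = %-range (γ ^ i) (∤-^ i ∤γ)

    abstract
      -- The n powers γ^0, ..., γ^(n - 1) meet each of the n nonzero residues at most once, hence
      -- all of them.
      log-exists : ∀ z → ¬ p ∣ z → ∃ λ i → i < n × γ ^ i ~ z
      log-exists z p∤z with anyUpTo? (λ i → (γ ^ i) ≡? z mod p) n
      ... | yes found = found
      ... | no none = ⊥-elim (<⇒≱ (s≤s z≤n) (≤-trans (∑-full {xs = range1 n} {logs} (λ {z} _ → logs≤1 z) logs-total (range1⁺ {n} {z % p} (proj₁ rng) (proj₂ rng)))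
              (≤-reflexive (∑-zero (upTo n) (λ {i} i∈ → 𝟙-no ((γ ^ i) ≡? z % p mod p)
                (λ eq → none (i , ∈-upTo⁻ i∈ , mod-trans (γ ^ i) (z % p) z eq (mod-% z))))))))
        where
        rng : 1 ≤ z % p × z % p ≤ n
        rng = %-range z p∤z

  -- Discrete logarithm to the base γ; the value 0 on multiples of p is junk.
  ind : ℕ → ℕ
  ind z with p ∣? z
  ... | yes _  = 0
  ... | no p∤z = proj₁ (log-exists z p∤z)

  ind<n : ∀ z → ind z < n
  ind<n z with p ∣? z
  ... | yes _  = n≥1
  ... | no p∤z = proj₁ (proj₂ (log-exists z p∤z))

  γ^ind : ∀ z → ¬ p ∣ z → γ ^ ind z ~ z
  γ^ind z p∤z with p ∣? z
  ... | yes p∣z = ⊥-elim (p∤z p∣z)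
  ... | no p∤z' = proj₂ (proj₂ (log-exists z p∤z'))

  ind-unique : ∀ z i → ¬ p ∣ z → i < n → γ ^ i ~ z → ind z ≡ i
  ind-unique z i p∤z i<n eq = mod-unique (ind z) i (ind<n z) i<n
    (γ^-inj (ind z) i (mod-trans (γ ^ ind z) z (γ ^ i) (γ^ind z p∤z) (mod-sym (γ ^ i) z eq)))

  ind-cong : ∀ z w → ¬ p ∣ z → z ~ w → ind z ≡ ind w
  ind-cong z w p∤z eq = ind-unique z (ind w) p∤z (ind<n w)
    (mod-trans (γ ^ ind w) w z (γ^ind w (λ p∣w → p∤z (mod-resp-∣ w z (mod-sym z w eq) p∣w))) (mod-sym z w eq))

  ind-inj : ∀ z w → ¬ p ∣ z → ¬ p ∣ w → ind z ≡ ind w → z ~ w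
  ind-inj z w p∤z p∤w eq = mod-trans z (γ ^ ind z) w (mod-sym (γ ^ ind z) z (γ^ind z p∤z)) (subst (λ i → γ ^ i ~ w) (sym eq) (γ^ind w p∤w))

  ind-* : ∀ z w → ¬ p ∣ z → ¬ p ∣ w → ind (z * w) ≡ ind z + ind w mod n
  ind-* z w p∤z p∤w = γ^-inj (ind (z * w)) (ind z + ind w) (mod-trans (γ ^ ind (z * w)) (z * w) (γ ^ (ind z + ind w))
    (γ^ind (z * w) (∤-* p∤z p∤w))
    (mod-sym (γ ^ (ind z + ind w)) (z * w) (subst (_~ z * w) (sym (^-distribˡ-+-* γ (ind z) (ind w)))
      (mod-* (γ ^ ind z) z (γ ^ ind w) w (γ^ind z p∤z) (γ^ind w p∤w)))))

  ind-^ : ∀ g h i → γ ^ i ~ g → g ^ h ~ γ ^ (i * h)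
  ind-^ g h i eq = mod-trans (g ^ h) ((γ ^ i) ^ h) (γ ^ (i * h)) (mod-sym ((γ ^ i) ^ h) (g ^ h) (mod-^ (γ ^ i) g h eq)) (mod-reflexive (^-*-assoc γ i h))

  ∑-by-index : (h : ℕ → ℕ) → ∑ (range1 n) (h ∘ ind) ≡ ∑ (upTo n) h
  ∑-by-index h = ∑-reindex (range1 n) (upTo n) (λ z i → ind z ≟ i)
    (λ {z} _ → trans (cong (_* h (ind z)) (∑-𝟙-upTo n (λ i → ind z ≟ i) (ind<n z) refl (λ _ eq → sym eq))) (*-identityˡ _))
    (λ {i} i∈ → trans (cong (_* h i) (∑-𝟙-range1 n (λ z → ind z ≟ i) (proj₁ (rng i)) (proj₂ (rng i)) (hit i (∈-upTo⁻ i∈))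
       (λ {z} lo hi eq → mod-unique z ((γ ^ i) % p) (s≤s hi) (m%n<n (γ ^ i) p)
          (ind-inj z ((γ ^ i) % p) (∤-range lo hi) (∤-range (proj₁ (rng i)) (proj₂ (rng i))) (trans eq (sym (hit i (∈-upTo⁻ i∈)))))))) (*-identityˡ _))
    (λ _ _ eq → cong h eq)
    where
    rng : ∀ i → 1 ≤ (γ ^ i) % p × (γ ^ i) % p ≤ n
    rng i = %-range (γ ^ i) (∤-^ i ∤γ)
    hit : ∀ i → i < n → ind ((γ ^ i) % p) ≡ i
    hit i i<n = ind-unique ((γ ^ i) % p) i (∤-range (proj₁ (rng i)) (proj₂ (rng i))) i<n (mod-sym ((γ ^ i) % p) (γ ^ i) (mod-% (γ ^ i)))

-- Sums of squares

sq : ℤ → ℕ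
sq z = ℤ.∣ z ∣ * ℤ.∣ z ∣

pos-sq : ∀ z → ℤ.+ (sq z) ≡ z ℤ.* z
pos-sq (ℤ.+ n)      = ℤP.pos-* n n
pos-sq (ℤ.-[1+ n ]) = refl

sq-neg : ∀ z → sq (ℤ.- z) ≡ sq z
sq-neg z = cong (λ a → a * a) (ℤP.∣-i∣≡∣i∣ z)

sq-* : ∀ y z → sq (y ℤ.* z) ≡ sq y * sq z
sq-* y z = trans (cong (λ a → a * a) (ℤP.abs-* y z)) ([m*n]*[o*p]≡[m*o]*[n*p] ℤ.∣ y ∣ ℤ.∣ z ∣ ℤ.∣ y ∣ ℤ.∣ z ∣)

-- Weighted form of (x + y)² ≤ 2x² + 2y²; the defect is the square of Bx - Ay.
sq-+ : ∀ A B x y → A * B * sq (x ℤ.+ y) ≤ (A + B) * (B * sq x + A * sq y)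
sq-+ A B x y = ≤-trans (m≤m+n _ (sq (ℤ.+ B ℤ.* x ℤ.- ℤ.+ A ℤ.* y))) (≤-reflexive (ℤP.+-injective (begin
  ℤ.+ (A * B * sq (x ℤ.+ y) + sq δ)
    ≡⟨ cong₂ ℤ._+_ (trans (ℤP.pos-* (A * B) (sq (x ℤ.+ y))) (cong₂ ℤ._*_ (ℤP.pos-* A B) (pos-sq (x ℤ.+ y)))) (pos-sq δ) ⟩
  ℤ.+ A ℤ.* ℤ.+ B ℤ.* ((x ℤ.+ y) ℤ.* (x ℤ.+ y)) ℤ.+ δ ℤ.* δ
    ≡⟨ identity (ℤ.+ A) (ℤ.+ B) x y ⟩
  (ℤ.+ A ℤ.+ ℤ.+ B) ℤ.* (ℤ.+ B ℤ.* (x ℤ.* x) ℤ.+ ℤ.+ A ℤ.* (y ℤ.* y))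
    ≡⟨ cong (λ z → (ℤ.+ A ℤ.+ ℤ.+ B) ℤ.* z) (cong₂ ℤ._+_ (trans (ℤP.pos-* B (sq x)) (cong (λ z → ℤ.+ B ℤ.* z) (pos-sq x))) (trans (ℤP.pos-* A (sq y)) (cong (λ z → ℤ.+ A ℤ.* z) (pos-sq y)))) ⟨
  (ℤ.+ A ℤ.+ ℤ.+ B) ℤ.* ℤ.+ (B * sq x + A * sq y)
    ≡⟨ ℤP.pos-* (A + B) (B * sq x + A * sq y) ⟨
  ℤ.+ ((A + B) * (B * sq x + A * sq y)) ∎)))
  where
  open ≡-Reasoning
  δ = ℤ.+ B ℤ.* x ℤ.- ℤ.+ A ℤ.* y
  identity : ∀ A B x y → A ℤ.* B ℤ.* ((x ℤ.+ y) ℤ.* (x ℤ.+ y)) ℤ.+ (B ℤ.* x ℤ.- A ℤ.* y) ℤ.* (B ℤ.* x ℤ.- A ℤ.* y)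
             ≡ (A ℤ.+ B) ℤ.* (B ℤ.* (x ℤ.* x) ℤ.+ A ℤ.* (y ℤ.* y))
  identity = ℤSolver.solve-∀

-- Induction through `sq-+` with weights 1 and k, where k is the length of the tail. The singleton
-- is treated apart because k is cancelled at the end and must be nonzero.
cauchy-schwarz : {X : Set} (xs : List X) (F : X → ℤ) → sq (Z.∑ xs F) ≤ length xs * ∑ xs (λ x → sq (F x))
cauchy-schwarz []           F = z≤n
cauchy-schwarz (x ∷ [])     F = ≤-reflexive (begin
  sq (F x ℤ.+ ℤ.0ℤ)  ≡⟨ cong sq (ℤP.+-identityʳ (F x)) ⟩
  sq (F x)  ≡⟨ trans (sym (+-identityʳ _)) (sym (+-identityʳ _)) ⟩
  1 * (sq (F x) + 0)  ∎)
  where open ≡-Reasoning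
cauchy-schwarz (x ∷ xs@(_ ∷ _)) F = *-cancelˡ-≤ k (begin
  k * sq (F x ℤ.+ S)  ≡⟨ cong (_* sq (F x ℤ.+ S)) (*-identityˡ k) ⟨
  1 * k * sq (F x ℤ.+ S)  ≤⟨ sq-+ 1 k (F x) S ⟩
  suc k * (k * sq (F x) + 1 * sq S)  ≤⟨ *-monoʳ-≤ (suc k) (+-monoʳ-≤ (k * sq (F x)) (≤-trans (≤-reflexive (*-identityˡ (sq S))) (cauchy-schwarz xs F))) ⟩
  suc k * (k * sq (F x) + k * Q)  ≡⟨ rearrange k (sq (F x)) Q ⟩
  k * (suc k * (sq (F x) + Q))  ∎)
  where
  open ≤-Reasoning
  k = length xs
  S = Z.∑ xs F
  Q = ∑ xs (λ x → sq (F x))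
  rearrange : ∀ k a b → suc k * (k * a + k * b) ≡ k * (suc k * (a + b))
  rearrange = solve-∀

-- The triangle inequality in ℓ² without square roots: the norms are known only through the bounds A
-- √U and B √U, and these serve as the weights in `sq-+`.
minkowski : {X : Set} (xs : List X) (F G : X → ℤ) (A B U : ℕ) .{{_ : NonZero A}} .{{_ : NonZero B}} →
            ∑ xs (λ x → sq (F x)) ≤ A * A * U → ∑ xs (λ x → sq (G x)) ≤ B * B * U →
            ∑ xs (λ x → sq (F x ℤ.+ G x)) ≤ (A + B) * (A + B) * U
minkowski xs F G A B U hF hG = *-cancelˡ-≤ (A * B) {{m*n≢0 A B}} (begin
  A * B * ∑ xs (λ x → sq (F x ℤ.+ G x))  ≡⟨ ∑-*ˡ xs (A * B) ⟨
  ∑ xs (λ x → A * B * sq (F x ℤ.+ G x))  ≤⟨ ∑-mono xs (λ {x} _ → sq-+ A B (F x) (G x)) ⟩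
  ∑ xs (λ x → (A + B) * (B * sq (F x) + A * sq (G x)))  ≡⟨ ∑-*ˡ xs (A + B) ⟩
  (A + B) * ∑ xs (λ x → B * sq (F x) + A * sq (G x))  ≡⟨ cong ((A + B) *_) (trans (∑-+ xs) (cong₂ _+_ (∑-*ˡ xs B) (∑-*ˡ xs A))) ⟩
  (A + B) * (B * ∑ xs (λ x → sq (F x)) + A * ∑ xs (λ x → sq (G x)))  ≤⟨ *-monoʳ-≤ (A + B) (+-mono-≤ (*-monoʳ-≤ B hF) (*-monoʳ-≤ A hG)) ⟩
  (A + B) * (B * (A * A * U) + A * (B * B * U))  ≡⟨ rearrange A B U ⟩
  A * B * ((A + B) * (A + B) * U)  ∎)
  where
  open ≤-Reasoning
  rearrange : ∀ A B U → (A + B) * (B * (A * A * U) + A * (B * B * U)) ≡ A * B * ((A + B) * (A + B) * U)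
  rearrange = solve-∀

-- Intervals and cosets of subgroups

length-upTo : ∀ k → length (upTo k) ≡ k
length-upTo = length-applyUpTo id

∑-upTo-const : ∀ k c → ∑ (upTo k) (λ _ → c) ≡ k * c
∑-upTo-const k c = trans (∑-const (upTo k) c) (cong (_* c) (length-upTo k))

∑-upTo-mono : ∀ {a b} {h : ℕ → ℕ} → a ≤ b → ∑ (upTo a) h ≤ ∑ (upTo b) h
∑-upTo-mono {a} {b} {h} a≤b = ≤-trans (m≤m+n _ _) (≤-reflexive (trans (sym (∑-upTo-+ a (b ∸ a))) (cong (λ c → ∑ (upTo c) h) (m+[n∸m]≡n a≤b))))

∑-𝟙-residue : ∀ f .{{_ : NonZero f}} i → ∑ (upTo f) (λ w → 𝟙 (f ∣? (w + i))) ≡ 1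
∑-𝟙-residue f i = ∑-𝟙-upTo f (λ w → f ∣? (w + i)) (m%n<n (f * i ∸ i) f) hit
  (λ {w} w<f f∣ → mod-unique w w₀ w<f (m%n<n (f * i ∸ i) f) (mod-+-cancelˡ i w w₀
    (subst₂ (λ a b → a ≡ b mod f) (+-comm w i) (+-comm w₀ i) (mod-trans (w + i) 0 (w₀ + i) (mod-0⁺ (w + i) f∣) (mod-sym (w₀ + i) 0 (mod-0⁺ (w₀ + i) hit))))))
  where
  -- The residue -i modulo f; `f * i ∸ i` is a genuine difference because f ≥ 1.
  w₀ = (f * i ∸ i) % f
  hit : f ∣ w₀ + i
  hit = mod-resp-∣ ((f * i ∸ i) + i) (w₀ + i) (mod-+ (f * i ∸ i) w₀ i i (mod-sym w₀ (f * i ∸ i) (mod-% (f * i ∸ i))) (mod-refl i))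
    (subst (f ∣_) (sym (m∸n+n≡m (m≤n*m i f))) (m∣m*n i))

-- The first congruence is a linear equation for x, and ρ ≡ 1 is excluded by b ≢ b'.
linear-unique : ∀ {p} → Prime p → ∀ ρ b b' → ¬ (b ≡ b' mod p) → ∀ x y →
                (ρ * (x + b')) ≡ x + b mod p → (ρ * (y + b')) ≡ y + b mod p → x ≡ y mod p
linear-unique {p} pr ρ b b' b≁b' x y ex ey = [ (λ ρ~1 → ⊥-elim (b≁b' (degenerate ρ~1))) , (λ x~y → x~y) ]′
    (euclidsLemma ℤ.∣ ρ -ₙ 1 ∣ ℤ.∣ x -ₙ y ∣ pr (subst (p ∣_) (ℤP.abs-* (ρ -ₙ 1) (x -ₙ y)) (S.∣⇒∣ᵤ (subst ((ℤ.+ p) S.∣_) factor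
      (S.∣m∣n⇒∣m-n (mod⇒∣ {p} {ρ * (x + b')} {x + b} ex) (mod⇒∣ {p} {ρ * (y + b')} {y + b} ey))))))
  where
  cast : ∀ z → (ρ * (z + b')) -ₙ (z + b) ≡ ℤ.+ ρ ℤ.* (ℤ.+ z ℤ.+ ℤ.+ b') ℤ.- (ℤ.+ z ℤ.+ ℤ.+ b)
  cast z = cong (λ k → k ℤ.- (ℤ.+ z ℤ.+ ℤ.+ b)) (ℤP.pos-* ρ (z + b'))
  ring : ∀ r x y b b' → (r ℤ.* (x ℤ.+ b') ℤ.- (x ℤ.+ b)) ℤ.- (r ℤ.* (y ℤ.+ b') ℤ.- (y ℤ.+ b)) ≡ (r ℤ.- ℤ.1ℤ) ℤ.* (x ℤ.- y)
  ring = ℤSolver.solve-∀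
  factor : ((ρ * (x + b')) -ₙ (x + b)) ℤ.- ((ρ * (y + b')) -ₙ (y + b)) ≡ (ρ -ₙ 1) ℤ.* (x -ₙ y)
  factor = trans (cong₂ ℤ._-_ (cast x) (cast y)) (ring (ℤ.+ ρ) (ℤ.+ x) (ℤ.+ y) (ℤ.+ b) (ℤ.+ b'))
  degenerate : ρ ≡ 1 mod p → b ≡ b' mod p
  degenerate ρ~1 = mod-sym b' b (mod-+-cancelˡ x b' b (mod-trans (x + b') (ρ * (x + b')) (x + b)
    (mod-sym (ρ * (x + b')) (x + b') (subst (λ z → (ρ * (x + b')) ≡ z mod p) (*-identityˡ (x + b')) (mod-* ρ 1 (x + b') (x + b') ρ~1 (mod-refl (x + b'))))) ex))

module Coset (n : ℕ) (pr : Prime (suc n)) (f m : ℕ) (n≡f*m : n ≡ f * m) where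

  open Order n pr

  f≢0 : NonZero f
  f≢0 = ≢-nonZero (λ f≡0 → <-irrefl (sym (trans n≡f*m (cong (_* m) f≡0))) n≥1)

  private instance _ = f≢0

  f∣n : f ∣ n
  f∣n = subst (f ∣_) (sym n≡f*m) (m∣m*n m)

  -- A coset of the subgroup of order m, namely the elements of index -w modulo f. With a sum in
  -- place of a difference, the parameters w simply add when elements are multiplied.
  InCoset : ℕ → ℕ → Set
  InCoset w z = ¬ p ∣ z × f ∣ w + ind z

  inCoset? : ∀ w z → Dec (InCoset w z)
  inCoset? w z = ¬? (p ∣? z) ×-dec (f ∣? (w + ind z))

  χ : ℕ → ℕ → ℕ
  χ w z = 𝟙 (inCoset? w z)

  inCoset-cong : ∀ {w z z'} → z ~ z' → InCoset w z → InCoset w z'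
  inCoset-cong {w} {z} {z'} eq (p∤z , f∣) = (λ p∣z' → p∤z (mod-resp-∣ z' z (mod-sym z z' eq) p∣z')) , subst (λ i → f ∣ w + i) (ind-cong z z' p∤z eq) f∣

  χ-periodic : ∀ w z → χ w (p + z) ≡ χ w z
  χ-periodic w z = 𝟙-cong (inCoset? w (p + z)) (inCoset? w z)
    (inCoset-cong {w} {p + z} {z} (mod-+-multiple z p ∣-refl)) (inCoset-cong {w} {z} {p + z} (mod-sym (p + z) z (mod-+-multiple z p ∣-refl)))

  unit : ℕ → ℕ
  unit z = 𝟙 (¬? (p ∣? z))

  ∑-χ : ∀ z → ∑ (upTo f) (λ w → χ w z) ≡ unit z
  ∑-χ z = begin
    ∑ (upTo f) (λ w → χ w z)  ≡⟨ ∑-cong (upTo f) (λ {w} _ → 𝟙-× (¬? (p ∣? z)) (f ∣? (w + ind z))) ⟩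
    ∑ (upTo f) (λ w → unit z * 𝟙 (f ∣? (w + ind z)))  ≡⟨ ∑-*ˡ (upTo f) (unit z) ⟩
    unit z * ∑ (upTo f) (λ w → 𝟙 (f ∣? (w + ind z)))  ≡⟨ cong (unit z *_) (∑-𝟙-residue f (ind z)) ⟩
    unit z * 1  ≡⟨ *-identityʳ (unit z) ⟩
    unit z  ∎
    where open ≡-Reasoning

  ∑-unit : ∀ b → ∑ (upTo p) (λ x → unit (x + b)) ≡ n
  ∑-unit b = begin
    ∑ (upTo p) (λ x → unit (x + b))  ≡⟨ ∑-cong (upTo p) (λ {x} _ → cong unit (+-comm x b)) ⟩
    ∑ (upTo p) (λ x → unit (b + x))  ≡⟨ ∑-shift p {unit} periodic b ⟩
    ∑ (upTo p) unit  ≡⟨ cong₂ _+_ (𝟙-no (¬? (p ∣? 0)) (λ p∤0 → p∤0 (p ∣0))) (∑-cong (range1 n) (λ z∈ → let (lo , hi) = range1⁻ z∈ in 𝟙-yes (¬? (p ∣? _)) (∤-range lo hi))) ⟩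
    ∑ (range1 n) (λ _ → 1)  ≡⟨ ∑-range1 n ⟩
    ∑ (upTo n) (λ _ → 1)  ≡⟨ ∑-upTo-const n 1 ⟩
    n * 1  ≡⟨ *-identityʳ n ⟩
    n  ∎
    where
    open ≡-Reasoning
    periodic : ∀ x → unit (p + x) ≡ unit x
    periodic x = 𝟙-cong (¬? (p ∣? (p + x))) (¬? (p ∣? x)) (λ ¬∣ p∣x → ¬∣ (∣m∣n⇒∣m+n ∣-refl p∣x)) (λ ¬∣ p∣ → ¬∣ (∣m+n∣m⇒∣n p∣ ∣-refl))

  ∑-period : ∀ w → ∑ (upTo p) (χ w) ≡ m
  ∑-period w = begin
    ∑ (upTo p) (χ w)  ≡⟨ cong₂ _+_ (𝟙-no (inCoset? w 0) (λ (p∤0 , _) → p∤0 (p ∣0))) (∑-cong (range1 n) (λ {z} z∈ → let (lo , hi) = range1⁻ z∈ in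
        𝟙-cong (inCoset? w z) (f ∣? (w + ind z)) proj₂ (λ f∣ → ∤-range lo hi , f∣))) ⟩
    ∑ (range1 n) (λ z → 𝟙 (f ∣? (w + ind z)))  ≡⟨ ∑-by-index (λ i → 𝟙 (f ∣? (w + i))) ⟩
    ∑ (upTo n) (λ i → 𝟙 (f ∣? (w + i)))  ≡⟨ cong (λ k → ∑ (upTo k) (λ i → 𝟙 (f ∣? (w + i)))) (trans n≡f*m (*-comm f m)) ⟩
    ∑ (upTo (m * f)) (λ i → 𝟙 (f ∣? (w + i)))  ≡⟨ ∑-blocks f periodic m ⟩
    ∑ (upTo m) (λ _ → ∑ (upTo f) (λ i → 𝟙 (f ∣? (w + i)))) ≡⟨ ∑-upTo-const m _ ⟩
    m * ∑ (upTo f) (λ i → 𝟙 (f ∣? (w + i)))  ≡⟨ cong (m *_) (trans (∑-cong (upTo f) (λ {i} _ → 𝟙-cong (f ∣? (w + i)) (f ∣? (i + w)) (subst (f ∣_) (+-comm w i)) (subst (f ∣_) (+-comm i w)))) (∑-𝟙-residue f w)) ⟩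
    m * 1  ≡⟨ *-identityʳ m ⟩
    m  ∎
    where
    open ≡-Reasoning
    swap-f : ∀ x → w + (f + x) ≡ f + (w + x)
    swap-f x = trans (sym (+-assoc w f x)) (trans (cong (_+ x) (+-comm w f)) (+-assoc f w x))
    periodic : ∀ x → 𝟙 (f ∣? (w + (f + x))) ≡ 𝟙 (f ∣? (w + x))
    periodic x = 𝟙-cong (f ∣? (w + (f + x))) (f ∣? (w + x)) (λ f∣ → ∣m+n∣m⇒∣n (subst (f ∣_) (swap-f x) f∣) ∣-refl)
      (λ f∣ → subst (f ∣_) (sym (swap-f x)) (∣m∣n⇒∣m+n ∣-refl f∣))

  T : ℕ → ℕ → ℕ
  T w M = ∑ (range1 M) (χ w)

  -- [1, M] is covered by ⌊M / p⌋ + 1 full periods, each containing m elements of the coset.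
  T-bound : ∀ w M → T w M * p ≤ m * (M + p)
  T-bound w M = begin
    T w M * p  ≤⟨ *-monoˡ-≤ p (≤-trans (≤-reflexive (∑-range1 M)) (∑-upTo-mono M≤)) ⟩
    ∑ (upTo (k * p)) (χ w ∘ suc) * p  ≡⟨ cong (_* p) (∑-blocks p {χ w ∘ suc} (λ x → trans (cong (χ w) (sym (+-suc p x))) (χ-periodic w (suc x))) k) ⟩
    ∑ (upTo k) (λ _ → ∑ (upTo p) (χ w ∘ suc)) * p  ≡⟨ cong (_* p) (∑-upTo-const k (∑ (upTo p) (χ w ∘ suc))) ⟩
    k * ∑ (upTo p) (χ w ∘ suc) * p  ≡⟨ cong (λ z → k * z * p) (trans (∑-shift p (χ-periodic w) 1) (∑-period w)) ⟩
    k * m * p  ≡⟨ rearrange k m p ⟩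
    m * (k * p)  ≤⟨ *-monoʳ-≤ m (≤-trans (≤-reflexive (split (M / p) p)) (+-monoˡ-≤ p (m/n*n≤m M p))) ⟩
    m * (M + p)  ∎
    where
    open ≤-Reasoning
    k = M / p + 1
    rearrange : ∀ a b c → a * b * c ≡ b * (a * c)
    rearrange = solve-∀
    split : ∀ a c → (a + 1) * c ≡ a * c + c
    split = solve-∀
    M≤ : M ≤ k * p
    M≤ = begin
      M  ≡⟨ m≡m%n+[m/n]*n M p ⟩
      M % p + M / p * p  ≤⟨ +-monoˡ-≤ (M / p * p) (<⇒≤ (m%n<n M p)) ⟩
      p + M / p * p  ≡⟨ trans (+-comm p (M / p * p)) (sym (split (M / p) p)) ⟩
      k * p  ∎

  private
    ratios : ℕ → ℕ → ℕ
    ratios z z' = ∑ (upTo m) (λ j → 𝟙 ((γ ^ (f * j) * z') ≡? z mod p))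

    same-coset : ∀ {w z z'} → InCoset w z → InCoset w z' → 1 ≤ ratios z z'
    same-coset {w} {z} {z'} (p∤z , f∣z) (p∤z' , f∣z') = ≤-trans (≤-reflexive (sym (𝟙-yes (γ ^ (f * j) * z' ≡? z mod p) hit)))
        (∈⇒≤∑ (λ j → 𝟙 ((γ ^ (f * j) * z') ≡? z mod p)) (∈-upTo⁺ j<m))
      where
      instance _ = >-nonZero n≥1
      s = ind z + (n ∸ ind z')
      δ = s % n
      rearrange : ∀ w a b c → (w + a) + (b + c) ≡ (w + b) + (a + c)
      rearrange = solve-∀
      f∣s : f ∣ s
      f∣s = ∣m+n∣m⇒∣n (subst (f ∣_) (trans (cong (λ k → w + ind z + k) (sym (m+[n∸m]≡n (<⇒≤ (ind<n z'))))) (rearrange w (ind z) (ind z') (n ∸ ind z'))) (∣m∣n⇒∣m+n f∣z f∣n)) f∣z'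
      f∣δ : f ∣ δ
      f∣δ = %-presˡ-∣ f∣s f∣n
      j = quotient f∣δ
      δ≡fj : δ ≡ f * j
      δ≡fj = m∣n⇒n≡m*quotient f∣δ
      j<m : j < m
      j<m = *-cancelˡ-< f j m (subst₂ _<_ δ≡fj n≡f*m (m%n<n s n))
      cong-δ : (δ + ind z') ≡ ind z mod n
      cong-δ = mod-trans (δ + ind z') (s + ind z') (ind z) (mod-+ δ s (ind z') (ind z') (mod-% s) (mod-refl (ind z')))
        (subst (λ k → k ≡ ind z mod n) (sym (trans (+-assoc (ind z) (n ∸ ind z') (ind z')) (trans (cong (ind z +_) (m∸n+n≡m (<⇒≤ (ind<n z')))) (+-comm (ind z) n)))) (mod-+-multiple (ind z) n ∣-refl))
      hit : γ ^ (f * j) * z' ~ z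
      hit = subst (λ k → γ ^ k * z' ~ z) δ≡fj (mod-trans (γ ^ δ * z') (γ ^ δ * γ ^ ind z') z
        (mod-* (γ ^ δ) (γ ^ δ) z' (γ ^ ind z') (mod-refl (γ ^ δ)) (mod-sym (γ ^ ind z') z' (γ^ind z' p∤z')))
        (mod-trans (γ ^ δ * γ ^ ind z') (γ ^ ind z) z (subst (_~ γ ^ ind z) (^-distribˡ-+-* γ δ (ind z')) (γ^-cong (δ + ind z') (ind z) cong-δ)) (γ^ind z p∤z)))

    χχ≤ : ∀ w z z' → χ w z * χ w z' ≤ χ w z * ratios z z'
    χχ≤ w z z' with inCoset? w z
    ... | no _   = z≤n
    ... | yes iz = *-monoʳ-≤ 1 (𝟙≤ (inCoset? w z') (same-coset iz))

    ∑χχ≤ : ∀ z z' → ∑ (upTo f) (λ w → χ w z * χ w z') ≤ ratios z z'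
    ∑χχ≤ z z' = begin
      ∑ (upTo f) (λ w → χ w z * χ w z')  ≤⟨ ∑-mono (upTo f) (λ {w} _ → χχ≤ w z z') ⟩
      ∑ (upTo f) (λ w → χ w z * ratios z z')  ≡⟨ ∑-*ʳ (upTo f) (ratios z z') ⟩
      ∑ (upTo f) (λ w → χ w z) * ratios z z'  ≤⟨ *-monoˡ-≤ (ratios z z') (≤-trans (≤-reflexive (∑-χ z)) (𝟙≤1 (¬? (p ∣? z)))) ⟩
      1 * ratios z z'  ≡⟨ *-identityˡ (ratios z z') ⟩
      ratios z z'  ∎
      where open ≤-Reasoning

    -- For each of the m possible ratios of x + b to x + b' the congruence for x is linear and, as b
    -- and b' differ, has at most one solution. This takes the place of a character sum estimate.
    ∑-ratios : ∀ b b' → ¬ (b ~ b') → ∑ (upTo p) (λ x → ratios (x + b) (x + b')) ≤ m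
    ∑-ratios b b' b≁b' = begin
      ∑ (upTo p) (λ x → ratios (x + b) (x + b'))  ≡⟨ ∑-swap (upTo p) (upTo m) ⟩
      ∑ (upTo m) (λ j → ∑ (upTo p) (λ x → 𝟙 ((γ ^ (f * j) * (x + b')) ≡? (x + b) mod p)))  ≤⟨ ∑-bound (upTo m) 1 (λ {j} _ → ∑-𝟙≤1 p (λ x → (γ ^ (f * j) * (x + b')) ≡? (x + b) mod p)
          (λ {x} {y} x<p y<p ex ey → mod-unique x y x<p y<p (linear-unique pr (γ ^ (f * j)) b b' b≁b' x y ex ey))) ⟩
      length (upTo m) * 1  ≡⟨ trans (*-identityʳ _) (length-upTo m) ⟩
      m  ∎
      where open ≤-Reasoning

    X : ℕ → ℕ → ℕ
    X b b' = ∑ (upTo p) (λ x → ∑ (upTo f) (λ w → χ w (x + b) * χ w (x + b')))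

    X≤ : ∀ b b' → b < p → b' < p → X b b' ≤ n * 𝟙 (b' ≟ b) + m
    X≤ b b' b<p b'<p with b' ≟ b
    ... | yes refl = ≤-trans (≤-trans (∑-mono (upTo p) (λ {x} _ → ≤-trans (∑-mono (upTo f) (λ {w} _ → ≤-trans (*-monoʳ-≤ (χ w (x + b)) (𝟙≤1 (inCoset? w (x + b)))) (≤-reflexive (*-identityʳ _)))) (≤-reflexive (∑-χ (x + b)))))
                       (≤-reflexive (trans (∑-unit b) (sym (*-identityʳ n))))) (m≤m+n (n * 1) m)
    ... | no b'≢b = ≤-trans (≤-trans (∑-mono (upTo p) (λ {x} _ → ∑χχ≤ (x + b) (x + b'))) (∑-ratios b b' (λ b~b' → b'≢b (sym (mod-unique b b' b<p b'<p b~b'))))) (m≤n+m m (n * 0))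

  g : ℕ → ℕ → ℕ → ℕ
  g w x J = ∑ (upTo J) (λ b → χ w (x + b))

  ∑∑g : ∀ J → ∑ (upTo p) (λ x → ∑ (upTo f) (λ w → g w x J)) ≡ J * n
  ∑∑g J = begin
    ∑ (upTo p) (λ x → ∑ (upTo f) (λ w → g w x J))  ≡⟨ ∑-cong (upTo p) (λ {x} _ → trans (∑-swap (upTo f) (upTo J)) (∑-cong (upTo J) (λ {b} _ → ∑-χ (x + b)))) ⟩
    ∑ (upTo p) (λ x → ∑ (upTo J) (λ b → unit (x + b)))  ≡⟨ ∑-swap (upTo p) (upTo J) ⟩
    ∑ (upTo J) (λ b → ∑ (upTo p) (λ x → unit (x + b)))  ≡⟨ ∑-cong (upTo J) (λ {b} _ → ∑-unit b) ⟩
    ∑ (upTo J) (λ _ → n)  ≡⟨ ∑-upTo-const J n ⟩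
    J * n  ∎
    where open ≡-Reasoning

  -- The J diagonal pairs of shifts contribute n each, and every pair contributes at most m beyond
  -- that.
  ∑∑g² : ∀ J → J ≤ p → ∑ (upTo p) (λ x → ∑ (upTo f) (λ w → g w x J * g w x J)) ≤ J * (n + J * m)
  ∑∑g² J J≤p = begin
    ∑ xs (λ x → ∑ ws (λ w → g w x J * g w x J))  ≡⟨ ∑-cong xs (λ {x} _ → ∑-cong ws (λ {w} _ → trans (sym (∑-*ʳ bs (g w x J))) (∑-cong bs (λ {b} _ → sym (∑-*ˡ bs (χ w (x + b))))))) ⟩
    ∑ xs (λ x → ∑ ws (λ w → ∑ bs (λ b → ∑ bs (λ b' → χ w (x + b) * χ w (x + b')))))  ≡⟨ ∑-cong xs (λ _ → ∑-swap ws bs) ⟩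
    ∑ xs (λ x → ∑ bs (λ b → ∑ ws (λ w → ∑ bs (λ b' → χ w (x + b) * χ w (x + b')))))  ≡⟨ ∑-swap xs bs ⟩
    ∑ bs (λ b → ∑ xs (λ x → ∑ ws (λ w → ∑ bs (λ b' → χ w (x + b) * χ w (x + b')))))  ≡⟨ ∑-cong bs (λ _ → trans (∑-cong xs (λ _ → ∑-swap ws bs)) (∑-swap xs bs)) ⟩
    ∑ bs (λ b → ∑ bs (λ b' → X b b'))  ≤⟨ ∑-mono bs (λ {b} b∈ → inner b (∈-upTo⁻ b∈)) ⟩
    ∑ bs (λ _ → n + J * m)  ≡⟨ ∑-upTo-const J (n + J * m) ⟩
    J * (n + J * m)  ∎
    where
    open ≤-Reasoning
    xs = upTo p
    ws = upTo f
    bs = upTo J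
    inner : ∀ b → b < J → ∑ bs (λ b' → X b b') ≤ n + J * m
    inner b b<J = begin
      ∑ bs (λ b' → X b b')  ≤⟨ ∑-mono bs (λ {b'} b'∈ → X≤ b b' (<-≤-trans b<J J≤p) (<-≤-trans (∈-upTo⁻ b'∈) J≤p)) ⟩
      ∑ bs (λ b' → n * 𝟙 (b' ≟ b) + m)  ≡⟨ ∑-+ bs ⟩
      ∑ bs (λ b' → n * 𝟙 (b' ≟ b)) + ∑ bs (λ _ → m)  ≡⟨ cong₂ _+_ (∑-*ˡ bs n) (∑-upTo-const J m) ⟩
      n * ∑ bs (λ b' → 𝟙 (b' ≟ b)) + J * m  ≤⟨ +-monoˡ-≤ (J * m) (*-monoʳ-≤ n (∑-𝟙≤1 J (_≟ b) (λ _ _ e e' → trans e (sym e')))) ⟩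
      n * 1 + J * m  ≡⟨ cong (_+ J * m) (*-identityʳ n) ⟩
      n + J * m  ∎

  -- Excess of the coset over its expected share of the interval [x, x + J), scaled by f.
  Ψ : ℕ → ℕ → ℕ → ℤ
  Ψ w x J = ℤ.+ (f * g w x J) ℤ.- ℤ.+ J

  -- The mean-square bound per unit of interval length: `variance` reads J * U at every scale J,
  -- which is what the halving argument needs.
  U : ℕ
  U = 2 * (f * f) * p

  private
    sq-Ψ : ∀ w x J → sq (Ψ w x J) + 2 * (f * J) * g w x J ≡ f * f * (g w x J * g w x J) + J * J
    sq-Ψ w x J = ℤP.+-injective (begin
      ℤ.+ sq (Ψ w x J) ℤ.+ ℤ.+ (2 * (f * J) * G)
        ≡⟨ cong₂ ℤ._+_ (trans (pos-sq (Ψ w x J)) (cong (λ z → (z ℤ.- ℤ.+ J) ℤ.* (z ℤ.- ℤ.+ J)) (ℤP.pos-* f G)))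
             (trans (ℤP.pos-* (2 * (f * J)) G) (cong (λ z → z ℤ.* ℤ.+ G) (trans (ℤP.pos-* 2 (f * J)) (cong (λ z → ℤ.+ 2 ℤ.* z) (ℤP.pos-* f J))))) ⟩
      (ℤ.+ f ℤ.* ℤ.+ G ℤ.- ℤ.+ J) ℤ.* (ℤ.+ f ℤ.* ℤ.+ G ℤ.- ℤ.+ J) ℤ.+ ℤ.+ 2 ℤ.* (ℤ.+ f ℤ.* ℤ.+ J) ℤ.* ℤ.+ G
        ≡⟨ ring (ℤ.+ f) (ℤ.+ G) (ℤ.+ J) ⟩
      ℤ.+ f ℤ.* ℤ.+ f ℤ.* (ℤ.+ G ℤ.* ℤ.+ G) ℤ.+ ℤ.+ J ℤ.* ℤ.+ J
        ≡⟨ cong₂ ℤ._+_ (trans (ℤP.pos-* (f * f) (G * G)) (cong₂ ℤ._*_ (ℤP.pos-* f f) (ℤP.pos-* G G))) (ℤP.pos-* J J) ⟨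
      ℤ.+ (f * f * (G * G) + J * J) ∎)
      where
      open ≡-Reasoning
      G = g w x J
      ring : ∀ f g j → (f ℤ.* g ℤ.- j) ℤ.* (f ℤ.* g ℤ.- j) ℤ.+ ℤ.+ 2 ℤ.* (f ℤ.* j) ℤ.* g ≡ f ℤ.* f ℤ.* (g ℤ.* g) ℤ.+ j ℤ.* j
      ring = ℤSolver.solve-∀

  -- Expand (f g - J)² and keep the cross term on the left to stay in ℕ. Since f m = n and p = n +
  -- 1, the terms in J² n cancel; what remains is f² J n + f J², at most 2 f² J p.
  variance : ∀ J → J ≤ p → ∑ (upTo p) (λ x → ∑ (upTo f) (λ w → sq (Ψ w x J))) ≤ J * U
  variance J J≤p = +-cancelʳ-≤ (2 * (f * J) * (J * n)) V (J * U) (begin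
    V + 2 * (f * J) * (J * n)
      ≡⟨ cong (V +_) (trans (cong (2 * (f * J) *_) (sym (∑∑g J))) (sym (∑∑-*ˡ (2 * (f * J))))) ⟩
    V + ∑ xs (λ x → ∑ ws (λ w → 2 * (f * J) * g w x J))
      ≡⟨ ∑∑-+ ⟨
    ∑ xs (λ x → ∑ ws (λ w → sq (Ψ w x J) + 2 * (f * J) * g w x J))
      ≡⟨ ∑-cong xs (λ {x} _ → ∑-cong ws (λ {w} _ → sq-Ψ w x J)) ⟩
    ∑ xs (λ x → ∑ ws (λ w → f * f * (g w x J * g w x J) + J * J))
      ≡⟨ ∑∑-+ ⟩
    ∑ xs (λ x → ∑ ws (λ w → f * f * (g w x J * g w x J))) + ∑ xs (λ _ → ∑ ws (λ _ → J * J))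
      ≡⟨ cong₂ _+_ (∑∑-*ˡ (f * f)) (trans (∑-upTo-const p _) (cong (p *_) (∑-upTo-const f (J * J)))) ⟩
    f * f * ∑ xs (λ x → ∑ ws (λ w → g w x J * g w x J)) + p * (f * (J * J))
      ≤⟨ +-monoˡ-≤ _ (*-monoʳ-≤ (f * f) (∑∑g² J J≤p)) ⟩
    f * f * (J * (n + J * m)) + p * (f * (J * J))
      ≡⟨ trans (ring₁ f J n m) (cong (λ k → f * f * J * n + f * J * J * k + (n + 1) * (f * (J * J))) (sym n≡f*m)) ⟩
    f * f * J * n + f * J * J * n + (n + 1) * (f * (J * J))
      ≡⟨ ring₂ f J n ⟩
    (f * f * J * n + f * J * J) + 2 * (f * J) * (J * n)
      ≤⟨ +-monoˡ-≤ (2 * (f * J) * (J * n)) (+-mono-≤ (*-monoʳ-≤ (f * f * J) (n≤1+n n)) (*-mono-≤ (*-monoˡ-≤ J (m≤m*n f f)) J≤p)) ⟩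
    (f * f * J * p + f * f * J * p) + 2 * (f * J) * (J * n)
      ≡⟨ cong (_+ 2 * (f * J) * (J * n)) (ring₃ f J p) ⟩
    J * U + 2 * (f * J) * (J * n) ∎)
    where
    open ≤-Reasoning
    xs = upTo p
    ws = upTo f
    V = ∑ xs (λ x → ∑ ws (λ w → sq (Ψ w x J)))
    ∑∑-+ : {h k : ℕ → ℕ → ℕ} → ∑ xs (λ x → ∑ ws (λ w → h x w + k x w)) ≡ ∑ xs (λ x → ∑ ws (h x)) + ∑ xs (λ x → ∑ ws (k x))
    ∑∑-+ {h} {k} = trans (∑-cong xs (λ {x} _ → ∑-+ ws {h x} {k x})) (∑-+ xs {λ x → ∑ ws (h x)} {λ x → ∑ ws (k x)})
    ∑∑-*ˡ : ∀ c {h : ℕ → ℕ → ℕ} → ∑ xs (λ x → ∑ ws (λ w → c * h x w)) ≡ c * ∑ xs (λ x → ∑ ws (h x))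
    ∑∑-*ˡ c = trans (∑-cong xs (λ _ → ∑-*ˡ ws c)) (∑-*ˡ xs c)
    ring₁ : ∀ f J n m → f * f * (J * (n + J * m)) + suc n * (f * (J * J)) ≡ f * f * J * n + f * J * J * (f * m) + (n + 1) * (f * (J * J))
    ring₁ = solve-∀
    ring₂ : ∀ f J n → f * f * J * n + f * J * J * n + (n + 1) * (f * (J * J)) ≡ (f * f * J * n + f * J * J) + 2 * (f * J) * (J * n)
    ring₂ = solve-∀
    ring₃ : ∀ f J p → f * f * J * p + f * f * J * p ≡ J * (2 * (f * f) * p)
    ring₃ = solve-∀

  Ψ-+ : ∀ w x J K → Ψ w x (J + K) ≡ Ψ w x J ℤ.+ Ψ w (x + J) K
  Ψ-+ w x J K = trans (cong₂ ℤ._-_ (trans (cong ℤ.+_ (trans (cong (f *_) split) (*-distribˡ-+ f (g w x J) (g w (x + J) K)))) (ℤP.pos-+ (f * g w x J) (f * g w (x + J) K))) (ℤP.pos-+ J K))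
    (ring (ℤ.+ (f * g w x J)) (ℤ.+ (f * g w (x + J) K)) (ℤ.+ J) (ℤ.+ K))
    where
    split : g w x (J + K) ≡ g w x J + g w (x + J) K
    split = trans (∑-upTo-+ J K) (cong (g w x J +_) (∑-cong (upTo K) (λ {i} _ → cong (χ w) (sym (+-assoc x J i)))))
    ring : ∀ a b j k → (a ℤ.+ b) ℤ.- (j ℤ.+ k) ≡ (a ℤ.- j) ℤ.+ (b ℤ.- k)
    ring = ℤSolver.solve-∀

  private
    -- The excess smoothed over A consecutive starting points. At J = 1 the sum is the excess over
    -- an interval of length A.
    Φ : ℕ → ℕ → ℕ → ℕ → ℤ
    Φ w α A J = Z.∑ (upTo A) (λ a → Ψ w (α + a) J)

    -- Cauchy-Schwarz over the A starting points, which are then enlarged to a full period so that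
    -- `variance` applies.
    ∑Φ² : ∀ α A J → A ≤ p → J ≤ p → ∑ (upTo f) (λ w → sq (Φ w α A J)) ≤ A * J * U
    ∑Φ² α A J A≤p J≤p = begin
      ∑ (upTo f) (λ w → sq (Φ w α A J))  ≤⟨ ∑-mono (upTo f) (λ {w} _ → ≤-trans (cauchy-schwarz (upTo A) (λ a → Ψ w (α + a) J))
          (≤-trans (*-monoʳ-≤ (length (upTo A)) (∑-upTo-mono A≤p)) (≤-reflexive (cong (_* _) (length-upTo A))))) ⟩
      ∑ (upTo f) (λ w → A * ∑ (upTo p) (λ a → sq (Ψ w (α + a) J)))  ≡⟨ ∑-*ˡ (upTo f) A ⟩
      A * ∑ (upTo f) (λ w → ∑ (upTo p) (λ a → sq (Ψ w (α + a) J)))  ≡⟨ cong (A *_) (∑-cong (upTo f) (λ {w} _ → ∑-shift p {λ x → sq (Ψ w x J)} (periodic w) α)) ⟩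
      A * ∑ (upTo f) (λ w → ∑ (upTo p) (λ x → sq (Ψ w x J)))  ≡⟨ cong (A *_) (∑-swap (upTo f) (upTo p)) ⟩
      A * ∑ (upTo p) (λ x → ∑ (upTo f) (λ w → sq (Ψ w x J)))  ≤⟨ *-monoʳ-≤ A (variance J J≤p) ⟩
      A * (J * U)  ≡⟨ *-assoc A J U ⟨
      A * J * U  ∎
      where
      open ≤-Reasoning
      periodic : ∀ w x → sq (Ψ w (p + x) J) ≡ sq (Ψ w x J)
      periodic w x = cong (λ k → sq (ℤ.+ (f * k) ℤ.- ℤ.+ J)) (∑-cong (upTo J) (λ {b} _ → trans (cong (χ w) (+-assoc p x b)) (χ-periodic w (x + b))))

    -- An interval of length 2 J splits into two, the second beginning J later. Shifting the
    -- starting points by J trades J of them at the beginning for J beyond the end, so the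
    -- corrections are smoothed sums with A = J, which `∑Φ²` controls.
    Φ-double : ∀ w α M J → Φ w α M (J + J) ℤ.+ (Φ w α J J ℤ.+ ℤ.- Φ w (α + M) J J) ≡ ℤ.+ 2 ℤ.* Φ w α M J
    Φ-double w α M J = trans (cong₂ (λ a b → a ℤ.+ (Φ w α J J ℤ.+ ℤ.- b)) doubled tail) (ring (Φ w α M J) S₁ (Φ w α J J) S₂ exchange)
      where
      h : ℕ → ℤ
      h a = Ψ w (α + a) J
      S₁ = Z.∑ (upTo M) (λ a → h (J + a))
      S₂ = Z.∑ (upTo J) (λ a → h (M + a))
      doubled : Φ w α M (J + J) ≡ Φ w α M J ℤ.+ S₁
      doubled = trans (Z.∑-cong (upTo M) (λ {a} _ → trans (Ψ-+ w (α + a) J J) (cong (λ z → h a ℤ.+ Ψ w z J) (trans (+-assoc α a J) (cong (α +_) (+-comm a J)))))) (Z.∑-+ (upTo M))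
      tail : Φ w (α + M) J J ≡ S₂
      tail = Z.∑-cong (upTo J) (λ {a} _ → cong (λ z → Ψ w z J) (+-assoc α M a))
      exchange : Φ w α J J ℤ.+ S₁ ≡ Φ w α M J ℤ.+ S₂
      exchange = trans (sym (Z.∑-upTo-+ J M)) (trans (cong (λ k → Z.∑ (upTo k) h) (+-comm J M)) (Z.∑-upTo-+ M J))
      ring : ∀ a s₁ b s₂ → b ℤ.+ s₁ ≡ a ℤ.+ s₂ → (a ℤ.+ s₁) ℤ.+ (b ℤ.+ ℤ.- s₂) ≡ ℤ.+ 2 ℤ.* a
      ring a s₁ b s₂ eq = trans (r₁ a s₁ b s₂) (trans (cong (λ z → a ℤ.+ (z ℤ.+ ℤ.- s₂)) eq) (r₂ a s₂))
        where
        r₁ : ∀ a s₁ b s₂ → (a ℤ.+ s₁) ℤ.+ (b ℤ.+ ℤ.- s₂) ≡ a ℤ.+ ((b ℤ.+ s₁) ℤ.+ ℤ.- s₂)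
        r₁ = ℤSolver.solve-∀
        r₂ : ∀ a s₂ → a ℤ.+ ((a ℤ.+ s₂) ℤ.+ ℤ.- s₂) ≡ ℤ.+ 2 ℤ.* a
        r₂ = ℤSolver.solve-∀

    Φ-1 : ∀ w α M → Φ w α M 1 ≡ Ψ w α M
    Φ-1 w α zero    = cong (λ k → ℤ.+ k ℤ.- ℤ.0ℤ) (sym (*-zeroʳ f))
    Φ-1 w α (suc M) = trans (Z.∑-upTo-suc M) (trans (cong (λ z → z ℤ.+ Ψ w (α + M) 1) (Φ-1 w α M)) (trans (sym (Ψ-+ w α M 1)) (cong (Ψ w α) (+-comm M 1))))

  -- Pólya–Vinogradov on average over the cosets, by halving the smoothing length J = 2^i down to 1.
  module _ (k M : ℕ) (2^k≤p : 2 ^ k ≤ p) (p<2^1+k : p < 2 ^ suc k) (M≤p : M ≤ p) where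

    private
      -- In ℓ² norm over w, `Φ-double` reads 2 ‖Φ at J‖ ≤ ‖Φ at 2 J‖ + 2 J √U. Divided by J, the
      -- bound thus grows by √U at each halving, from the value 2 √U at the scale 2^k, where M ≤ p <
      -- 2 · 2^k.
      descent : ∀ j i → i + j ≡ k → ∑ (upTo f) (λ w → sq (Φ w 1 M (2 ^ i))) ≤ ((2 + j) * 2 ^ i) * ((2 + j) * 2 ^ i) * U
      descent zero i eq = begin
        ∑ (upTo f) (λ w → sq (Φ w 1 M (2 ^ i)))  ≤⟨ ∑Φ² 1 M (2 ^ i) M≤p (subst (λ e → 2 ^ e ≤ p) k≡i 2^k≤p) ⟩
        M * 2 ^ i * U  ≤⟨ *-monoˡ-≤ U (*-mono-≤ (≤-trans M≤p (<⇒≤ (subst (λ e → p < 2 ^ suc e) k≡i p<2^1+k))) (m≤n*m (2 ^ i) 2)) ⟩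
        (2 * 2 ^ i) * (2 * 2 ^ i) * U  ∎
        where
        open ≤-Reasoning
        k≡i : k ≡ i
        k≡i = trans (sym eq) (+-identityʳ i)
      descent (suc j) i eq = *-cancelˡ-≤ 4 (begin
        4 * ∑ ws (λ w → sq (Φ w 1 M J))  ≡⟨ ∑-*ˡ ws 4 ⟨
        ∑ ws (λ w → 4 * sq (Φ w 1 M J))  ≡⟨ ∑-cong ws (λ {w} _ → trans (cong sq (Φ-double w 1 M J)) (sq-* (ℤ.+ 2) (Φ w 1 M J))) ⟨
        ∑ ws (λ w → sq (Φ w 1 M (J + J) ℤ.+ (Φ w 1 J J ℤ.+ ℤ.- Φ w (1 + M) J J)))  ≤⟨ minkowski ws (λ w → Φ w 1 M (J + J)) (λ w → Φ w 1 J J ℤ.+ ℤ.- Φ w (1 + M) J J) ((2 + j) * 2 ^ suc i) (J + J) U {{m*n≢0 (2 + j) (2 ^ suc i) {{_}} {{m^n≢0 2 (suc i)}}}} {{>-nonZero (≤-trans J≥1 (m≤m+n J J))}} main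
            (minkowski ws (λ w → Φ w 1 J J) (λ w → ℤ.- Φ w (1 + M) J J) J J U {{>-nonZero J≥1}} {{>-nonZero J≥1}} (∑Φ² 1 J J J≤p J≤p)
                (≤-trans (≤-reflexive (∑-cong ws (λ {w} _ → sq-neg (Φ w (1 + M) J J)))) (∑Φ² (1 + M) J J J≤p J≤p))) ⟩
        ((2 + j) * 2 ^ suc i + (J + J)) * ((2 + j) * 2 ^ suc i + (J + J)) * U  ≡⟨ ring j J U ⟩
        4 * ((3 + j) * J * ((3 + j) * J) * U)  ∎)
        where
        open ≤-Reasoning
        ws = upTo f
        J = 2 ^ i
        J≥1 : 1 ≤ J
        J≥1 = m^n>0 2 i
        J≤p : J ≤ p
        J≤p = ≤-trans (^-monoʳ-≤ 2 (≤-trans (m≤m+n i (suc j)) (≤-reflexive eq))) 2^k≤p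
        main : ∑ ws (λ w → sq (Φ w 1 M (J + J))) ≤ ((2 + j) * 2 ^ suc i) * ((2 + j) * 2 ^ suc i) * U
        main = subst (λ K → ∑ ws (λ w → sq (Φ w 1 M K)) ≤ ((2 + j) * 2 ^ suc i) * ((2 + j) * 2 ^ suc i) * U) (cong (J +_) (+-identityʳ J)) (descent j (suc i) (trans (sym (+-suc i j)) eq))
        ring : ∀ j J U → ((2 + j) * (2 * J) + (J + J)) * ((2 + j) * (2 * J) + (J + J)) * U ≡ 4 * ((3 + j) * J * ((3 + j) * J) * U)
        ring = solve-∀

    polya-vinogradov : ∑ (upTo f) (λ w → sq (ℤ.+ (f * T w M) ℤ.- ℤ.+ M)) ≤ (2 + k) * (2 + k) * U
    polya-vinogradov = begin
      ∑ (upTo f) (λ w → sq (ℤ.+ (f * T w M) ℤ.- ℤ.+ M))  ≡⟨ ∑-cong (upTo f) (λ {w} _ → trans (cong (λ t → sq (ℤ.+ (f * t) ℤ.- ℤ.+ M)) (∑-range1 M)) (cong sq (sym (Φ-1 w 1 M)))) ⟩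
      ∑ (upTo f) (λ w → sq (Φ w 1 M (2 ^ 0)))  ≤⟨ descent k 0 refl ⟩
      (2 + k) * 1 * ((2 + k) * 1) * U  ≡⟨ cong (λ c → c * c * U) (*-identityʳ (2 + k)) ⟩
      (2 + k) * (2 + k) * U  ∎
      where open ≤-Reasoning

-- Products of coset elements

∑-range1-mono : ∀ {a b} {h : ℕ → ℕ} → a ≤ b → ∑ (range1 a) h ≤ ∑ (range1 b) h
∑-range1-mono {a} {b} a≤b = subst₂ _≤_ (sym (∑-range1 a)) (sym (∑-range1 b)) (∑-upTo-mono a≤b)

∑-𝟙∣≤d : ∀ M z → 1 ≤ z → ∑ (range1 M) (λ k → 𝟙 (k ∣? z)) ≤ d z
∑-𝟙∣≤d M z z≥1 = ≤-trans (∑-range1-mono (m≤m⊔n M z)) (≤-reflexive (∑-𝟙∣ (M ⊔ z) z z≥1 (m≤n⊔m M z)))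

module ProductSet (n : ℕ) (pr : Prime (suc n)) (f m : ℕ) (n≡f*m : n ≡ f * m) where

  open Order n pr
  open Coset n pr f m n≡f*m

  private instance _ = f≢0

  ind-*-mod-f : ∀ z w → ¬ p ∣ z → ¬ p ∣ w → ind (z * w) ≡ ind z + ind w mod f
  ind-*-mod-f z w p∤z p∤w = ∣-trans f∣n (ind-* z w p∤z p∤w)

  inCoset-* : ∀ {w w' y z} → InCoset w y → InCoset w' z → InCoset (w + w') (y * z)
  inCoset-* {w} {w'} {y} {z} (p∤y , f∣y) (p∤z , f∣z) = ∤-* p∤y p∤z ,
    mod-resp-∣ (w + w' + (ind y + ind z)) (w + w' + ind (y * z))
      (mod-+ (w + w') (w + w') (ind y + ind z) (ind (y * z)) (mod-refl (w + w')) (mod-sym (ind (y * z)) (ind y + ind z) (ind-*-mod-f y z p∤y p∤z)))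
      (subst (f ∣_) (rearrange w (ind y) w' (ind z)) (∣m∣n⇒∣m+n f∣y f∣z))
    where
    rearrange : ∀ a b c d → (a + b) + (c + d) ≡ a + c + (b + d)
    rearrange = solve-∀

  module _ (w M : ℕ) where

    private
      K : List ℕ
      K = filter (inCoset? w) (range1 M)

      K-length : length K ≡ T w M
      K-length = length-filter (inCoset? w) (range1 M)

      K⁻ : ∀ {k} → k ∈ K → (1 ≤ k × k ≤ M) × InCoset w k
      K⁻ k∈ = let (k∈r , c) = ∈-filter⁻ (inCoset? w) {xs = range1 M} k∈ in range1⁻ k∈r , c

      -- The number of ordered factorisations of z into r elements of `K`.
      R : ℕ → ℕ → ℕ
      R zero    z = 𝟙 (z ≟ 1)
      R (suc r) z = ∑ K (λ k → ∑ (range1 (M ^ r)) (λ y → 𝟙 (z ≟ k * y) * R r y))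

      R-total : ∀ r → ∑ (range1 (M ^ r)) (R r) ≡ T w M ^ r
      R-total zero    = refl
      R-total (suc r) = begin
        ∑ zs (λ z → ∑ K (λ k → ∑ ys (λ y → 𝟙 (z ≟ k * y) * R r y)))  ≡⟨ ∑-swap zs K ⟩
        ∑ K (λ k → ∑ zs (λ z → ∑ ys (λ y → 𝟙 (z ≟ k * y) * R r y)))  ≡⟨ ∑-cong K (λ k∈ → inner (K⁻ k∈)) ⟩
        ∑ K (λ _ → T w M ^ r)  ≡⟨ ∑-const K (T w M ^ r) ⟩
        length K * T w M ^ r  ≡⟨ cong (_* T w M ^ r) K-length ⟩
        T w M * T w M ^ r  ∎
        where
        open ≡-Reasoning
        zs = range1 (M ^ suc r)
        ys = range1 (M ^ r)
        inner : ∀ {k} → (1 ≤ k × k ≤ M) × InCoset w k → ∑ zs (λ z → ∑ ys (λ y → 𝟙 (z ≟ k * y) * R r y)) ≡ T w M ^ r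
        inner {k} ((k≥1 , k≤M) , _) = begin
          ∑ zs (λ z → ∑ ys (λ y → 𝟙 (z ≟ k * y) * R r y))  ≡⟨ ∑-swap zs ys ⟩
          ∑ ys (λ y → ∑ zs (λ z → 𝟙 (z ≟ k * y) * R r y))  ≡⟨ ∑-cong ys (λ {y} y∈ → let (y≥1 , y≤) = range1⁻ y∈ in trans (∑-*ʳ zs (R r y))
              (trans (cong (_* R r y) (∑-𝟙-range1 (M ^ suc r) (_≟ k * y) (*-mono-≤ k≥1 y≥1) (*-mono-≤ k≤M y≤) refl (λ _ _ e → e))) (*-identityˡ (R r y)))) ⟩
          ∑ ys (R r)  ≡⟨ R-total r ⟩
          T w M ^ r  ∎

      ind-1 : ind 1 ≡ 0
      ind-1 = ind-unique 1 0 (∤-range ≤-refl n≥1) n≥1 (mod-refl 1)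

      -- A product z of r elements has at most d(z)^r factorisations, and lies in the r-th power of the coset.
      R-bound : ∀ r z → 1 ≤ z → R r z ≤ d z ^ r * χ (r * w) z
      R-bound zero z z≥1 = 𝟙≤ (z ≟ 1) (λ { refl → ≤-trans (≤-reflexive (sym (𝟙-yes (inCoset? 0 1) (∤-range ≤-refl n≥1 , subst (f ∣_) (sym ind-1) (f ∣0))))) (≤-reflexive (sym (*-identityˡ (χ 0 1)))) })
      R-bound (suc r) z z≥1 = begin
        ∑ K (λ k → ∑ ys (λ y → 𝟙 (z ≟ k * y) * R r y))  ≤⟨ ∑-mono K (λ k∈ → inner (K⁻ k∈)) ⟩
        ∑ K (λ k → 𝟙 (k ∣? z) * B)  ≡⟨ ∑-*ʳ K B ⟩
        ∑ K (λ k → 𝟙 (k ∣? z)) * B  ≤⟨ *-monoˡ-≤ B (≤-trans (≤-reflexive (∑-filter (inCoset? w) (range1 M)))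
            (≤-trans (∑-mono (range1 M) (λ {k} _ → ≤-trans (*-monoˡ-≤ (𝟙 (k ∣? z)) (𝟙≤1 (inCoset? w k))) (≤-reflexive (*-identityˡ _)))) (∑-𝟙∣≤d M z z≥1))) ⟩
        d z * B  ≡⟨ *-assoc (d z) (d z ^ r) (χ (suc r * w) z) ⟨
        d z ^ suc r * χ (suc r * w) z  ∎
        where
        open ≤-Reasoning
        ys = range1 (M ^ r)
        B = d z ^ r * χ (suc r * w) z
        inner : ∀ {k} → (1 ≤ k × k ≤ M) × InCoset w k → ∑ ys (λ y → 𝟙 (z ≟ k * y) * R r y) ≤ 𝟙 (k ∣? z) * B
        inner {k} ((k≥1 , _) , k∈C) = begin
          ∑ ys (λ y → 𝟙 (z ≟ k * y) * R r y)  ≤⟨ ∑-mono ys (λ {y} y∈ → term y (proj₁ (range1⁻ y∈))) ⟩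
          ∑ ys (λ y → 𝟙 (z ≟ k * y) * (𝟙 (k ∣? z) * B))  ≡⟨ ∑-*ʳ ys (𝟙 (k ∣? z) * B) ⟩
          ∑ ys (λ y → 𝟙 (z ≟ k * y)) * (𝟙 (k ∣? z) * B)  ≤⟨ *-monoˡ-≤ (𝟙 (k ∣? z) * B) (≤-trans (≤-reflexive (∑-range1 (M ^ r)))
              (∑-𝟙≤1 (M ^ r) (λ y → z ≟ k * suc y) (λ _ _ e e' → suc-injective (*-cancelˡ-≡ _ _ k {{>-nonZero k≥1}} (trans (sym e) e'))))) ⟩
          1 * (𝟙 (k ∣? z) * B)  ≡⟨ *-identityˡ _ ⟩
          𝟙 (k ∣? z) * B  ∎
          where
          term : ∀ y → 1 ≤ y → 𝟙 (z ≟ k * y) * R r y ≤ 𝟙 (z ≟ k * y) * (𝟙 (k ∣? z) * B)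
          term y y≥1 with z ≟ k * y
          ... | no _     = z≤n
          ... | yes refl = *-monoʳ-≤ 1 (begin
            R r y  ≤⟨ R-bound r y y≥1 ⟩
            d y ^ r * χ (r * w) y  ≤⟨ *-mono-≤ (^-monoˡ-≤ r (d-mono-∣ z≥1 (n∣m*n k))) (𝟙-mono (inCoset? (r * w) y) (inCoset? (suc r * w) (k * y)) (inCoset-* {w} {r * w} k∈C)) ⟩
            B  ≡⟨ *-identityˡ B ⟨
            1 * B  ≡⟨ cong (_* B) (𝟙-yes (k ∣? (k * y)) (m∣m*n y)) ⟨
            𝟙 (k ∣? (k * y)) * B  ∎)

    -- The T^r products of r coset elements lie in [1, M^r] and in the coset with parameter r w, and
    -- each value is taken at most D times; `T-bound` counts that coset.
    product-bound : ∀ r D → (∀ z → 1 ≤ z → z ≤ M ^ r → d z ^ r ≤ D) → T w M ^ r * p ≤ D * (m * (M ^ r + p))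
    product-bound r D d≤D = begin
      T w M ^ r * p  ≡⟨ cong (_* p) (R-total r) ⟨
      ∑ (range1 (M ^ r)) (R r) * p  ≤⟨ *-monoˡ-≤ p (∑-mono (range1 (M ^ r)) (λ {z} z∈ → let (z≥1 , z≤) = range1⁻ z∈ in ≤-trans (R-bound r z z≥1) (*-monoˡ-≤ (χ (r * w) z) (d≤D z z≥1 z≤)))) ⟩
      ∑ (range1 (M ^ r)) (λ z → D * χ (r * w) z) * p  ≡⟨ cong (_* p) (∑-*ˡ (range1 (M ^ r)) D) ⟩
      D * T (r * w) (M ^ r) * p  ≡⟨ *-assoc D (T (r * w) (M ^ r)) p ⟩
      D * (T (r * w) (M ^ r) * p)  ≤⟨ *-monoʳ-≤ D (T-bound (r * w) (M ^ r)) ⟩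
      D * (m * (M ^ r + p))  ∎
      where open ≤-Reasoning

  χ-mod : ∀ w w' z → w ≡ w' mod f → χ w z ≡ χ w' z
  χ-mod w w' z eq = 𝟙-cong (inCoset? w z) (inCoset? w' z)
    (λ (p∤z , f∣) → p∤z , mod-resp-∣ (w + ind z) (w' + ind z) (mod-+ w w' (ind z) (ind z) eq (mod-refl (ind z))) f∣)
    (λ (p∤z , f∣) → p∤z , mod-resp-∣ (w' + ind z) (w + ind z) (mod-+ w' w (ind z) (ind z) (mod-sym w w' eq) (mod-refl (ind z))) f∣)

  excess : ℕ → ℕ → ℤ
  excess w M = ℤ.+ (f * T w M) ℤ.- ℤ.+ M

  excess-% : ∀ w M → excess (w % f) M ≡ excess w M
  excess-% w M = cong (λ t → ℤ.+ (f * t) ℤ.- ℤ.+ M) (∑-cong (range1 M) (λ {z} _ → χ-mod (w % f) w z (mod-% w)))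

  -- Multiplying the coset elements by l ≤ Y fills many cosets of [1, YM] above average.
  module _ (w M Y s k : ℕ) (YM≤n : Y * M ≤ n) (M≥1 : 1 ≤ M) (s-bound : ∀ w' → T w' Y ≤ s)
           (2^k≤p : 2 ^ k ≤ p) (p<2^1+k : p < 2 ^ suc k) where

    private
      -- The parameter w - ind l of the coset that contains l k for every k in the coset w.
      shifted : ℕ → ℕ
      shifted l = w + (n ∸ ind l)

      l-range : ∀ {l} → l ∈ range1 Y → 1 ≤ l × l ≤ n × l ≤ Y
      l-range l∈ = let (lo , hi) = range1⁻ l∈ in lo , ≤-trans hi (≤-trans (m≤m*n Y M {{>-nonZero M≥1}}) YM≤n) , hi

      transported : ∀ l k → ¬ p ∣ l → InCoset w k → InCoset (shifted l) (l * k)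
      transported l k p∤l (p∤k , f∣) = ∤-* p∤l p∤k , mod-resp-∣ (shifted l + (ind l + ind k)) (shifted l + ind (l * k))
        (mod-+ (shifted l) (shifted l) (ind l + ind k) (ind (l * k)) (mod-refl (shifted l)) (mod-sym (ind (l * k)) (ind l + ind k) (ind-*-mod-f l k p∤l p∤k)))
        (subst (f ∣_) (trans (cong (w + ind k +_) (sym (m∸n+n≡m (<⇒≤ (ind<n l))))) (rearrange w (ind k) (n ∸ ind l) (ind l))) (∣m∣n⇒∣m+n f∣ f∣n))
        where
        rearrange : ∀ a b c d → (a + b) + (c + d) ≡ a + c + (d + b)
        rearrange = solve-∀

      T-shifted : ∀ {l} → l ∈ range1 Y → T w M ≤ T (shifted l) (Y * M)
      T-shifted {l} l∈ = begin
        ∑ (range1 M) (χ w)  ≤⟨ ∑-mono (range1 M) (λ {k} _ → 𝟙-mono (inCoset? w k) (inCoset? (shifted l) (l * k)) (transported l k (∤-range l≥1 l≤n))) ⟩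
        ∑ (range1 M) (λ k → χ (shifted l) (l * k))  ≡⟨ ∑-multiples-range1 l M {{>-nonZero l≥1}} (χ (shifted l)) ⟨
        ∑ (range1 (l * M)) (λ h → 𝟙 (l ∣? h) * χ (shifted l) h)  ≤⟨ ∑-mono (range1 (l * M)) (λ {h} _ → ≤-trans (*-monoˡ-≤ (χ (shifted l) h) (𝟙≤1 (l ∣? h))) (≤-reflexive (*-identityˡ _))) ⟩
        ∑ (range1 (l * M)) (χ (shifted l))  ≤⟨ ∑-range1-mono (*-monoˡ-≤ M l≤Y) ⟩
        ∑ (range1 (Y * M)) (χ (shifted l))  ∎
        where
        open ≤-Reasoning
        l≥1 = proj₁ (l-range l∈)
        l≤n = proj₁ (proj₂ (l-range l∈))
        l≤Y = proj₂ (proj₂ (l-range l∈))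

      -- All l that lead to the same shifted coset lie in one coset themselves, with parameter w' -
      -- w modulo f, and [1, Y] contains at most s of its elements.
      hits : ∀ w' → ∑ (range1 Y) (λ l → 𝟙 (w' ≟ shifted l % f)) ≤ s
      hits w' = ≤-trans (∑-mono (range1 Y) (λ {l} l∈ → 𝟙-mono (w' ≟ shifted l % f) (inCoset? w'' l) (member l∈))) (s-bound w'')
        where
        w'' = w' + (f * w ∸ w)
        member : ∀ {l} → l ∈ range1 Y → w' ≡ shifted l % f → InCoset w'' l
        member {l} l∈ eq = ∤-range (proj₁ (l-range l∈)) (proj₁ (proj₂ (l-range l∈))) ,
          mod-resp-∣ (shifted l + (f * w ∸ w) + ind l) (w'' + ind l)
            (mod-+ (shifted l + (f * w ∸ w)) w'' (ind l) (ind l) (mod-+ (shifted l) w' (f * w ∸ w) (f * w ∸ w)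
              (subst (λ v → shifted l ≡ v mod f) (sym eq) (mod-sym (shifted l % f) (shifted l) (mod-% (shifted l)))) (mod-refl (f * w ∸ w))) (mod-refl (ind l)))
            (subst (f ∣_) (trans (cong₂ _+_ (sym (m∸n+n≡m (m≤n*m w f))) (sym (m∸n+n≡m (<⇒≤ (ind<n l))))) (rearrange (f * w ∸ w) w (n ∸ ind l) (ind l))) (∣m∣n⇒∣m+n (m∣m*n w) f∣n))
          where
          rearrange : ∀ a b c d → (a + b) + (c + d) ≡ b + c + a + d
          rearrange = solve-∀

      -- The expected share Y M is at most half of the scaled count, so at least half of the count
      -- is excess.
      excess-large : 2 * (Y * M) ≤ f * T w M → ∀ {l} → l ∈ range1 Y → (f * T w M) * (f * T w M) ≤ 4 * sq (excess (shifted l) (Y * M))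
      excess-large big {l} l∈ = ≤-trans (*-mono-≤ half half) (≤-reflexive (rearrange (f * T (shifted l) (Y * M) ∸ Y * M)
          (cong ℤ.∣_∣ (trans (ℤP.m-n≡m⊖n (f * T (shifted l) (Y * M)) (Y * M)) (ℤP.⊖-≥ YM≤)))))
        where
        a = f * T w M
        b = f * T (shifted l) (Y * M)
        a≤b : a ≤ b
        a≤b = *-monoʳ-≤ f (T-shifted l∈)
        YM≤ : Y * M ≤ b
        YM≤ = ≤-trans (m≤n*m (Y * M) 2) (≤-trans big a≤b)
        half : a ≤ 2 * (b ∸ Y * M)
        half = begin
          a  ≤⟨ m≤n+m∸n a (2 * (Y * M)) ⟩
          2 * (Y * M) + (a ∸ 2 * (Y * M))  ≤⟨ +-monoˡ-≤ _ big ⟩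
          a + (a ∸ 2 * (Y * M))  ≡⟨ +-∸-assoc a big ⟨
          (a + a) ∸ 2 * (Y * M)  ≡⟨ cong (_∸ 2 * (Y * M)) (cong (a +_) (sym (+-identityʳ a))) ⟩
          2 * a ∸ 2 * (Y * M)  ≡⟨ *-distribˡ-∸ 2 a (Y * M) ⟨
          2 * (a ∸ Y * M)  ≤⟨ *-monoʳ-≤ 2 (∸-monoˡ-≤ (Y * M) a≤b) ⟩
          2 * (b ∸ Y * M)  ∎
          where open ≤-Reasoning
        rearrange : ∀ c {e} → e ≡ c → (2 * c) * (2 * c) ≡ 4 * (e * e)
        rearrange c refl = ring c
          where
          ring : ∀ c → (2 * c) * (2 * c) ≡ 4 * (c * c)
          ring = solve-∀

    -- The squared excesses are summed over l; each coset is met at most s times, so the total is at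
    -- most s times the mean-square bound over all cosets.
    amplification : 2 * (Y * M) ≤ f * T w M → Y * ((f * T w M) * (f * T w M)) ≤ 4 * (s * ((2 + k) * (2 + k) * U))
    amplification big = begin
      Y * (a * a)  ≡⟨ cong (_* (a * a)) (length-applyUpTo suc Y) ⟨
      length (range1 Y) * (a * a)  ≡⟨ ∑-const (range1 Y) (a * a) ⟨
      ∑ (range1 Y) (λ _ → a * a)  ≤⟨ ∑-mono (range1 Y) (excess-large big) ⟩
      ∑ (range1 Y) (λ l → 4 * sq (excess (shifted l) (Y * M)))  ≡⟨ ∑-*ˡ (range1 Y) 4 ⟩
      4 * ∑ (range1 Y) (λ l → sq (excess (shifted l) (Y * M)))  ≡⟨ cong (4 *_) (∑-cong (range1 Y) (λ {l} _ → expand l)) ⟩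
      4 * ∑ (range1 Y) (λ l → ∑ (upTo f) (λ w' → 𝟙 (w' ≟ shifted l % f) * E w'))  ≡⟨ cong (4 *_) (∑-swap (range1 Y) (upTo f)) ⟩
      4 * ∑ (upTo f) (λ w' → ∑ (range1 Y) (λ l → 𝟙 (w' ≟ shifted l % f) * E w'))  ≡⟨ cong (4 *_) (∑-cong (upTo f) (λ {w'} _ → ∑-*ʳ (range1 Y) (E w'))) ⟩
      4 * ∑ (upTo f) (λ w' → ∑ (range1 Y) (λ l → 𝟙 (w' ≟ shifted l % f)) * E w')  ≤⟨ *-monoʳ-≤ 4 (∑-mono (upTo f) (λ {w'} _ → *-monoˡ-≤ (E w') (hits w'))) ⟩
      4 * ∑ (upTo f) (λ w' → s * E w')  ≡⟨ cong (4 *_) (∑-*ˡ (upTo f) s) ⟩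
      4 * (s * ∑ (upTo f) E)  ≤⟨ *-monoʳ-≤ 4 (*-monoʳ-≤ s (polya-vinogradov k (Y * M) 2^k≤p p<2^1+k (m≤n⇒m≤1+n YM≤n))) ⟩
      4 * (s * ((2 + k) * (2 + k) * U))  ∎
      where
      open ≤-Reasoning
      a = f * T w M
      E : ℕ → ℕ
      E w' = sq (excess w' (Y * M))
      expand : ∀ l → sq (excess (shifted l) (Y * M)) ≡ ∑ (upTo f) (λ w' → 𝟙 (w' ≟ shifted l % f) * E w')
      expand l = sym (trans (∑-cong (upTo f) (λ {w'} _ → 𝟙-*-cong (w' ≟ shifted l % f) (λ { refl → cong sq (excess-% (shifted l) (Y * M)) })))
        (trans (∑-*ʳ (upTo f) (sq (excess (shifted l) (Y * M)))) (trans (cong (_* sq (excess (shifted l) (Y * M))) (∑-𝟙-upTo f (_≟ shifted l % f) (m%n<n (shifted l) f) refl (λ _ e → e))) (*-identityˡ _))))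

-- Counting fixed points

gcd-coprime-parts : ∀ h c → 1 ≤ c → ∃ λ h' → ∃ λ c' → h ≡ gcd h c * h' × c ≡ gcd h c * c' × Coprime c' h'
gcd-coprime-parts h c c≥1 with gcd[m,n]∣m h c | gcd[m,n]∣n h c
... | divides h' eh | divides c' ec = h' , c' , trans eh (*-comm h' b) , trans ec (*-comm c' b) , cop
  where
  b = gcd h c
  instance b≢0 : NonZero b
           b≢0 = ≢-nonZero (λ b≡0 → <-irrefl (sym (trans ec (trans (cong (c' *_) b≡0) (*-zeroʳ c')))) c≥1)
  cop : Coprime c' h'
  cop {e} (e∣c' , e∣h') = ∣1⇒≡1 (*-cancelʳ-∣ b (subst (e * b ∣_) (sym (*-identityˡ b))
    (gcd-greatest (subst (e * b ∣_) (sym eh) (*-monoˡ-∣ b e∣h')) (subst (e * b ∣_) (sym ec) (*-monoˡ-∣ b e∣c')))))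

∑-linear-coprime : ∀ c h i → 1 ≤ c → Coprime c h → ∑ (upTo c) (λ v → 𝟙 ((v * h) ≡? i mod c)) ≡ 1
∑-linear-coprime c h i c≥1 cop with inverse-mod h cop
... | h' , h'h≡1 = ∑-𝟙-upTo c (λ v → (v * h) ≡? i mod c) (m%n<n (i * h') c) hit
      (λ {v} v<c eq → mod-unique v v₀ v<c (m%n<n (i * h') c) (mod-cancelʳ v v₀ h cop (mod-trans (v * h) i (v₀ * h) eq (mod-sym (v₀ * h) i hit))))
  where
  instance _ = >-nonZero c≥1
  v₀ = (i * h') % c
  hit : (v₀ * h) ≡ i mod c
  hit = mod-trans (v₀ * h) (i * h' * h) i (mod-* v₀ (i * h') h h (mod-% (i * h')) (mod-refl h))
    (subst₂ (λ x y → x ≡ y mod c) (sym (*-assoc i h' h)) (*-identityʳ i) (mod-* i i (h' * h) 1 (mod-refl i) h'h≡1))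

-- With b = gcd h c, division by a b leaves a congruence modulo c / b with coprime coefficient. Its
-- unique solution recurs b times below c.
∑-linear : ∀ a c h i → 1 ≤ a → 1 ≤ c →
           ∑ (upTo c) (λ v → 𝟙 ((a * v * h) ≡? i mod (a * c))) ≡ gcd h c * 𝟙 ((a * gcd h c) ∣? i)
∑-linear a c h i a≥1 c≥1 with gcd-coprime-parts h c c≥1
... | h' , c' , eh , ec , cop with (a * gcd h c) ∣? i
... | no ¬∣ = trans (∑-zero (upTo c) (λ {v} _ → 𝟙-no ((a * v * h) ≡? i mod (a * c)) (λ eq → ¬∣ (mod-resp-∣ (a * v * h) i
        (∣-trans (*-monoʳ-∣ a (gcd[m,n]∣n h c)) eq) (subst (a * gcd h c ∣_) (sym (*-assoc a v h)) (*-monoʳ-∣ a (∣n⇒∣m*n v (gcd[m,n]∣m h c))))))))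
        (sym (*-zeroʳ (gcd h c)))
... | yes (divides i' ei) = begin
  ∑ (upTo c) (λ v → 𝟙 ((a * v * h) ≡? i mod (a * c)))  ≡⟨ ∑-cong (upTo c) (λ {v} _ → 𝟙-cong ((a * v * h) ≡? i mod (a * c)) ((v * h') ≡? i' mod c') (unscale v) (scale v)) ⟩
  ∑ (upTo c) (λ v → 𝟙 ((v * h') ≡? i' mod c'))  ≡⟨ cong (λ k → ∑ (upTo k) (λ v → 𝟙 ((v * h') ≡? i' mod c'))) ec ⟩
  ∑ (upTo (b * c')) (λ v → 𝟙 ((v * h') ≡? i' mod c'))  ≡⟨ ∑-blocks c' periodic b ⟩
  ∑ (upTo b) (λ _ → ∑ (upTo c') (λ v → 𝟙 ((v * h') ≡? i' mod c')))  ≡⟨ ∑-upTo-const b _ ⟩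
  b * ∑ (upTo c') (λ v → 𝟙 ((v * h') ≡? i' mod c'))  ≡⟨ cong (b *_) (∑-linear-coprime c' h' i' c'≥1 cop) ⟩
  b * 1  ∎
  where
  open ≡-Reasoning
  b = gcd h c
  c'≥1 : 1 ≤ c'
  c'≥1 = n≢0⇒n>0 (λ c'≡0 → <-irrefl (sym (trans ec (trans (cong (b *_) c'≡0) (*-zeroʳ b)))) c≥1)
  b≥1 : 1 ≤ b
  b≥1 = n≢0⇒n>0 (λ b≡0 → <-irrefl (sym (trans ec (cong (_* c') b≡0))) c≥1)
  r₁ : ∀ a v b h → (a * b) * (v * h) ≡ a * v * (b * h)
  r₁ = solve-∀
  eqˡ : ∀ v → (a * b) * (v * h') ≡ a * v * h
  eqˡ v = trans (r₁ a v b h') (cong (a * v *_) (sym eh))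
  eqᵐ : (a * b) * c' ≡ a * c
  eqᵐ = trans (*-assoc a b c') (cong (a *_) (sym ec))
  eqʳ : (a * b) * i' ≡ i
  eqʳ = trans (*-comm (a * b) i') (sym ei)
  scale : ∀ v → (v * h') ≡ i' mod c' → (a * v * h) ≡ i mod (a * c)
  scale v eq = subst (λ k → (a * v * h) ≡ i mod k) eqᵐ (subst₂ (λ x y → x ≡ y mod (a * b * c')) (eqˡ v) eqʳ (mod-*-scale (a * b) (v * h') i' eq))
  unscale : ∀ v → (a * v * h) ≡ i mod (a * c) → (v * h') ≡ i' mod c'
  unscale v eq = mod-*-unscale (a * b) {{>-nonZero (*-mono-≤ a≥1 b≥1)}} (v * h') i'
    (subst₂ (λ x y → x ≡ y mod (a * b * c')) (sym (eqˡ v)) (sym eqʳ) (subst (λ k → (a * v * h) ≡ i mod k) (sym eqᵐ) eq))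
  periodic : ∀ v → 𝟙 (((c' + v) * h') ≡? i' mod c') ≡ 𝟙 ((v * h') ≡? i' mod c')
  periodic v = 𝟙-cong (((c' + v) * h') ≡? i' mod c') ((v * h') ≡? i' mod c')
    (mod-trans (v * h') ((c' + v) * h') i' (mod-sym ((c' + v) * h') (v * h') shift)) (mod-trans ((c' + v) * h') (v * h') i' shift)
    where
    shift : ((c' + v) * h') ≡ v * h' mod c'
    shift = subst (λ x → x ≡ v * h' mod c') (sym (*-distribʳ-+ h' c' v)) (mod-+-multiple (v * h') (c' * h') (m∣m*n h'))

module Count (n : ℕ) (pr : Prime (suc n)) where

  open Order n pr

  private
    g^~1⁻ : ∀ g k → ¬ p ∣ g → g ^ k ~ 1 → n ∣ ind g * k
    g^~1⁻ g k p∤g eq = γ^~1⁻ (ind g * k) (mod-trans (γ ^ (ind g * k)) (g ^ k) 1 (mod-sym (g ^ k) (γ ^ (ind g * k)) (ind-^ g k (ind g) (γ^ind g p∤g))) eq)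

    g^~1⁺ : ∀ g k → ¬ p ∣ g → n ∣ ind g * k → g ^ k ~ 1
    g^~1⁺ g k p∤g n∣ = mod-trans (g ^ k) (γ ^ (ind g * k)) 1 (ind-^ g k (ind g) (γ^ind g p∤g)) (γ^~1⁺ (ind g * k) n∣)

  primitive⇒coprime : ∀ g → ¬ p ∣ g → IsPrimitiveRoot p g → gcd (ind g) n ≡ 1
  primitive⇒coprime g p∤g (_ , all) with gcd[m,n]∣n (ind g) n | gcd[m,n]∣m (ind g) n
  ... | divides n' en | divides u' eu with gcd (ind g) n ≟ 1
  ... | yes D≡1 = D≡1
  ... | no D≢1 = ⊥-elim (All.lookup all (range1⁺ n'≥1 (<⇒≤pred n'<n)) (g^~1⁺ g n' p∤g (divides u'
          (trans (cong (_* n') eu) (trans (*-assoc u' D n') (cong (u' *_) (trans (*-comm D n') (sym en))))))))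
    where
    D = gcd (ind g) n
    n'≥1 : 1 ≤ n'
    n'≥1 = n≢0⇒n>0 (λ n'≡0 → <-irrefl (sym (trans en (cong (_* D) n'≡0))) n≥1)
    D≥1 : 1 ≤ D
    D≥1 = n≢0⇒n>0 (λ D≡0 → <-irrefl (sym (trans en (trans (cong (n' *_) D≡0) (*-zeroʳ n')))) n≥1)
    n'<n : n' < n
    n'<n = subst (n' <_) (sym en) (m<m*n n' D {{>-nonZero n'≥1}} (≤∧≢⇒< D≥1 (D≢1 ∘ sym)))

  coprime⇒primitive : ∀ g → ¬ p ∣ g → gcd (ind g) n ≡ 1 → IsPrimitiveRoot p g
  coprime⇒primitive g p∤g D≡1 = fermat g p∤g , All.tabulate (λ {k} k∈ eq → let (k≥1 , k≤) = range1⁻ k∈ in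
    <⇒≱ (s≤s k≤) (≤-trans (≤-reflexive (m+[n∸m]≡n n≥1)) (∣⇒≤ {{>-nonZero k≥1}} (coprime-divisor (Coprimality.sym (gcd≡1⇒coprime {ind g} {n} D≡1)) (g^~1⁻ g k p∤g eq)))))

  solutions : ℕ → ℕ → ℕ
  solutions u h = 𝟙 (gcd u n ≟ 1) * 𝟙 ((u * h) ≡? ind h mod n)

  goodPair≡ : ∀ {g h} → g ∈ range1 n → h ∈ range1 n → 𝟙 (goodPair? p (g , h)) ≡ solutions (ind g) h
  goodPair≡ {g} {h} g∈ h∈ = trans (𝟙-× (isPrimitiveRoot? p g) ((g ^ h) ≡? h mod p)) (cong₂ _*_
      (𝟙-cong (isPrimitiveRoot? p g) (gcd (ind g) n ≟ 1) (primitive⇒coprime g p∤g) (coprime⇒primitive g p∤g))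
      (𝟙-cong ((g ^ h) ≡? h mod p) ((ind g * h) ≡? ind h mod n)
        (λ eq → γ^-inj (ind g * h) (ind h) (mod-trans (γ ^ (ind g * h)) (g ^ h) (γ ^ ind h) (mod-sym (g ^ h) (γ ^ (ind g * h)) g^h) (mod-trans (g ^ h) h (γ ^ ind h) eq (mod-sym (γ ^ ind h) h γ^h))))
        (λ eq → mod-trans (g ^ h) (γ ^ (ind g * h)) h g^h (mod-trans (γ ^ (ind g * h)) (γ ^ ind h) h (γ^-cong (ind g * h) (ind h) eq) γ^h))))
    where
    p∤g = let (lo , hi) = range1⁻ g∈ in ∤-range lo hi
    p∤h = let (lo , hi) = range1⁻ h∈ in ∤-range lo hi
    g^h = ind-^ g h (ind g) (γ^ind g p∤g)
    γ^h = γ^ind h p∤h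

  FPR≡ : FPR p ≡ ∑ (upTo n) (λ u → ∑ (range1 n) (solutions u))
  FPR≡ = begin
    FPR p  ≡⟨ length-filter (goodPair? p) (cartesianProduct (range1 n) (range1 n)) ⟩
    ∑ (cartesianProduct (range1 n) (range1 n)) (𝟙 ∘ goodPair? p)  ≡⟨ ∑-cartesianProduct (range1 n) (range1 n) ⟩
    ∑ (range1 n) (λ g → ∑ (range1 n) (λ h → 𝟙 (goodPair? p (g , h))))  ≡⟨ ∑-cong (range1 n) (λ g∈ → ∑-cong (range1 n) (λ h∈ → goodPair≡ g∈ h∈)) ⟩
    ∑ (range1 n) (λ g → ∑ (range1 n) (solutions (ind g)))  ≡⟨ ∑-by-index (λ u → ∑ (range1 n) (solutions u)) ⟩
    ∑ (upTo n) (λ u → ∑ (range1 n) (solutions u))  ∎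
    where open ≡-Reasoning

  φ≡ : φ n ≡ ∑ (upTo n) (λ u → 𝟙 (gcd u n ≟ 1))
  φ≡ = trans (length-filter (λ k → gcd k n ≟ 1) (range1 n)) (∑-upTo-ends n (cong (λ k → 𝟙 (k ≟ 1))
    (trans (∣-antisym (gcd[m,n]∣n 0 n) (gcd-greatest (n ∣0) ∣-refl)) (∣-antisym (gcd-greatest ∣-refl ∣-refl) (gcd[m,n]∣n n n)))))

  A : ℕ → ℕ
  A a = ∑ (upTo n) (λ u → 𝟙 (a ∣? u) * ∑ (range1 n) (λ h → 𝟙 ((u * h) ≡? ind h mod n)))

  A* : ℕ → ℕ
  A* a = ∑ (upTo n) (λ u → 𝟙 (a ∣? u))

  private
    weighted-sieve : ∀ (l : List (ℤ × ℕ)) → IsSieve n l → (F : ℕ → ℕ) →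
      ℤ.+ ∑ (upTo n) (λ u → 𝟙 (gcd u n ≟ 1) * F u) ≡ Z.∑ l (λ (s , a) → s ℤ.* ℤ.+ ∑ (upTo n) (λ u → 𝟙 (a ∣? u) * F u))
    weighted-sieve l (_ , _ , detects) F = begin
      ℤ.+ ∑ us (λ u → 𝟙 (gcd u n ≟ 1) * F u)  ≡⟨ pos-∑ us _ ⟩
      Z.∑ us (λ u → ℤ.+ (𝟙 (gcd u n ≟ 1) * F u))  ≡⟨ Z.∑-cong us (λ {u} _ → trans (ℤP.pos-* (𝟙 (gcd u n ≟ 1)) (F u)) (cong (λ z → z ℤ.* ℤ.+ F u) (trans (pos-𝟙 (gcd u n ≟ 1)) (sym (detects u))))) ⟩
      Z.∑ us (λ u → Z.∑ l (λ (s , a) → s ℤ.* Z.𝟙 (a ∣? u)) ℤ.* ℤ.+ F u)  ≡⟨ Z.∑-cong us (λ {u} _ → sym (Z.∑-*ʳ l (ℤ.+ F u))) ⟩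
      Z.∑ us (λ u → Z.∑ l (λ (s , a) → s ℤ.* Z.𝟙 (a ∣? u) ℤ.* ℤ.+ F u))  ≡⟨ Z.∑-swap us l ⟩
      Z.∑ l (λ (s , a) → Z.∑ us (λ u → s ℤ.* Z.𝟙 (a ∣? u) ℤ.* ℤ.+ F u))  ≡⟨ Z.∑-cong l (λ { {s , a} _ → trans (Z.∑-cong us (λ {u} _ → trans (ℤP.*-assoc s (Z.𝟙 (a ∣? u)) (ℤ.+ F u)) (cong (λ z → s ℤ.* z) (trans (cong (λ z → z ℤ.* ℤ.+ F u) (sym (pos-𝟙 (a ∣? u)))) (sym (ℤP.pos-* (𝟙 (a ∣? u)) (F u)))))))
          (trans (Z.∑-*ˡ us s) (cong (λ z → s ℤ.* z) (sym (pos-∑ us _)))) }) ⟩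
      Z.∑ l (λ (s , a) → s ℤ.* ℤ.+ ∑ us (λ u → 𝟙 (a ∣? u) * F u))  ∎
      where
      open ≡-Reasoning
      us = upTo n

  Err≤ : ∀ B → (∀ a → a ∣ n → ℤ.∣ ℤ.+ A a ℤ.- ℤ.+ A* a ∣ ≤ B) → Err p ≤ d n * B
  Err≤ B bound with sieve n n≥1
  ... | l , isSieve@(div , len , _) = begin
    Err p  ≡⟨ cong ℤ.∣_∣ (cong₂ ℤ._-_ FPR-sieved φ-sieved) ⟩
    ℤ.∣ Z.∑ l (λ (s , a) → s ℤ.* ℤ.+ A a) ℤ.- Z.∑ l (λ (s , a) → s ℤ.* ℤ.+ A* a) ∣  ≡⟨ cong ℤ.∣_∣ difference ⟩
    ℤ.∣ Z.∑ l (λ (s , a) → s ℤ.* (ℤ.+ A a ℤ.- ℤ.+ A* a)) ∣  ≤⟨ ∣∑∣≤ l {λ (s , a) → s ℤ.* (ℤ.+ A a ℤ.- ℤ.+ A* a)} B (λ { {s , a} a∈ → ≤-trans (≤-reflexive (ℤP.abs-* s _))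
        (≤-trans (*-mono-≤ (proj₁ (div a∈)) (bound a (proj₂ (div a∈)))) (≤-reflexive (*-identityˡ B))) }) ⟩
    length l * B  ≤⟨ *-monoˡ-≤ B len ⟩
    d n * B  ∎
    where
    open ≤-Reasoning
    FPR-sieved : ℤ.+ FPR p ≡ Z.∑ l (λ (s , a) → s ℤ.* ℤ.+ A a)
    FPR-sieved = trans (cong ℤ.+_ (trans FPR≡ (∑-cong (upTo n) (λ {u} _ → ∑-*ˡ (range1 n) (𝟙 (gcd u n ≟ 1)))))) (weighted-sieve l isSieve (λ u → ∑ (range1 n) (λ h → 𝟙 ((u * h) ≡? ind h mod n))))
    φ-sieved : ℤ.+ φ n ≡ Z.∑ l (λ (s , a) → s ℤ.* ℤ.+ A* a)
    φ-sieved = trans (cong ℤ.+_ (trans φ≡ (∑-cong (upTo n) (λ {u} _ → sym (*-identityʳ (𝟙 (gcd u n ≟ 1)))))))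
      (trans (weighted-sieve l isSieve (λ _ → 1)) (Z.∑-cong l (λ { {s , a} _ → cong (λ z → s ℤ.* ℤ.+ z) (∑-cong (upTo n) (λ {u} _ → *-identityʳ (𝟙 (a ∣? u)))) })))
    difference : Z.∑ l (λ (s , a) → s ℤ.* ℤ.+ A a) ℤ.- Z.∑ l (λ (s , a) → s ℤ.* ℤ.+ A* a) ≡ Z.∑ l (λ (s , a) → s ℤ.* (ℤ.+ A a ℤ.- ℤ.+ A* a))
    difference = trans (cong (λ z → Z.∑ l (λ (s , a) → s ℤ.* ℤ.+ A a) ℤ.+ z) (trans (sym (ℤP.-1*i≡-i (Z.∑ l (λ (s , a) → s ℤ.* ℤ.+ A* a)))) (sym (Z.∑-*ˡ l ℤ.-1ℤ))))
      (trans (sym (Z.∑-+ l)) (Z.∑-cong l (λ { {s , a} _ → ring s (ℤ.+ A a) (ℤ.+ A* a) })))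
      where
      ring : ∀ s x y → s ℤ.* x ℤ.+ ℤ.-1ℤ ℤ.* (s ℤ.* y) ≡ s ℤ.* (x ℤ.- y)
      ring = ℤSolver.solve-∀

  -- A weight of mean value 1: a b divides one index in a b.
  P : ℕ → ℕ → ℕ → ℕ
  P a b h = a * b * 𝟙 ((a * b) ∣? ind h)

  Δ : ℕ → ℕ → ℕ → ℤ
  Δ a b c = Z.∑ (range1 n) (λ h → Z.𝟙 (gcd h c ≟ b) ℤ.* (ℤ.+ P a b h ℤ.- ℤ.1ℤ))

  module _ (a c : ℕ) (n≡a*c : n ≡ a * c) where

    private
      a≥1 : 1 ≤ a
      a≥1 = n≢0⇒n>0 (λ a≡0 → <-irrefl (sym (trans n≡a*c (cong (_* c) a≡0))) n≥1)

      c≥1 : 1 ≤ c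
      c≥1 = n≢0⇒n>0 (λ c≡0 → <-irrefl (sym (trans n≡a*c (trans (cong (a *_) c≡0) (*-zeroʳ a)))) n≥1)

      instance _ = >-nonZero a≥1

    A≡ : A a ≡ ∑ (range1 n) (λ h → gcd h c * 𝟙 ((a * gcd h c) ∣? ind h))
    A≡ = begin
      ∑ (upTo n) (λ u → 𝟙 (a ∣? u) * G u)  ≡⟨ cong (λ k → ∑ (upTo k) (λ u → 𝟙 (a ∣? u) * G u)) n≡a*c ⟩
      ∑ (upTo (a * c)) (λ u → 𝟙 (a ∣? u) * G u)  ≡⟨ ∑-multiples-upTo a c G ⟩
      ∑ (upTo c) (λ v → G (a * v))  ≡⟨ ∑-swap (upTo c) (range1 n) ⟩
      ∑ (range1 n) (λ h → ∑ (upTo c) (λ v → 𝟙 ((a * v * h) ≡? ind h mod n)))  ≡⟨ ∑-cong (range1 n) (λ {h} _ → trans (cong (λ k → ∑ (upTo c) (λ v → 𝟙 ((a * v * h) ≡? ind h mod k))) n≡a*c) (∑-linear a c h (ind h) a≥1 c≥1)) ⟩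
      ∑ (range1 n) (λ h → gcd h c * 𝟙 ((a * gcd h c) ∣? ind h))  ∎
      where
      open ≡-Reasoning
      G : ℕ → ℕ
      G u = ∑ (range1 n) (λ h → 𝟙 ((u * h) ≡? ind h mod n))

    A*≡ : A* a ≡ c
    A*≡ = begin
      ∑ (upTo n) (λ u → 𝟙 (a ∣? u))  ≡⟨ cong (λ k → ∑ (upTo k) (λ u → 𝟙 (a ∣? u))) n≡a*c ⟩
      ∑ (upTo (a * c)) (λ u → 𝟙 (a ∣? u))  ≡⟨ ∑-cong (upTo (a * c)) (λ {u} _ → *-identityʳ (𝟙 (a ∣? u))) ⟨
      ∑ (upTo (a * c)) (λ u → 𝟙 (a ∣? u) * 1)  ≡⟨ ∑-multiples-upTo a c (λ _ → 1) ⟩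
      ∑ (upTo c) (λ _ → 1)  ≡⟨ trans (∑-upTo-const c 1) (*-identityʳ c) ⟩
      c  ∎
      where open ≡-Reasoning

    private
      -- Multiplied by a, the main term c becomes a c = n, the number of all h, so a 1 can be
      -- subtracted for each h. This is the reason for scaling by a.
      scaled : ℤ.+ a ℤ.* (ℤ.+ A a ℤ.- ℤ.+ A* a) ≡ Z.∑ (divisors n) (λ b → Δ a b c)
      scaled = begin
        ℤ.+ a ℤ.* (ℤ.+ A a ℤ.- ℤ.+ A* a)  ≡⟨ expand (ℤ.+ a) (ℤ.+ A a) (ℤ.+ A* a) ⟩
        ℤ.+ a ℤ.* ℤ.+ A a ℤ.+ ℤ.-1ℤ ℤ.* (ℤ.+ a ℤ.* ℤ.+ A* a)  ≡⟨ cong₂ (λ x y → x ℤ.+ ℤ.-1ℤ ℤ.* y) (trans (sym (ℤP.pos-* a (A a))) (cong ℤ.+_ first)) (trans (sym (ℤP.pos-* a (A* a))) (cong ℤ.+_ second)) ⟩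
        ℤ.+ ∑ hs (λ h → P a (gcd h c) h) ℤ.+ ℤ.-1ℤ ℤ.* ℤ.+ ∑ hs (λ _ → 1)  ≡⟨ cong₂ (λ x y → x ℤ.+ ℤ.-1ℤ ℤ.* y) (pos-∑ hs _) (pos-∑ hs _) ⟩
        Z.∑ hs (λ h → ℤ.+ P a (gcd h c) h) ℤ.+ ℤ.-1ℤ ℤ.* Z.∑ hs (λ _ → ℤ.1ℤ)  ≡⟨ cong (λ y → Z.∑ hs (λ h → ℤ.+ P a (gcd h c) h) ℤ.+ y) (Z.∑-*ˡ hs ℤ.-1ℤ) ⟨
        Z.∑ hs (λ h → ℤ.+ P a (gcd h c) h) ℤ.+ Z.∑ hs (λ _ → ℤ.-1ℤ ℤ.* ℤ.1ℤ)  ≡⟨ Z.∑-+ hs ⟨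
        Z.∑ hs (λ h → ℤ.+ P a (gcd h c) h ℤ.- ℤ.1ℤ)  ≡⟨ Z.∑-cong hs (λ {h} _ → by-gcd h) ⟩
        Z.∑ hs (λ h → Z.∑ (divisors n) (λ b → Z.𝟙 (gcd h c ≟ b) ℤ.* (ℤ.+ P a b h ℤ.- ℤ.1ℤ)))  ≡⟨ Z.∑-swap hs (divisors n) ⟩
        Z.∑ (divisors n) (λ b → Δ a b c)  ∎
        where
        open ≡-Reasoning
        hs = range1 n
        expand : ∀ x y z → x ℤ.* (y ℤ.- z) ≡ x ℤ.* y ℤ.+ ℤ.-1ℤ ℤ.* (x ℤ.* z)
        expand = ℤSolver.solve-∀
        first : a * A a ≡ ∑ hs (λ h → P a (gcd h c) h)
        first = trans (cong (a *_) A≡) (trans (sym (∑-*ˡ hs a)) (∑-cong hs (λ {h} _ → sym (*-assoc a (gcd h c) _))))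
        second : a * A* a ≡ ∑ hs (λ _ → 1)
        second = trans (cong (a *_) A*≡) (trans (sym n≡a*c) (sym (trans (∑-range1 n) (trans (∑-upTo-const n 1) (*-identityʳ n)))))
        by-gcd : ∀ h → ℤ.+ P a (gcd h c) h ℤ.- ℤ.1ℤ ≡ Z.∑ (divisors n) (λ b → Z.𝟙 (gcd h c ≟ b) ℤ.* (ℤ.+ P a b h ℤ.- ℤ.1ℤ))
        by-gcd h = sym (trans (Z.∑-cong (divisors n) (λ {b} _ → Z.𝟙-*-cong (gcd h c ≟ b) {ℤ.+ P a b h ℤ.- ℤ.1ℤ} {v} (λ eq → cong (λ b → ℤ.+ P a b h ℤ.- ℤ.1ℤ) (sym eq))))
          (trans (Z.∑-*ʳ (divisors n) v) (trans (cong (λ z → z ℤ.* v) one) (ℤP.*-identityˡ v))))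
          where
          v = ℤ.+ P a (gcd h c) h ℤ.- ℤ.1ℤ
          gcd∣n : gcd h c ∣ n
          gcd∣n = subst (gcd h c ∣_) (sym n≡a*c) (∣n⇒∣m*n a (gcd[m,n]∣n h c))
          gcd≥1 : 1 ≤ gcd h c
          gcd≥1 = n≢0⇒n>0 (λ eq → <-irrefl (sym (0∣⇒≡0 (subst (_∣ n) eq gcd∣n))) n≥1)
          one : Z.∑ (divisors n) (λ b → Z.𝟙 (gcd h c ≟ b)) ≡ ℤ.1ℤ
          one = trans (Z.∑-filter (_∣? n) (range1 n)) (trans (Z.∑-cong (range1 n) (λ {b} _ → trans (sym (Z.𝟙-× (b ∣? n) (gcd h c ≟ b)))
            (Z.𝟙-cong (b ∣? n ×-dec gcd h c ≟ b) (gcd h c ≟ b) proj₂ (λ eq → subst (_∣ n) eq gcd∣n , eq))))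
            (Z.∑-𝟙-range1 n (λ b → gcd h c ≟ b) gcd≥1 (∣⇒≤ {{>-nonZero n≥1}} gcd∣n) refl (λ _ _ → sym)))

    ∣A-A*∣≤ : ∀ W → (∀ b → b ∣ c → ℤ.∣ Δ a b c ∣ ≤ a * W) → ℤ.∣ ℤ.+ A a ℤ.- ℤ.+ A* a ∣ ≤ d n * W
    ∣A-A*∣≤ W bound = *-cancelˡ-≤ a (begin
      a * ℤ.∣ ℤ.+ A a ℤ.- ℤ.+ A* a ∣  ≡⟨ ℤP.abs-* (ℤ.+ a) (ℤ.+ A a ℤ.- ℤ.+ A* a) ⟨
      ℤ.∣ ℤ.+ a ℤ.* (ℤ.+ A a ℤ.- ℤ.+ A* a) ∣  ≡⟨ cong ℤ.∣_∣ scaled ⟩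
      ℤ.∣ Z.∑ (divisors n) (λ b → Δ a b c) ∣  ≤⟨ ∣∑∣≤ (divisors n) {λ b → Δ a b c} (a * W) (λ {b} _ → each b) ⟩
      d n * (a * W)  ≡⟨ ring (d n) a W ⟩
      a * (d n * W)  ∎)
      where
      open ≤-Reasoning
      ring : ∀ x y z → x * (y * z) ≡ y * (x * z)
      ring = solve-∀
      each : ∀ b → ℤ.∣ Δ a b c ∣ ≤ a * W
      each b with b ∣? c
      ... | yes b∣c = bound b b∣c
      ... | no b∤c = ≤-trans (≤-reflexive (cong ℤ.∣_∣ (Z.∑-zero (range1 n) (λ {h} _ → trans (cong (λ z → z ℤ.* (ℤ.+ P a b h ℤ.- ℤ.1ℤ))
              (Z.𝟙-no (gcd h c ≟ b) (λ eq → b∤c (subst (_∣ c) eq (gcd[m,n]∣n h c))))) (ℤP.*-zeroˡ (ℤ.+ P a b h ℤ.- ℤ.1ℤ)))))) z≤n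

  Err≤² : ∀ W → (∀ a b e → n ≡ a * (b * e) → ℤ.∣ Δ a b (b * e) ∣ ≤ a * W) → Err p ≤ d n * (d n * W)
  Err≤² W bound = Err≤ (d n * W) (λ { a (divides c n≡c*a) → let n≡a*c = trans n≡c*a (*-comm c a) in
    ∣A-A*∣≤ a c n≡a*c W (λ { b (divides e c≡e*b) → let c≡b*e = trans c≡e*b (*-comm e b) in
      subst (λ c → ℤ.∣ Δ a b c ∣ ≤ a * W) (sym c≡b*e) (bound a b e (trans n≡a*c (cong (a *_) c≡b*e))) }) })

  module _ (a b e : ℕ) (n≡abe : n ≡ a * (b * e)) where

    private
      m : ℕ
      m = a * e

      n≡ab*e : n ≡ (a * b) * e
      n≡ab*e = trans n≡abe (sym (*-assoc a b e))

      n≡b*m : n ≡ b * m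
      n≡b*m = trans n≡abe (ring a b e)
        where
        ring : ∀ a b e → a * (b * e) ≡ b * (a * e)
        ring = solve-∀

      pos-of : ∀ {x y} → n ≡ x * y → 1 ≤ x
      pos-of {x} {y} eq = n≢0⇒n>0 (λ x≡0 → <-irrefl (sym (trans eq (cong (_* y) x≡0))) n≥1)

      b≥1 : 1 ≤ b
      b≥1 = pos-of n≡b*m

      a≥1 : 1 ≤ a
      a≥1 = pos-of n≡abe

      e≥1 : 1 ≤ e
      e≥1 = pos-of (trans n≡ab*e (*-comm (a * b) e))

      instance _ = >-nonZero b≥1

      c : ℕ
      c = b * e

      gcd-b* : ∀ k → gcd (b * k) c ≡ b → gcd k e ≡ 1
      gcd-b* k eq = *-cancelˡ-≡ (gcd k e) 1 b (trans (c*gcd[m,n]≡gcd[cm,cn] b k e) (trans eq (sym (*-identityʳ b))))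

      gcd-b*⁻ : ∀ k → gcd k e ≡ 1 → gcd (b * k) c ≡ b
      gcd-b*⁻ k eq = trans (sym (c*gcd[m,n]≡gcd[cm,cn] b k e)) (trans (cong (b *_) eq) (*-identityʳ b))

      gcd⇒∣ : ∀ h → gcd h c ≡ b → b ∣ h
      gcd⇒∣ h eq = subst (_∣ h) eq (gcd[m,n]∣m h c)

    module Small = ProductSet n pr (a * b) e n≡ab*e
    module SmallC = Coset n pr (a * b) e n≡ab*e
    module Large = Coset n pr b m n≡b*m

    -- Write h = b k with k coprime to e and sieve this condition by q ∣ e. With k = q j, the
    -- condition a b ∣ ind (b q j) places j in the coset with parameter ind (b q), so each sieved
    -- sum is an excess over [1, a e / q].
    Δ-small : ∀ E → (∀ w M → M ≤ n → ℤ.∣ Small.excess w M ∣ ≤ E) → ℤ.∣ Δ a b c ∣ ≤ d e * E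
    Δ-small E bound with sieve e e≥1
    ... | l , div , len , detects = let open ≤-Reasoning in begin
      ℤ.∣ Δ a b c ∣  ≡⟨ cong ℤ.∣_∣ sieved ⟩
      ℤ.∣ Z.∑ l (λ (s , q) → s ℤ.* inner q) ∣  ≤⟨ ∣∑∣≤ l {λ (s , q) → s ℤ.* inner q} E (λ { {s , q} q∈ → ≤-trans (≤-reflexive (ℤP.abs-* s (inner q)))
          (≤-trans (*-mono-≤ (proj₁ (div q∈)) (inner≤ q (proj₂ (div q∈)))) (≤-reflexive (*-identityˡ E))) }) ⟩
      length l * E  ≤⟨ *-monoˡ-≤ E len ⟩
      d e * E  ∎
      where
      F : ℕ → ℤ
      F h = ℤ.+ P a b h ℤ.- ℤ.1ℤ
      inner : ℕ → ℤ
      inner q = Z.∑ (range1 m) (λ k → Z.𝟙 (q ∣? k) ℤ.* F (b * k))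
      sieved : Δ a b c ≡ Z.∑ l (λ (s , q) → s ℤ.* inner q)
      sieved = begin
        Z.∑ (range1 n) (λ h → Z.𝟙 (gcd h c ≟ b) ℤ.* F h)  ≡⟨ Z.∑-cong (range1 n) (λ {h} _ → guard h) ⟩
        Z.∑ (range1 n) (λ h → Z.𝟙 (b ∣? h) ℤ.* (Z.𝟙 (gcd h c ≟ b) ℤ.* F h))  ≡⟨ cong (λ k → Z.∑ (range1 k) (λ h → Z.𝟙 (b ∣? h) ℤ.* (Z.𝟙 (gcd h c ≟ b) ℤ.* F h))) n≡b*m ⟩
        Z.∑ (range1 (b * m)) (λ h → Z.𝟙 (b ∣? h) ℤ.* (Z.𝟙 (gcd h c ≟ b) ℤ.* F h)) ≡⟨ Z.∑-multiples-range1 b m (λ h → Z.𝟙 (gcd h c ≟ b) ℤ.* F h) ⟩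
        Z.∑ (range1 m) (λ k → Z.𝟙 (gcd (b * k) c ≟ b) ℤ.* F (b * k))  ≡⟨ Z.∑-cong (range1 m) (λ {k} _ → trans (cong (λ z → z ℤ.* F (b * k)) (trans (Z.𝟙-cong (gcd (b * k) c ≟ b) (gcd k e ≟ 1) (gcd-b* k) (gcd-b*⁻ k)) (sym (detects k)))) (sym (Z.∑-*ʳ l (F (b * k))))) ⟩
        Z.∑ (range1 m) (λ k → Z.∑ l (λ (s , q) → s ℤ.* Z.𝟙 (q ∣? k) ℤ.* F (b * k))) ≡⟨ Z.∑-swap (range1 m) l ⟩
        Z.∑ l (λ (s , q) → Z.∑ (range1 m) (λ k → s ℤ.* Z.𝟙 (q ∣? k) ℤ.* F (b * k))) ≡⟨ Z.∑-cong l (λ { {s , q} _ → trans (Z.∑-cong (range1 m) (λ {k} _ → ℤP.*-assoc s (Z.𝟙 (q ∣? k)) (F (b * k)))) (Z.∑-*ˡ (range1 m) s) }) ⟩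
        Z.∑ l (λ (s , q) → s ℤ.* inner q)  ∎
        where
        open ≡-Reasoning
        guard : ∀ h → Z.𝟙 (gcd h c ≟ b) ℤ.* F h ≡ Z.𝟙 (b ∣? h) ℤ.* (Z.𝟙 (gcd h c ≟ b) ℤ.* F h)
        guard h with gcd h c ≟ b
        ... | yes eq = sym (trans (cong (λ z → z ℤ.* (ℤ.1ℤ ℤ.* F h)) (Z.𝟙-yes (b ∣? h) (gcd⇒∣ h eq))) (ℤP.*-identityˡ (ℤ.1ℤ ℤ.* F h)))
        ... | no _   = trans (ℤP.*-zeroˡ (F h)) (sym (trans (cong (λ z → Z.𝟙 (b ∣? h) ℤ.* z) (ℤP.*-zeroˡ (F h))) (ℤP.*-zeroʳ (Z.𝟙 (b ∣? h)))))
      inner≤ : ∀ q → q ∣ e → ℤ.∣ inner q ∣ ≤ E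
      inner≤ q (divides e' e≡e'q) = ≤-trans (≤-reflexive (cong ℤ.∣_∣ inner≡)) (bound (ind (b * q)) M M≤n)
        where
        q≥1 : 1 ≤ q
        q≥1 = n≢0⇒n>0 (λ q≡0 → <-irrefl (sym (trans e≡e'q (trans (cong (e' *_) q≡0) (*-zeroʳ e')))) e≥1)
        instance _ = >-nonZero q≥1
        M = a * e'
        m≡q*M : m ≡ q * M
        m≡q*M = trans (cong (a *_) e≡e'q) (ring a e' q)
          where
          ring : ∀ a e q → a * (e * q) ≡ q * (a * e)
          ring = solve-∀
        n≡bq*M : n ≡ b * q * M
        n≡bq*M = trans n≡b*m (trans (cong (b *_) m≡q*M) (sym (*-assoc b q M)))
        M≤n : M ≤ n
        M≤n = subst (M ≤_) (sym n≡bq*M) (m≤n*m M (b * q) {{>-nonZero (*-mono-≤ b≥1 q≥1)}})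
        f = a * b
        term : ∀ {j} → j ∈ range1 M → F (b * (q * j)) ≡ ℤ.+ (f * SmallC.χ (ind (b * q)) j) ℤ.- ℤ.1ℤ
        term {j} j∈ = cong (λ k → ℤ.+ (f * k) ℤ.- ℤ.1ℤ) (𝟙-cong (f ∣? ind (b * (q * j))) (SmallC.inCoset? (ind (b * q)) j)
            (λ f∣ → p∤j , mod-resp-∣ (ind (b * (q * j))) (ind (b * q) + ind j) same f∣)
            (λ (_ , f∣) → mod-resp-∣ (ind (b * q) + ind j) (ind (b * (q * j))) (mod-sym (ind (b * (q * j))) (ind (b * q) + ind j) same) f∣))
          where
          lo = proj₁ (range1⁻ j∈)
          hi = proj₂ (range1⁻ j∈)
          p∤j = ∤-range lo (≤-trans hi M≤n)
          p∤bq = ∤-range (*-mono-≤ b≥1 q≥1) (subst (b * q ≤_) (sym n≡bq*M) (m≤m*n (b * q) M {{>-nonZero (≤-trans lo hi)}}))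
          same : ind (b * (q * j)) ≡ ind (b * q) + ind j mod f
          same = subst (λ z → ind z ≡ ind (b * q) + ind j mod f) (*-assoc b q j) (Small.ind-*-mod-f (b * q) j p∤bq p∤j)
        inner≡ : inner q ≡ Small.excess (ind (b * q)) M
        inner≡ = begin
          Z.∑ (range1 m) (λ k → Z.𝟙 (q ∣? k) ℤ.* F (b * k))  ≡⟨ cong (λ k → Z.∑ (range1 k) (λ k → Z.𝟙 (q ∣? k) ℤ.* F (b * k))) m≡q*M ⟩
          Z.∑ (range1 (q * M)) (λ k → Z.𝟙 (q ∣? k) ℤ.* F (b * k))  ≡⟨ Z.∑-multiples-range1 q M (λ k → F (b * k)) ⟩
          Z.∑ (range1 M) (λ j → F (b * (q * j)))  ≡⟨ Z.∑-cong (range1 M) term ⟩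
          Z.∑ (range1 M) (λ j → ℤ.+ (f * SmallC.χ (ind (b * q)) j) ℤ.+ ℤ.-1ℤ)  ≡⟨ Z.∑-+ (range1 M) ⟩
          Z.∑ (range1 M) (λ j → ℤ.+ (f * SmallC.χ (ind (b * q)) j)) ℤ.+ Z.∑ (range1 M) (λ _ → ℤ.-1ℤ)  ≡⟨ cong₂ ℤ._+_ (trans (sym (pos-∑ (range1 M) _)) (cong ℤ.+_ (∑-*ˡ (range1 M) f))) minus ⟩
          ℤ.+ (f * SmallC.T (ind (b * q)) M) ℤ.- ℤ.+ M  ∎
          where
          open ≡-Reasoning
          minus : Z.∑ (range1 M) (λ _ → ℤ.-1ℤ) ≡ ℤ.- (ℤ.+ M)
          minus = trans (Z.∑-*ˡ (range1 M) ℤ.-1ℤ {λ _ → ℤ.1ℤ}) (trans (cong (λ z → ℤ.-1ℤ ℤ.* z) (trans (sym (pos-∑ (range1 M) (λ _ → 1))) (cong ℤ.+_ (trans (∑-range1 M) (trans (∑-upTo-const M 1) (*-identityʳ M)))))) (ℤP.-1*i≡-i (ℤ.+ M)))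

    private
      P-total : ℕ
      P-total = ∑ (range1 n) (λ h → 𝟙 (gcd h c ≟ b) * P a b h)

      Q-total : ℕ
      Q-total = ∑ (range1 n) (λ h → 𝟙 (gcd h c ≟ b))

      Δ≡ : Δ a b c ≡ ℤ.+ P-total ℤ.- ℤ.+ Q-total
      Δ≡ = begin
        Z.∑ hs (λ h → Z.𝟙 (gcd h c ≟ b) ℤ.* (ℤ.+ P a b h ℤ.- ℤ.1ℤ))  ≡⟨ Z.∑-cong hs (λ {h} _ → trans (cong (λ z → z ℤ.* (ℤ.+ P a b h ℤ.- ℤ.1ℤ)) (sym (pos-𝟙 (gcd h c ≟ b)))) (trans (ring (ℤ.+ 𝟙 (gcd h c ≟ b)) (ℤ.+ P a b h)) (cong (λ z → z ℤ.+ ℤ.-1ℤ ℤ.* ℤ.+ 𝟙 (gcd h c ≟ b)) (sym (ℤP.pos-* (𝟙 (gcd h c ≟ b)) (P a b h)))))) ⟩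
        Z.∑ hs (λ h → ℤ.+ (𝟙 (gcd h c ≟ b) * P a b h) ℤ.+ ℤ.-1ℤ ℤ.* ℤ.+ 𝟙 (gcd h c ≟ b))  ≡⟨ Z.∑-+ hs ⟩
        Z.∑ hs (λ h → ℤ.+ (𝟙 (gcd h c ≟ b) * P a b h)) ℤ.+ Z.∑ hs (λ h → ℤ.-1ℤ ℤ.* ℤ.+ 𝟙 (gcd h c ≟ b)) ≡⟨ cong₂ ℤ._+_ (sym (pos-∑ hs _)) (trans (Z.∑-*ˡ hs ℤ.-1ℤ) (trans (ℤP.-1*i≡-i _) (cong ℤ.-_ (sym (pos-∑ hs _))))) ⟩
        ℤ.+ P-total ℤ.- ℤ.+ Q-total  ∎
        where
        open ≡-Reasoning
        hs = range1 n
        ring : ∀ x y → x ℤ.* (y ℤ.- ℤ.1ℤ) ≡ x ℤ.* y ℤ.+ ℤ.-1ℤ ℤ.* x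
        ring = ℤSolver.solve-∀

      Δ≤ : ℤ.∣ Δ a b c ∣ ≤ P-total + Q-total
      Δ≤ = ≤-trans (≤-reflexive (cong ℤ.∣_∣ Δ≡)) (ℤP.∣i-j∣≤∣i∣+∣j∣ (ℤ.+ P-total) (ℤ.+ Q-total))

      Q≤m : Q-total ≤ m
      Q≤m = begin
        ∑ (range1 n) (λ h → 𝟙 (gcd h c ≟ b))  ≤⟨ ∑-mono (range1 n) (λ {h} _ → 𝟙-mono (gcd h c ≟ b) (b ∣? h) (gcd⇒∣ h)) ⟩
        ∑ (range1 n) (λ h → 𝟙 (b ∣? h))  ≡⟨ cong (λ k → ∑ (range1 k) (λ h → 𝟙 (b ∣? h))) n≡b*m ⟩
        ∑ (range1 (b * m)) (λ h → 𝟙 (b ∣? h))  ≡⟨ ∑-cong (range1 (b * m)) (λ {h} _ → *-identityʳ (𝟙 (b ∣? h))) ⟨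
        ∑ (range1 (b * m)) (λ h → 𝟙 (b ∣? h) * 1)  ≡⟨ ∑-multiples-range1 b m (λ _ → 1) ⟩
        ∑ (range1 m) (λ _ → 1)  ≡⟨ trans (∑-range1 m) (trans (∑-upTo-const m 1) (*-identityʳ m)) ⟩
        m  ∎
        where open ≤-Reasoning

      P≤T : P-total ≤ a * (b * Large.T (ind b) m)
      P≤T = begin
        ∑ (range1 n) (λ h → 𝟙 (gcd h c ≟ b) * P a b h)  ≤⟨ ∑-mono (range1 n) (λ {h} _ → *-mono-≤ (𝟙-mono (gcd h c ≟ b) (b ∣? h) (gcd⇒∣ h)) (*-monoʳ-≤ (a * b) (𝟙-mono ((a * b) ∣? ind h) (b ∣? ind h) (m*n∣⇒n∣ a b)))) ⟩
        ∑ (range1 n) (λ h → 𝟙 (b ∣? h) * (a * b * 𝟙 (b ∣? ind h)))  ≡⟨ cong (λ k → ∑ (range1 k) (λ h → 𝟙 (b ∣? h) * (a * b * 𝟙 (b ∣? ind h)))) n≡b*m ⟩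
        ∑ (range1 (b * m)) (λ h → 𝟙 (b ∣? h) * (a * b * 𝟙 (b ∣? ind h)))  ≡⟨ ∑-multiples-range1 b m (λ h → a * b * 𝟙 (b ∣? ind h)) ⟩
        ∑ (range1 m) (λ k → a * b * 𝟙 (b ∣? ind (b * k)))  ≡⟨ ∑-*ˡ (range1 m) (a * b) ⟩
        a * b * ∑ (range1 m) (λ k → 𝟙 (b ∣? ind (b * k)))  ≤⟨ *-monoʳ-≤ (a * b) (∑-mono (range1 m) (λ {k} k∈ → 𝟙-mono (b ∣? ind (b * k)) (Large.inCoset? (ind b) k) (member k∈))) ⟩
        a * b * Large.T (ind b) m  ≡⟨ *-assoc a b _ ⟩
        a * (b * Large.T (ind b) m)  ∎
        where
        open ≤-Reasoning
        member : ∀ {k} → k ∈ range1 m → b ∣ ind (b * k) → Large.InCoset (ind b) k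
        member {k} k∈ b∣ = p∤k , mod-resp-∣ (ind (b * k)) (ind b + ind k) (∣-trans Large.f∣n (ind-* b k p∤b p∤k)) b∣
          where
          lo = proj₁ (range1⁻ k∈)
          hi = proj₂ (range1⁻ k∈)
          p∤k = ∤-range lo (≤-trans hi (subst (m ≤_) (sym n≡b*m) (m≤n*m m b)))
          p∤b = ∤-range b≥1 (subst (b ≤_) (sym n≡b*m) (m≤m*n b m {{>-nonZero (≤-trans lo hi)}}))

    -- Weakening a b ∣ ind h to b ∣ ind h leaves a as an outer factor, to be removed by the scaling,
    -- and leads to a subgroup whose order m is also the length of the interval.
    Δ-large : ℤ.∣ Δ a b c ∣ ≤ a * (b * Large.T (ind b) m + m)
    Δ-large = ≤-trans Δ≤ (≤-trans (+-mono-≤ P≤T (≤-trans Q≤m (m≤n*m m a {{>-nonZero a≥1}}))) (≤-reflexive (sym (*-distribˡ-+ a _ m))))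

    -- With bm = p - 1 ≡ -1, a fixed point h = bk of order dividing m satisfies k^{2m} ≡ m^{2m}.
    Δ-tiny : 2 ≤ n → (∀ k → 1 ≤ k → k < m → ¬ p ∣ m ^ (2 * m) ∸ k ^ (2 * m)) → ℤ.∣ Δ a b c ∣ ≤ a * m
    Δ-tiny n≥2 nonExceptional = ≤-trans Δ≤ (≤-trans (≤-reflexive (cong (_+ Q-total) P≡0)) (≤-trans Q≤m (m≤n*m m a {{>-nonZero a≥1}})))
      where
      n²~1 : n * n ~ 1
      n²~1 = mod-+-cancelˡ n (n * n) 1 (mod-trans (n + n * n) 0 (n + 1)
        (mod-0⁺ (n + n * n) (m∣m*n n)) (mod-sym (n + 1) 0 (mod-0⁺ (n + 1) (∣-reflexive (+-comm 1 n)))))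
      power-eq : ∀ k → ¬ p ∣ b * k → b ∣ ind (b * k) → m ^ (2 * m) ~ k ^ (2 * m)
      power-eq k p∤bk (divides i eq) = mod-trans (m ^ N) (m ^ N * (b * k) ^ N) (k ^ N)
          (subst (_~ m ^ N * (b * k) ^ N) (*-identityʳ (m ^ N)) (mod-* (m ^ N) (m ^ N) 1 ((b * k) ^ N) (mod-refl (m ^ N)) (mod-sym ((b * k) ^ N) 1 h^N~1)))
          (subst (_~ k ^ N) reorder (subst ((n * n) ^ m * k ^ N ~_) (*-identityˡ (k ^ N)) (mod-* ((n * n) ^ m) 1 (k ^ N) (k ^ N) n^N~1 (mod-refl (k ^ N)))))
        where
        N = 2 * m
        h^N~1 : (b * k) ^ N ~ 1
        h^N~1 = g^~1⁺ (b * k) N p∤bk (divides (i * 2) (trans (cong (_* N) eq) (trans (ring i b m) (cong (i * 2 *_) (sym n≡b*m)))))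
          where
          ring : ∀ i b m → i * b * (2 * m) ≡ i * 2 * (b * m)
          ring = solve-∀
        n^N~1 : (n * n) ^ m ~ 1
        n^N~1 = subst ((n * n) ^ m ~_) (^-zeroˡ m) (mod-^ (n * n) 1 m n²~1)
        reorder : (n * n) ^ m * k ^ N ≡ m ^ N * (b * k) ^ N
        reorder = trans (cong (_* k ^ N) (trans (trans (cong (_^ m) (cong (n *_) (sym (*-identityʳ n)))) (^-*-assoc n 2 m)) (trans (cong (_^ N) n≡b*m) (^-distribʳ-* N b m))))
          (trans (ring (b ^ N) (m ^ N) (k ^ N)) (cong (m ^ N *_) (sym (^-distribʳ-* N b k))))
          where
          ring : ∀ x y z → x * y * z ≡ y * (x * z)
          ring = solve-∀
      none : ∀ {k} → k ∈ range1 m → gcd (b * k) c ≡ b → ¬ (a * b ∣ ind (b * k))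
      none {k} k∈ g≡b ab∣ with m≤n⇒m<n∨m≡n hi
        where hi = proj₂ (range1⁻ k∈)
      ... | inj₁ k<m = nonExceptional k lo k<m (mod-≤⁻ (m ^ (2 * m)) (k ^ (2 * m)) (^-monoˡ-≤ (2 * m) (<⇒≤ k<m)) (power-eq k p∤bk (m*n∣⇒n∣ a b ab∣)))
        where
        lo = proj₁ (range1⁻ k∈)
        p∤bk = ∤-range (*-mono-≤ b≥1 lo) (subst (b * k ≤_) (sym n≡b*m) (*-monoʳ-≤ b (<⇒≤ k<m)))
      -- The case h = n ≡ -1: here b = c, so n ∣ ind n, which would give n ≡ 1.
      ... | inj₂ refl = <-irrefl (sym (mod-unique n 1 ≤-refl (s≤s n≥1) n~1)) n≥2
        where
        c∣n : c ∣ n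
        c∣n = subst (c ∣_) (sym n≡abe) (n∣m*n a)
        b≡c : b ≡ c
        b≡c = trans (sym g≡b) (trans (cong (λ z → gcd z c) (sym n≡b*m)) (∣-antisym (gcd[m,n]∣n n c) (gcd-greatest c∣n ∣-refl)))
        n∣ind : n ∣ ind n
        n∣ind = subst₂ _∣_ (trans (cong (a *_) b≡c) (sym n≡abe)) (cong ind (sym n≡b*m)) ab∣
        ind≡0 : ind n ≡ 0
        ind≡0 with ind n in eq
        ... | zero  = refl
        ... | suc i = ⊥-elim (<⇒≱ (ind<n n) (∣⇒≤ {{>-nonZero (subst (1 ≤_) (sym eq) (s≤s z≤n))}} n∣ind))
        n~1 : n ~ 1
        n~1 = mod-trans n (γ ^ ind n) 1 (mod-sym (γ ^ ind n) n (γ^ind n (∤-range n≥1 ≤-refl))) (subst (λ i → γ ^ i ~ 1) (sym ind≡0) (mod-refl 1))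
      P≡0 : P-total ≡ 0
      P≡0 = ∑-zero (range1 n) each
        where
        each : ∀ {h} → h ∈ range1 n → 𝟙 (gcd h c ≟ b) * P a b h ≡ 0
        each {h} h∈ with gcd h c ≟ b
        ... | no _ = refl
        ... | yes g≡b with gcd⇒∣ h g≡b
        ... | divides k h≡k*b = trans (+-identityʳ _) (trans (cong (a * b *_) (𝟙-no ((a * b) ∣? ind h) (λ ab∣ → none k∈ (subst (λ z → gcd z c ≡ b) h≡b*k g≡b) (subst (λ z → a * b ∣ ind z) h≡b*k ab∣)))) (*-zeroʳ (a * b)))
          where
          h≡b*k : h ≡ b * k
          h≡b*k = trans h≡k*b (*-comm k b)
          k∈ : k ∈ range1 m
          k∈ = range1⁺ (n≢0⇒n>0 (λ k≡0 → <-irrefl (sym (trans h≡k*b (cong (_* b) k≡0))) (proj₁ (range1⁻ h∈))))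
            (*-cancelˡ-≤ b (subst₂ _≤_ h≡b*k n≡b*m (proj₂ (range1⁻ h∈))))

-- The error term

n*n≤m*m⇒n≤m : ∀ x y → x * x ≤ y * y → x ≤ y
n*n≤m*m⇒n≤m x y le = ^-cancelˡ-≤ 2 (subst₂ _≤_ (cong (x *_) (sym (*-identityʳ x))) (cong (y *_) (sym (*-identityʳ y))) le)

-- m is the order of the subgroup in question; k = m never occurs for a fixed point.
NonExceptional : ℕ → ℕ → Set
NonExceptional n M = ∀ m → m ∣ n → m ≤ M → ∀ k → 1 ≤ k → k < m → ¬ suc n ∣ m ^ (2 * m) ∸ k ^ (2 * m)

-- Sizes are recorded as x ≤ t^i. As t ≥ 2, adding two quantities of the same size or doubling one
-- costs a single power of t.
module Powers (t : ℕ) (t≥2 : 2 ≤ t) where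

  private instance _ = >-nonZero (<⇒≤ t≥2)

  ^-up : ∀ {x} i j → i ≤ j → x ≤ t ^ i → x ≤ t ^ j
  ^-up i j i≤j x≤ = ≤-trans x≤ (^-monoʳ-≤ t i≤j)

  *-^ : ∀ {x y} i j → x ≤ t ^ i → y ≤ t ^ j → x * y ≤ t ^ (i + j)
  *-^ i j x≤ y≤ = ≤-trans (*-mono-≤ x≤ y≤) (≤-reflexive (sym (^-distribˡ-+-* t i j)))

  2*-^ : ∀ {x} i → x ≤ t ^ i → 2 * x ≤ t ^ suc i
  2*-^ i x≤ = *-mono-≤ t≥2 x≤

  +-^ : ∀ {x y} i → x ≤ t ^ i → y ≤ t ^ i → x + y ≤ t ^ suc i
  +-^ {x} {y} i x≤ y≤ = ≤-trans (+-mono-≤ x≤ y≤) (≤-trans (≤-reflexive (cong (t ^ i +_) (sym (+-identityʳ (t ^ i))))) (2*-^ i ≤-refl))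

  cancel-^ : ∀ {x y} i j → t ^ i * x ≤ y → y ≤ t ^ (i + j) → x ≤ t ^ j
  cancel-^ {x} i j lo hi = *-cancelˡ-≤ (t ^ i) {{m^n≢0 t i}} (≤-trans lo (≤-trans hi (≤-reflexive (^-distribˡ-+-* t i j))))

  root-^ : ∀ {x} k .{{_ : NonZero k}} i → x ^ k ≤ t ^ (i * k) → x ≤ t ^ i
  root-^ k i le = ^-cancelˡ-≤ k (≤-trans le (≤-reflexive (sym (^-*-assoc t i k))))

-- Exponents of t are thousandths of exponents of p, up to the gap between t^1000 and t^1001. The
-- hypothesis t ≥ 1003 makes 2 + log₂ p at most t^2.
module Estimate (n : ℕ) (pr : Prime (suc n)) (t : ℕ) (t≥1003 : 1003 ≤ t)
                (p≥ : t ^ 1000 ≤ suc n) (p≤ : suc n ≤ t ^ 1001)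
                (d-bound : ∀ z → 1 ≤ z → z ≤ t ^ 2000 → d z ^ 2000 ≤ t)
                (nonExceptional : NonExceptional n (t ^ 300)) where

  open Order n pr
  open Count n pr

  private
    t≥8 : 8 ≤ t
    t≥8 = ≤-trans (≤ᵇ⇒≤ 8 1003 tt) t≥1003

    t≥2 : 2 ≤ t
    t≥2 = ≤-trans (≤ᵇ⇒≤ 2 8 tt) t≥8

    instance _ = >-nonZero (<⇒≤ t≥2)

    open Powers t t≥2

    ≤t^1 : ∀ {x} → x ≤ t → x ≤ t ^ 1
    ≤t^1 x≤ = ≤-trans x≤ (≤-reflexive (sym (*-identityʳ t)))

    n≤ : n ≤ t ^ 1001
    n≤ = ≤-trans (n≤1+n n) p≤

    n≥2 : 2 ≤ n
    n≥2 = s≤s⁻¹ (≤-trans (≤-trans (≤ᵇ⇒≤ 3 8 tt) t≥8) (≤-trans (≤t^1 ≤-refl) (≤-trans (^-monoʳ-≤ t (≤ᵇ⇒≤ 1 1000 tt)) p≥)))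

    d^≤t : ∀ r → r ≤ 2000 → ∀ z → 1 ≤ z → z ≤ t ^ 2000 → d z ^ r ≤ t
    d^≤t r r≤ z z≥1 z≤ = ≤-trans (^-monoʳ-≤ (d z) {{>-nonZero (d-mono-∣ z≥1 (1∣ z))}} r≤) (d-bound z z≥1 z≤)

    d≤t : ∀ z → 1 ≤ z → z ≤ n → d z ≤ t
    d≤t z z≥1 z≤ = subst (_≤ t) (*-identityʳ (d z)) (d^≤t 1 (≤ᵇ⇒≤ 1 2000 tt) z z≥1 (^-up 1001 2000 (≤ᵇ⇒≤ 1001 2000 tt) (≤-trans z≤ n≤)))

    logarithm : ∃ λ k → 2 ^ k ≤ p × p < 2 ^ suc k
    logarithm = log 2 ≤-refl p (s≤s z≤n)

    k : ℕ
    k = proj₁ logarithm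

    2^k≤p : 2 ^ k ≤ p
    2^k≤p = proj₁ (proj₂ logarithm)

    p<2^1+k : p < 2 ^ suc k
    p<2^1+k = proj₂ (proj₂ logarithm)

    k≤ : k ≤ t * 1001
    k≤ = ≮⇒≥ (λ lt → <⇒≱ (^-monoʳ-< 2 (s≤s (s≤s z≤n)) lt) (≤-trans 2^k≤p (≤-trans p≤ (≤-trans (^-monoˡ-≤ 1001 (<⇒≤ (n<2^n t))) (≤-reflexive (^-*-assoc 2 t 1001))))))

    2+k≤ : 2 + k ≤ t ^ 2
    2+k≤ = begin
      2 + k  ≤⟨ +-mono-≤ t≥2 k≤ ⟩
      t + t * 1001  ≡⟨ *-suc t 1001 ⟨
      t * 1002  ≤⟨ *-monoʳ-≤ t (≤-trans (≤ᵇ⇒≤ 1002 1003 tt) t≥1003) ⟩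
      t * t  ≡⟨ cong (t *_) (*-identityʳ t) ⟨
      t ^ 2  ∎
      where open ≤-Reasoning

    log²≤ : (2 + k) * (2 + k) ≤ t ^ 4
    log²≤ = *-^ 2 2 2+k≤ 2+k≤

  module _ (a b e : ℕ) (n≡abe : n ≡ a * (b * e)) where

    private
      m : ℕ
      m = a * e

      n≡b*m : n ≡ b * m
      n≡b*m = trans n≡abe (ring a b e)
        where
        ring : ∀ a b e → a * (b * e) ≡ b * (a * e)
        ring = solve-∀

      m∣n : m ∣ n
      m∣n = subst (m ∣_) (sym n≡b*m) (n∣m*n b)

      ∣n⇒≥1 : ∀ {x} → x ∣ n → 1 ≤ x
      ∣n⇒≥1 {zero}  x∣n = ⊥-elim (<-irrefl (sym (0∣⇒≡0 x∣n)) n≥1)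
      ∣n⇒≥1 {suc x} _   = s≤s z≤n

      e∣n : e ∣ n
      e∣n = ∣-trans (n∣m*n a) m∣n

      m≥1 : 1 ≤ m
      m≥1 = ∣n⇒≥1 m∣n

      instance
        _ = >-nonZero n≥1

    -- The exponent is 824 = 1 + 320 + 503: a divisor function, the range of b, and √p with its
    -- logarithm, where 2 · 503 = 4 + 1002.
    small-b : b ≤ t ^ 320 → ℤ.∣ Δ a b (b * e) ∣ ≤ a * t ^ 830
    small-b b≤ = begin
      ℤ.∣ Δ a b (b * e) ∣  ≤⟨ Δ-small a b e n≡abe (a * b * t ^ 503) excess≤ ⟩
      d e * (a * b * t ^ 503)  ≤⟨ *-monoˡ-≤ (a * b * t ^ 503) (d≤t e (∣n⇒≥1 e∣n) (∣⇒≤ e∣n)) ⟩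
      t * (a * b * t ^ 503)  ≡⟨ ring t a b (t ^ 503) ⟩
      a * (b * (t * t ^ 503))  ≤⟨ *-monoʳ-≤ a (^-up 824 830 (≤ᵇ⇒≤ 824 830 tt) (*-^ 320 504 b≤ ≤-refl)) ⟩
      a * t ^ 830  ∎
      where
      open ≤-Reasoning
      ring : ∀ t a b x → t * (a * b * x) ≡ a * (b * (t * x))
      ring = solve-∀
      module PS = ProductSet n pr (a * b) e (trans n≡abe (sym (*-assoc a b e)))
      module C = Coset n pr (a * b) e (trans n≡abe (sym (*-assoc a b e)))
      instance _ = C.f≢0
      2p≤ : 2 * p ≤ t ^ 1002
      2p≤ = 2*-^ 1001 p≤
      ring₂ : ∀ x f p → x * (2 * (f * f) * p) ≡ f * f * (x * (2 * p))
      ring₂ = solve-∀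
      ring₃ : ∀ f x → f * f * (x * x) ≡ f * x * (f * x)
      ring₃ = solve-∀
      excess≤ : ∀ w M → M ≤ n → ℤ.∣ PS.excess w M ∣ ≤ a * b * t ^ 503
      excess≤ w M M≤n = n*n≤m*m⇒n≤m _ (a * b * t ^ 503) (begin
        sq (PS.excess w M)  ≡⟨ cong sq (PS.excess-% w M) ⟨
        sq (PS.excess (w % (a * b)) M)  ≤⟨ ∈⇒≤∑ (λ w → sq (PS.excess w M)) (∈-upTo⁺ (m%n<n w (a * b))) ⟩
        ∑ (upTo (a * b)) (λ w → sq (PS.excess w M))  ≤⟨ C.polya-vinogradov k M 2^k≤p p<2^1+k (m≤n⇒m≤1+n M≤n) ⟩
        (2 + k) * (2 + k) * (2 * (a * b * (a * b)) * p)  ≡⟨ ring₂ ((2 + k) * (2 + k)) (a * b) p ⟩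
        a * b * (a * b) * ((2 + k) * (2 + k) * (2 * p))  ≤⟨ *-monoʳ-≤ (a * b * (a * b)) (*-^ 4 1002 log²≤ 2p≤) ⟩
        a * b * (a * b) * t ^ 1006  ≡⟨ cong (a * b * (a * b) *_) (^-distribˡ-+-* t 503 503) ⟩
        a * b * (a * b) * (t ^ 503 * t ^ 503)  ≡⟨ ring₃ (a * b) (t ^ 503) ⟩
        a * b * t ^ 503 * (a * b * t ^ 503)  ∎)

    module L = Coset n pr b m n≡b*m
    module LP = ProductSet n pr b m n≡b*m

    private
      N : ℕ
      N = L.T (ind b) m

      -- `product-bound` with M = m, multiplied by b^(r + 1) and rewritten by b m = n. The two terms
      -- come from M^(r + 1) and p in its right-hand side.
      product-bound' : ∀ r → suc r ≤ 2000 → m ^ suc r ≤ t ^ 2000 → (b * N) ^ suc r ≤ t * (n ^ r * m + b ^ r * n)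
      product-bound' r r≤ m^≤ = *-cancelʳ-≤ _ _ p (begin
        (b * N) ^ suc r * p  ≡⟨ trans (cong (_* p) (^-distribʳ-* (suc r) b N)) (*-assoc (b ^ suc r) (N ^ suc r) p) ⟩
        b ^ suc r * (N ^ suc r * p)  ≤⟨ *-monoʳ-≤ (b ^ suc r) (LP.product-bound (ind b) m (suc r) t (λ z z≥1 z≤ → d^≤t (suc r) r≤ z z≥1 (≤-trans z≤ m^≤))) ⟩
        b ^ suc r * (t * (m * (m ^ suc r + p)))  ≡⟨ ring₁ b (b ^ r) t m (m ^ r) p ⟩
        t * ((b ^ r * m ^ r) * (b * m) * m + b ^ r * (b * m) * p)  ≡⟨ cong₂ (λ x y → t * (x * y * m + b ^ r * y * p)) (trans (sym (^-distribʳ-* r b m)) (cong (_^ r) (sym n≡b*m))) (sym n≡b*m) ⟩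
        t * (n ^ r * n * m + b ^ r * n * p)  ≤⟨ *-monoʳ-≤ t (+-monoˡ-≤ (b ^ r * n * p) (*-monoˡ-≤ m (*-monoʳ-≤ (n ^ r) (n≤1+n n)))) ⟩
        t * (n ^ r * p * m + b ^ r * n * p)  ≡⟨ ring₂ t (n ^ r) p m (b ^ r * n) ⟩
        t * (n ^ r * m + b ^ r * n) * p  ∎)
        where
        open ≤-Reasoning
        ring₁ : ∀ b B t m μ p → b * B * (t * (m * (m * μ + p))) ≡ t * ((B * μ) * (b * m) * m + B * (b * m) * p)
        ring₁ = solve-∀
        ring₂ : ∀ t x p m y → t * (x * p * m + y * p) ≡ t * (x * m + y) * p
        ring₂ = solve-∀

      b-from-m : ∀ i j → i + j ≡ 1001 → t ^ i < m → b ≤ t ^ j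
      b-from-m i j eq lt = cancel-^ {y = n} i j (≤-trans (*-monoˡ-≤ b (<⇒≤ lt)) (≤-reflexive (trans (*-comm m b) (sym n≡b*m)))) (subst (λ k → n ≤ t ^ k) (sym eq) n≤)

      n^≤ : ∀ r → n ^ r ≤ t ^ (1001 * r)
      n^≤ r = ≤-trans (^-monoˡ-≤ r n≤) (≤-reflexive (^-*-assoc t 1001 r))

      -- The term b² n is where m must not be too small: m > t^300 gives b ≤ t^701, and 2 · 701 +
      -- 1001 = 2403 is safely below 3 · 829 = 2487.
      cube : t ^ 300 < m → m ≤ t ^ 400 → b * N ≤ t ^ 829
      cube lo hi = root-^ 3 829 (^-up 2405 2487 (≤ᵇ⇒≤ 2405 2487 tt) (≤-trans
        (product-bound' 2 (≤ᵇ⇒≤ 3 2000 tt) (^-up 1200 2000 (≤ᵇ⇒≤ 1200 2000 tt) (≤-trans (^-monoˡ-≤ 3 hi) (≤-reflexive (^-*-assoc t 400 3)))))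
        (*-^ 1 2404 (≤t^1 ≤-refl) (+-^ 2403
          (^-up 2402 2403 (≤ᵇ⇒≤ 2402 2403 tt) (*-^ 2002 400 (n^≤ 2) hi))
          (*-^ 1402 1001 (≤-trans (^-monoˡ-≤ 2 b≤) (≤-reflexive (^-*-assoc t 701 2))) n≤)))))
        where
        b≤ : b ≤ t ^ 701
        b≤ = b-from-m 300 701 refl lo

      -- 655 is the largest exponent for which 1 + 1 + 1001 + 655 stays within 2 · 829.
      square : t ^ 400 < m → m ≤ t ^ 655 → b * N ≤ t ^ 829
      square lo hi = root-^ 2 829 (≤-trans
        (product-bound' 1 (≤ᵇ⇒≤ 2 2000 tt) (^-up 1310 2000 (≤ᵇ⇒≤ 1310 2000 tt) (≤-trans (^-monoˡ-≤ 2 hi) (≤-reflexive (^-*-assoc t 655 2)))))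
        (*-^ 1 1657 (≤t^1 ≤-refl) (+-^ 1656
          (*-^ 1001 655 (n^≤ 1) hi)
          (^-up 1602 1656 (≤ᵇ⇒≤ 1602 1656 tt) (*-^ 601 1001 (≤-trans (^-monoˡ-≤ 1 b≤) (≤-reflexive (^-*-assoc t 601 1))) n≤)))))
        where
        b≤ : b ≤ t ^ 601
        b≤ = b-from-m 400 601 refl lo

      -- Either b N is at most twice the expected share t^(140 + 681), or amplification applies and
      -- (b N)² has exponent 1 + 98 + 4 + 2 · 346 + 1001 - 140 = 1656, below 2 · 829.
      amplified : t ^ 320 < b → t ^ 655 < m → m ≤ t ^ 681 → b * N ≤ t ^ 829
      amplified b> lo hi = [ (λ le → ^-up 822 829 (≤ᵇ⇒≤ 822 829 tt) (≤-trans le (2*-^ 821 (*-^ 140 681 (≤-refl {t ^ 140}) hi)))) , by-amplification ]′ (≤-total (b * N) (2 * (Y * m)))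
        where
        Y = t ^ 140
        Y^7≤p : Y ^ 7 ≤ p
        Y^7≤p = ≤-trans (≤-reflexive (^-*-assoc t 140 7)) (≤-trans (^-monoʳ-≤ t (≤ᵇ⇒≤ 980 1000 tt)) p≥)
        b≤ : b ≤ t ^ 346
        b≤ = b-from-m 655 346 refl lo
        Ym≤n : Y * m ≤ n
        Ym≤n = ≤-trans (*-monoˡ-≤ m (≤-trans (^-monoʳ-≤ t (≤ᵇ⇒≤ 140 320 tt)) (<⇒≤ b>))) (≤-reflexive (sym n≡b*m))
        -- Seventh powers keep Y^7 = t^980 below p, so the product bound becomes T^7 ≤ 2 t m, of
        -- exponent 683 ≤ 7 · 98.
        s≤ : ∀ w → L.T w Y ≤ t ^ 98
        s≤ w = root-^ 7 98 (^-up 683 686 (≤ᵇ⇒≤ 683 686 tt) (*-cancelʳ-≤ _ _ p (begin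
          L.T w Y ^ 7 * p  ≤⟨ LP.product-bound w Y 7 t (λ z z≥1 z≤ → d^≤t 7 (≤ᵇ⇒≤ 7 2000 tt) z z≥1 (^-up 1001 2000 (≤ᵇ⇒≤ 1001 2000 tt) (≤-trans z≤ (≤-trans Y^7≤p p≤)))) ⟩
          t * (m * (Y ^ 7 + p))  ≤⟨ *-monoʳ-≤ t (*-monoʳ-≤ m (+-monoˡ-≤ p Y^7≤p)) ⟩
          t * (m * (p + p))  ≡⟨ ring t m p ⟩
          t * (2 * m) * p  ≤⟨ *-monoˡ-≤ p (*-^ 1 682 (≤t^1 ≤-refl) (2*-^ 681 hi)) ⟩
          t ^ 683 * p  ∎)))
          where
          open ≤-Reasoning
          ring : ∀ t m p → t * (m * (p + p)) ≡ t * (2 * m) * p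
          ring = solve-∀
        by-amplification : 2 * (Y * m) ≤ b * N → b * N ≤ t ^ 829
        by-amplification big = n*n≤m*m⇒n≤m (b * N) (t ^ 829) (≤-trans
          (cancel-^ 140 1656 (LP.amplification (ind b) m Y (t ^ 98) k Ym≤n m≥1 s≤ 2^k≤p p<2^1+k big) rhs)
          (≤-trans (^-monoʳ-≤ t (≤ᵇ⇒≤ 1656 1658 tt)) (≤-reflexive (^-distribˡ-+-* t 829 829))))
          where
          open ≤-Reasoning
          ring : ∀ s x b p → 4 * (s * (x * (2 * (b * b) * p))) ≡ 8 * (s * (x * (b * b * p)))
          ring = solve-∀
          rhs : 4 * (t ^ 98 * ((2 + k) * (2 + k) * L.U)) ≤ t ^ 1796
          rhs = ≤-trans (≤-reflexive (ring (t ^ 98) ((2 + k) * (2 + k)) b p))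
            (*-^ 1 1795 (≤t^1 t≥8) (*-^ 98 1697 ≤-refl (*-^ 4 1693 log²≤ (*-^ 692 1001 (*-^ 346 346 b≤ b≤) p≤))))

      bN≤ : t ^ 320 < b → m ≤ t ^ 681 → t ^ 300 < m → b * N ≤ t ^ 829
      bN≤ b> hi lo = [ cube lo , (λ 400< → [ square 400< , (λ 655< → amplified b> 655< hi) ]′ (≤-<-connex m (t ^ 655))) ]′ (≤-<-connex m (t ^ 400))

    large-b : t ^ 320 < b → ℤ.∣ Δ a b (b * e) ∣ ≤ a * t ^ 830
    large-b b> = [ tiny , main ]′ (≤-<-connex m (t ^ 300))
      where
      m≤ : m ≤ t ^ 681
      m≤ = cancel-^ {y = n} 320 681 (≤-trans (*-monoˡ-≤ m (<⇒≤ b>)) (≤-reflexive (sym n≡b*m))) n≤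
      tiny : m ≤ t ^ 300 → ℤ.∣ Δ a b (b * e) ∣ ≤ a * t ^ 830
      tiny m≤300 = ≤-trans (Δ-tiny a b e n≡abe n≥2 (nonExceptional m m∣n m≤300)) (*-monoʳ-≤ a (^-up 300 830 (≤ᵇ⇒≤ 300 830 tt) m≤300))
      main : t ^ 300 < m → ℤ.∣ Δ a b (b * e) ∣ ≤ a * t ^ 830
      main lo = ≤-trans (Δ-large a b e n≡abe) (*-monoʳ-≤ a (+-^ 829 (bN≤ b> m≤ lo) (^-up 681 829 (≤ᵇ⇒≤ 681 829 tt) m≤)))

  Err-bound : Err p ≤ t ^ 831
  Err-bound = begin
    Err p  ≤⟨ Err≤² (t ^ 830) (λ a b e eq → [ small-b a b e eq , large-b a b e eq ]′ (≤-<-connex b (t ^ 320))) ⟩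
    d n * (d n * t ^ 830)  ≡⟨ ring (d n) (t ^ 830) ⟩
    -- The two divisor factors, one from each sum over divisors, together cost a single t.
    d n ^ 2 * t ^ 830  ≤⟨ *-monoˡ-≤ (t ^ 830) (d^≤t 2 (≤ᵇ⇒≤ 2 2000 tt) n n≥1 (^-up 1001 2000 (≤ᵇ⇒≤ 1001 2000 tt) n≤)) ⟩
    t ^ 831  ∎
    where
    open ≤-Reasoning
    ring : ∀ x y → x * (x * y) ≡ x * (x * 1) * y
    ring = solve-∀

-- Chebyshev's bound

-- B i j is the binomial coefficient (i + j choose i).
B : ℕ → ℕ → ℕ
B zero    j       = 1
B (suc i) zero    = 1
B (suc i) (suc j) = B i (suc j) + B (suc i) j

B-0 : ∀ i → B i 0 ≡ 1
B-0 zero    = refl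
B-0 (suc i) = refl

-- The absorption identities for binomial coefficients, proved together because Pascal's rule brings
-- each into the induction for the other.
absorbʳ : ∀ i j → suc j * B i (suc j) ≡ suc (i + j) * B i j
absorbˡ : ∀ i j → suc i * B (suc i) j ≡ suc (i + j) * B i j

absorbʳ zero    j       = refl
absorbʳ (suc i) zero    = begin
  1 * (B i 1 + 1)  ≡⟨ ring₁ (B i 1) ⟩
  1 * B i 1 + 1  ≡⟨ cong (_+ 1) (trans (absorbʳ i 0) (cong (suc (i + 0) *_) (B-0 i))) ⟩
  suc (i + 0) * 1 + 1  ≡⟨ ring₂ i ⟩
  suc (suc i + 0) * 1  ∎
  where
  open ≡-Reasoning
  ring₁ : ∀ x → 1 * (x + 1) ≡ 1 * x + 1
  ring₁ = solve-∀
  ring₂ : ∀ i → suc (i + 0) * 1 + 1 ≡ suc (suc i + 0) * 1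
  ring₂ = solve-∀
absorbʳ (suc i) (suc j) = begin
  suc (suc j) * (B i (suc (suc j)) + B (suc i) (suc j))  ≡⟨ *-distribˡ-+ (suc (suc j)) (B i (suc (suc j))) (B (suc i) (suc j)) ⟩
  suc (suc j) * B i (suc (suc j)) + suc (suc j) * B (suc i) (suc j)  ≡⟨ cong₂ _+_ (absorbʳ i (suc j)) refl ⟩
  suc (i + suc j) * B i (suc j) + suc (suc j) * B (suc i) (suc j)  ≡⟨ cong (λ z → z + suc (suc j) * B (suc i) (suc j)) (trans (cong (λ s → suc s * B i (suc j)) (+-suc i j)) (sym step)) ⟩
  suc i * B (suc i) (suc j) + suc (suc j) * B (suc i) (suc j)  ≡⟨ ring i j (B (suc i) (suc j)) ⟩
  suc (suc i + suc j) * B (suc i) (suc j)  ∎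
  where
  open ≡-Reasoning
  ring : ∀ i j x → suc i * x + suc (suc j) * x ≡ suc (suc i + suc j) * x
  ring = solve-∀
  step : suc i * B (suc i) (suc j) ≡ suc (suc (i + j)) * B i (suc j)
  step = trans (absorbˡ i (suc j)) (cong (λ s → suc s * B i (suc j)) (+-suc i j))

absorbˡ zero    zero    = refl
absorbˡ zero    (suc j) = begin
  1 * (1 + B 1 j)  ≡⟨ ring₁ (B 1 j) ⟩
  1 + 1 * B 1 j  ≡⟨ cong (1 +_) (absorbˡ 0 j) ⟩
  1 + suc j * 1  ≡⟨ ring₂ j ⟩
  suc (suc j) * 1  ∎
  where
  open ≡-Reasoning
  ring₁ : ∀ x → 1 * (1 + x) ≡ 1 + 1 * x
  ring₁ = solve-∀
  ring₂ : ∀ j → 1 + suc j * 1 ≡ suc (suc j) * 1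
  ring₂ = solve-∀
absorbˡ (suc i) zero    = ring i
  where
  ring : ∀ i → suc (suc i) * 1 ≡ suc (suc i + 0) * 1
  ring = solve-∀
absorbˡ (suc i) (suc j) = begin
  suc (suc i) * (B (suc i) (suc j) + B (suc (suc i)) j)  ≡⟨ *-distribˡ-+ (suc (suc i)) (B (suc i) (suc j)) (B (suc (suc i)) j) ⟩
  suc (suc i) * B (suc i) (suc j) + suc (suc i) * B (suc (suc i)) j  ≡⟨ cong (suc (suc i) * B (suc i) (suc j) +_) (trans (absorbˡ (suc i) j) (sym step)) ⟩
  suc (suc i) * B (suc i) (suc j) + suc j * B (suc i) (suc j)  ≡⟨ ring i j (B (suc i) (suc j)) ⟩
  suc (suc i + suc j) * B (suc i) (suc j)  ∎
  where
  open ≡-Reasoning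
  ring : ∀ i j x → suc (suc i) * x + suc j * x ≡ suc (suc i + suc j) * x
  ring = solve-∀
  step : suc j * B (suc i) (suc j) ≡ suc (suc i + j) * B (suc i) j
  step = absorbʳ (suc i) j

B≥1 : ∀ i j → 1 ≤ B i j
B≥1 zero    j       = ≤-refl
B≥1 (suc i) zero    = ≤-refl
B≥1 (suc i) (suc j) = ≤-trans (B≥1 i (suc j)) (m≤m+n _ _)

2^k≤B : ∀ k → 2 ^ k ≤ B k k
2^k≤B zero    = ≤-refl
2^k≤B (suc k) = ≤-trans (*-monoʳ-≤ 2 (2^k≤B k)) (≤-trans (≤-reflexive (cong (B k k +_) (+-identityʳ (B k k)))) (+-mono-≤ (growʳ k k) (growˡ k k)))
  where
  growʳ : ∀ i j → B i j ≤ B i (suc j)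
  growʳ zero    j = ≤-refl
  growʳ (suc i) j = m≤n+m (B (suc i) j) (B i (suc j))
  growˡ : ∀ i j → B i j ≤ B (suc i) j
  growˡ i zero    = ≤-reflexive (B-0 i)
  growˡ i (suc j) = m≤m+n (B i (suc j)) (B (suc i) j)

-- Denominators of the Leibniz harmonic triangle, where each entry is the sum of the two below it.
leibniz : ℕ → ℕ → ℕ
leibniz i j = suc (i + j) * B i j

leibniz-sum : ∀ i j → leibniz i (suc j) * leibniz (suc i) j ≡ leibniz i j * (leibniz i (suc j) + leibniz (suc i) j)
leibniz-sum i j = *-cancelˡ-≡ _ _ (suc i * suc j) (begin
  suc i * suc j * (y * z)  ≡⟨ ring₁ (suc i) (suc j) y z ⟩
  (suc j * y) * (suc i * z)  ≡⟨ cong₂ _*_ ey ez ⟩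
  (suc S * x) * (suc S * x)  ≡⟨ ring₂ i j x ⟩
  x * (suc i * (suc S * x) + suc j * (suc S * x))  ≡⟨ cong₂ (λ u v → x * (suc i * u + suc j * v)) ey ez ⟨
  x * (suc i * (suc j * y) + suc j * (suc i * z))  ≡⟨ ring₃ (suc i) (suc j) x y z ⟩
  suc i * suc j * (x * (y + z))  ∎)
  where
  open ≡-Reasoning
  S = suc (i + j)
  x = leibniz i j
  y = leibniz i (suc j)
  z = leibniz (suc i) j
  swap : ∀ a b c → a * (b * c) ≡ b * (a * c)
  swap = solve-∀
  ey : suc j * y ≡ suc S * x
  ey = trans (swap (suc j) (suc (i + suc j)) (B i (suc j))) (cong₂ _*_ (cong suc (+-suc i j)) (absorbʳ i j))
  ez : suc i * z ≡ suc S * x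
  ez = trans (swap (suc i) (suc (suc i + j)) (B (suc i) j)) (cong (suc S *_) (absorbˡ i j))
  ring₁ : ∀ a b y z → a * b * (y * z) ≡ (b * y) * (a * z)
  ring₁ = solve-∀
  ring₂ : ∀ i j x → (suc (suc (i + j)) * x) * (suc (suc (i + j)) * x) ≡ x * (suc i * (suc (suc (i + j)) * x) + suc j * (suc (suc (i + j)) * x))
  ring₂ = solve-∀
  ring₃ : ∀ a b x y z → x * (a * (b * y) + b * (a * z)) ≡ a * b * (x * (y + z))
  ring₃ = solve-∀

-- By the triangle rule 1 / z = 1 / x - 1 / y, so L / z is the difference of the integers L / x = α
-- and L / y = β.
leibniz-∣ : ∀ L i j → (∀ k → 1 ≤ k → k ≤ suc (i + j) → k ∣ L) → leibniz i j ∣ L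
leibniz-∣ L zero    j div = subst (_∣ L) (sym (*-identityʳ (suc j))) (div (suc j) (s≤s z≤n) ≤-refl)
leibniz-∣ L (suc i) j div with leibniz-∣ L i j (λ k k≥1 k≤ → div k k≥1 (m≤n⇒m≤1+n k≤))
    | leibniz-∣ L i (suc j) (λ k k≥1 k≤ → div k k≥1 (≤-trans k≤ (≤-reflexive (cong suc (+-suc i j)))))
... | divides α eα | divides β eβ = ∣m+n∣m⇒∣n (divides α (trans (+-comm (z * β) L) (trans (sym zα) (*-comm z α)))) (m∣m*n β)
  where
  open ≡-Reasoning
  x = leibniz i j
  y = leibniz i (suc j)
  z = leibniz (suc i) j
  ring₁ : ∀ x y z α → x * y * (z * α) ≡ (α * x) * (y * z)
  ring₁ = solve-∀
  ring₂ : ∀ L x y z → L * (x * (y + z)) ≡ x * y * L + x * z * L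
  ring₂ = solve-∀
  ring₃ : ∀ x y z β L → x * y * L + x * z * (β * y) ≡ x * y * (L + z * β)
  ring₃ = solve-∀
  zα : z * α ≡ L + z * β
  zα = *-cancelˡ-≡ (z * α) (L + z * β) (x * y) {{m*n≢0 x y {{>-nonZero (*-mono-≤ {1} {suc (i + j)} (s≤s z≤n) (B≥1 i j))}} {{>-nonZero (*-mono-≤ {1} {suc (i + suc j)} (s≤s z≤n) (B≥1 i (suc j)))}}}} (begin
    x * y * (z * α)  ≡⟨ ring₁ x y z α ⟩
    (α * x) * (y * z)  ≡⟨ cong₂ _*_ (sym eα) (leibniz-sum i j) ⟩
    L * (x * (y + z))  ≡⟨ ring₂ L x y z ⟩
    x * y * L + x * z * L  ≡⟨ cong (λ l → x * y * L + x * z * l) eβ ⟩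
    x * y * L + x * z * (β * y)  ≡⟨ ring₃ x y z β L ⟩
    x * y * (L + z * β)  ∎)

module _ (N : ℕ) (N≥1 : 1 ≤ N) where

  private
    -- The product, over the listed primes q, of the largest power of q up to N; for all primes up
    -- to N this is lcm (1, ..., N).
    top : ∀ {ps} → All Prime ps → ℕ
    top []         = 1
    top (_∷_ {x = q} pq pps) = q ^ proj₁ (log q (prime≥2 pq) N N≥1) * top pps

    top≤ : ∀ {ps} (pps : All Prime ps) → top pps ≤ N ^ length ps
    top≤ []         = ≤-refl
    top≤ (_∷_ {x = q} pq pps) = *-mono-≤ (proj₁ (proj₂ (log q (prime≥2 pq) N N≥1))) (top≤ pps)

    top≥1 : ∀ {ps} (pps : All Prime ps) → 1 ≤ top pps
    top≥1 []         = ≤-refl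
    top≥1 (_∷_ {x = q} pq pps) = *-mono-≤ (m^n>0 q {{prime⇒nonZero pq}} (proj₁ (log q (prime≥2 pq) N N≥1))) (top≥1 pps)

    ∣top : ∀ {ps} (pps : All Prime ps) j → 1 ≤ j → j ≤ N → (∀ q → Prime q → q ∣ j → q ∈ ps) → j ∣ top pps
    ∣top [] zero () _ _
    ∣top [] (suc zero) _ _ _ = ∣-refl
    ∣top [] j@(suc (suc _)) _ _ supp with prime-divisor j (s≤s (s≤s z≤n))
    ... | q , pq , q∣j with supp q pq q∣j
    ... | ()
    ∣top (_∷_ {x = q} {xs = ps} pq pps) j j≥1 j≤N supp with extract-power q (prime≥2 pq) j j≥1
    ... | b , j' , refl , q∤j' = *-pres-∣ q^b∣ (∣top pps j' j'≥1 (≤-trans (m≤n*m j' (q ^ b) {{m^n≢0 q b}}) j≤N) supp')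
      where
      instance _ = prime⇒nonZero pq
      a = proj₁ (log q (prime≥2 pq) N N≥1)
      N<q^ = proj₂ (proj₂ (log q (prime≥2 pq) N N≥1))
      j'≥1 : 1 ≤ j'
      j'≥1 = n≢0⇒n>0 (λ { refl → q∤j' (q ∣0) })
      b≤a : b ≤ a
      b≤a = s≤s⁻¹ (≰⇒> (λ sa≤b → <⇒≱ N<q^ (≤-trans (^-monoʳ-≤ q sa≤b) (≤-trans (m≤m*n (q ^ b) j' {{>-nonZero j'≥1}}) j≤N))))
      q^b∣ : q ^ b ∣ q ^ a
      q^b∣ = subst (q ^ b ∣_) (trans (sym (^-distribˡ-+-* q b (a ∸ b))) (cong (q ^_) (m+[n∸m]≡n b≤a))) (m∣m*n (q ^ (a ∸ b)))
      supp' : ∀ r → Prime r → r ∣ j' → r ∈ ps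
      supp' r pr r∣j' with supp r pr (∣n⇒∣m*n (q ^ b) r∣j')
      ... | here refl = ⊥-elim (q∤j' r∣j')
      ... | there r∈  = r∈

  chebyshev : ∀ k → suc (k + k) ≤ N → 2 ^ k ≤ N ^ length (filter prime? (range1 N))
  chebyshev k k≤ = begin
    2 ^ k  ≤⟨ 2^k≤B k ⟩
    B k k  ≤⟨ m≤n*m (B k k) (suc (k + k)) ⟩
    leibniz k k  ≤⟨ ∣⇒≤ {{>-nonZero (top≥1 primes)}} (leibniz-∣ (top primes) k k (λ j j≥1 j≤ → ∣top primes j j≥1 (≤-trans j≤ k≤)
        (λ q pq q∣j → ∈-filter⁺ prime? (range1⁺ (<⇒≤ (prime≥2 pq)) (≤-trans (∣⇒≤ {{>-nonZero j≥1}} q∣j) (≤-trans j≤ k≤))) pq))) ⟩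
    top primes  ≤⟨ top≤ primes ⟩
    N ^ length (filter prime? (range1 N))  ∎
    where
    open ≤-Reasoning
    primes = all-filter prime? (range1 N)

-- Prime divisors of a fixed number above a bound.

private
  divisorAbove? : ∀ m A q → Dec (Prime q × m < q × q ∣ A)
  divisorAbove? m A q = prime? q ×-dec (m <? q ×-dec q ∣? A)

-- Distinct prime divisors of A above m have a product at most A. The induction divides out the
-- prime suc x, which does not affect divisibility by the smaller primes.
few-prime-divisors : ∀ m x A → 1 ≤ A → m ^ ∑ (range1 x) (λ q → 𝟙 (prime? q ×-dec (m <? q ×-dec q ∣? A))) ≤ A
few-prime-divisors m zero    A A≥1 = A≥1
few-prime-divisors m (suc x) A A≥1 = ≤-trans (≤-reflexive (cong (m ^_) (∑-range1-suc x))) (decide (divisorAbove? m A (suc x)))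
  where
  open ≤-Reasoning
  count : ℕ → ℕ
  count A = ∑ (range1 x) (λ q → 𝟙 (divisorAbove? m A q))
  decide : (D : Dec (Prime (suc x) × m < suc x × suc x ∣ A)) → m ^ (count A + 𝟙 D) ≤ A
  decide (no _) = ≤-trans (≤-reflexive (cong (m ^_) (+-identityʳ (count A)))) (few-prime-divisors m x A A≥1)
  decide (yes (_ , _ , divides zero refl)) = ⊥-elim (<-irrefl refl A≥1)
  decide (yes (px , m<x , divides A'@(suc _) refl)) = begin
    m ^ (count (A' * suc x) + 1)  ≤⟨ *-or (count (A' * suc x)) ⟩
    m * m ^ count (A' * suc x)  ≡⟨ cong (λ c → m * m ^ c) (∑-cong (range1 x) (λ {q} q∈ → 𝟙-cong (divisorAbove? m (A' * suc x) q) (divisorAbove? m A' q)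
        (λ (pq , m<q , q∣) → pq , m<q , [ (λ q∣A' → q∣A') , (λ q∣x → ⊥-elim (other pq q∈ q∣x)) ]′ (euclidsLemma A' (suc x) pq q∣))
            (λ (pq , m<q , q∣) → pq , m<q , ∣m⇒∣m*n (suc x) q∣))) ⟩
    m * m ^ count A'  ≤⟨ *-mono-≤ (<⇒≤ m<x) (few-prime-divisors m x A' (s≤s z≤n)) ⟩
    suc x * A'  ≡⟨ *-comm (suc x) A' ⟩
    A' * suc x  ∎
    where
    *-or : ∀ c → m ^ (c + 1) ≤ m * m ^ c
    *-or c = ≤-reflexive (cong (m ^_) (+-comm c 1))
    other : ∀ {q} → Prime q → q ∈ range1 x → ¬ q ∣ suc x
    other {q} pq q∈ q∣ with prime⇒irreducible px q∣
    ... | inj₁ refl = ¬prime[1] pq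
    ... | inj₂ refl = <⇒≱ ≤-refl (proj₂ (range1⁻ q∈))

-- Many good primes

-- Bases of large powers are kept in neutral form (τ + 1, not suc τ), since powers of suc τ unfold.
abstract
  root : ∀ R .{{_ : NonZero R}} x → ∃ λ τ → τ ^ R ≤ x × x < (τ + 1) ^ R
  root (suc R) zero    = 0 , z≤n , m^n>0 1 (suc R)
  root R       (suc x) = let (τ , lo , hi) = root R x in
    [ (λ sx< → τ , m≤n⇒m≤1+n lo , sx<)
    , (λ eq → τ + 1 , ≤-reflexive (sym eq) , subst (_< (τ + 1 + 1) ^ R) (sym eq) (^-monoˡ-< R (m<m+n (τ + 1) (s≤s z≤n)))) ]′ (m≤n⇒m<n∨m≡n hi)

^-cancelˡ-< : ∀ k m n → m ^ k < n ^ k → m < n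
^-cancelˡ-< k m n lt = ≰⇒> (λ n≤m → <⇒≱ lt (^-monoˡ-≤ k n≤m))

<root : ∀ k m τ {x} → m ^ k ≤ x → x < (τ + 1) ^ k → m ≤ τ
<root k m τ lo hi = s≤s⁻¹ (subst (m <_) (+-comm τ 1) (^-cancelˡ-< k m (τ + 1) (≤-<-trans lo hi)))

^-swap : ∀ m j k → (m ^ j) ^ k ≡ (m ^ k) ^ j
^-swap m j k = trans (^-*-assoc m j k) (trans (cong (m ^_) (*-comm j k)) (sym (^-*-assoc m k j)))

2^-cancel-≤ : ∀ {m n} → 2 ^ m ≤ 2 ^ n → m ≤ n
2^-cancel-≤ le = ≮⇒≥ (λ lt → <⇒≱ (^-monoʳ-< 2 ≤-refl lt) le)

[t+1]^≤ : ∀ R t → 1 ≤ t → 2 ^ R ≤ t → (t + 1) ^ R ≤ t ^ suc R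
[t+1]^≤ R t t≥1 2^R≤t = begin
  (t + 1) ^ R  ≤⟨ ^-monoˡ-≤ R (+-monoʳ-≤ t (≤-trans t≥1 (m≤m+n t 0))) ⟩
  (2 * t) ^ R  ≡⟨ ^-distribʳ-* R 2 t ⟩
  2 ^ R * t ^ R  ≤⟨ *-monoˡ-≤ (t ^ R) 2^R≤t ⟩
  t ^ suc R  ∎
  where open ≤-Reasoning

power-trade : ∀ j k e t p → e ≤ t ^ j → t ^ k ≤ p → e ^ k ≤ p ^ j
power-trade j k e t p e≤ t≤ = begin
  e ^ k  ≤⟨ ^-monoˡ-≤ k e≤ ⟩
  (t ^ j) ^ k  ≡⟨ ^-swap t j k ⟩
  (t ^ k) ^ j  ≤⟨ ^-monoˡ-≤ j t≤ ⟩
  p ^ j  ∎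
  where open ≤-Reasoning

Good : ℕ → Set
Good p = Err p ^ 1000 ≤ p ^ 831

-- The threshold is astronomically large and must never be unfolded.
abstract
  Err-bound-threshold : Σ[ t₀ ∈ ℕ ] (∀ p t → Prime p → t₀ ≤ t → t ^ 1000 ≤ p → p < (t + 1) ^ 1000 →
      NonExceptional (p ∸ 1) (t ^ 300) → Err p ≤ t ^ 831)
  Err-bound-threshold = let (t₁ , d-bound) = d-small 2000 in
    t₁ + (2 ^ 1000 + 1003) , λ { zero t pr → ⊥-elim (¬prime[0] pr) ; (suc n) t pr t₀≤t lo hi nonExc →
      let t≥1003 = ≤-trans (m≤n+m 1003 (2 ^ 1000)) (≤-trans (m≤n+m (2 ^ 1000 + 1003) t₁) t₀≤t)
          2^≤t   = ≤-trans (m≤m+n (2 ^ 1000) 1003) (≤-trans (m≤n+m (2 ^ 1000 + 1003) t₁) t₀≤t)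
          t₁≤t   = ≤-trans (m≤m+n t₁ (2 ^ 1000 + 1003)) t₀≤t
      in Estimate.Err-bound n pr t t≥1003 lo (≤-trans (<⇒≤ hi) ([t+1]^≤ 1000 t (≤-trans (≤ᵇ⇒≤ 1 1003 tt) t≥1003) 2^≤t)) (d-bound t t₁≤t) nonExc }

t₀ : ℕ
t₀ = proj₁ Err-bound-threshold

p₀ : ℕ
p₀ = t₀ ^ 1000

-- One τ serves all p ≤ x: the root t of p itself is at most τ, so excluding orders up to τ^300
-- excludes those up to t^300.
nonExceptional⇒good : ∀ p τ → Prime p → p₀ ≤ p → p < (τ + 1) ^ 1000 → NonExceptional (p ∸ 1) (τ ^ 300) → Good p
nonExceptional⇒good p τ pr p₀≤p p<τ nonExc = let (t , lo , hi) = root 1000 p in conclude t lo hi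
  where
  conclude : ∀ t → t ^ 1000 ≤ p → p < (t + 1) ^ 1000 → Good p
  conclude t lo hi = power-trade 831 1000 (Err p) t p (proj₂ Err-bound-threshold p t pr (<root 1000 t₀ t p₀≤p hi) lo hi
    (λ m m∣n m≤ → nonExc m m∣n (≤-trans m≤ (^-monoˡ-≤ 300 (<root 1000 t τ lo p<τ))))) lo

-- Exceptional primes.

gap : ℕ → ℕ → ℕ
gap m k = m ^ (2 * m) ∸ k ^ (2 * m)

-- The condition m < p, which holds when m ∣ p - 1, lets `few-prime-divisors` count with base m.
Exceptional : ℕ → ℕ → ℕ → Set
Exceptional m k p = k < m × Prime p × m < p × p ∣ gap m k

exceptional? : ∀ m k p → Dec (Exceptional m k p)
exceptional? m k p = k <? m ×-dec (prime? p ×-dec (m <? p ×-dec p ∣? gap m k))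

module _ (M : ℕ) where

  exceptions : ℕ → ℕ
  exceptions p = ∑ (range1 M) (λ m → ∑ (range1 M) (λ k → 𝟙 (exceptional? m k p)))

  no-exceptions⇒ : ∀ p → Prime p → exceptions p ≡ 0 → NonExceptional (p ∸ 1) M
  no-exceptions⇒ zero    pr = ⊥-elim (¬prime[0] pr)
  no-exceptions⇒ (suc n) pr none m m∣n m≤M k k≥1 k<m p∣ = <⇒≱ {0} {1} (s≤s z≤n) (begin
    1  ≡⟨ 𝟙-yes (exceptional? m k (suc n)) (k<m , pr , s≤s (∣⇒≤ {{>-nonZero (s≤s⁻¹ (prime≥2 pr))}} m∣n) , p∣) ⟨
    𝟙 (exceptional? m k (suc n))  ≤⟨ ∈⇒≤∑ (λ k → 𝟙 (exceptional? m k (suc n))) (range1⁺ k≥1 (≤-trans (<⇒≤ k<m) m≤M)) ⟩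
    ∑ (range1 M) (λ k → 𝟙 (exceptional? m k (suc n)))  ≤⟨ ∈⇒≤∑ (λ m → ∑ (range1 M) (λ k → 𝟙 (exceptional? m k (suc n)))) (range1⁺ (≤-trans k≥1 (<⇒≤ k<m)) m≤M) ⟩
    exceptions (suc n)  ≡⟨ none ⟩
    0  ∎)
    where open ≤-Reasoning

  -- For each pair (m , k) the gap is at most m^(2m), so at most 2 m primes above m divide it. With
  -- M = τ^300 the total is 2 τ^900, negligible against x / log x; this limits how far the tiny
  -- range can reach.
  ∑-exceptions : ∀ x → ∑ (range1 x) exceptions ≤ M * (M * (2 * M))
  ∑-exceptions x = begin
    ∑ (range1 x) exceptions  ≡⟨ trans (∑-swap (range1 x) (range1 M)) (∑-cong (range1 M) (λ _ → ∑-swap (range1 x) (range1 M))) ⟩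
    ∑ (range1 M) (λ m → ∑ (range1 M) (λ k → ∑ (range1 x) (λ p → 𝟙 (exceptional? m k p))))  ≤⟨ ∑-bound (range1 M) (length (range1 M) * (2 * M)) (λ {m} m∈ → ∑-bound (range1 M) (2 * M) (λ {k} k∈ →
        ≤-trans (few m k (proj₁ (range1⁻ k∈))) (*-monoʳ-≤ 2 (proj₂ (range1⁻ m∈))))) ⟩
    length (range1 M) * (length (range1 M) * (2 * M))  ≡⟨ cong (λ l → l * (l * (2 * M))) (length-applyUpTo suc M) ⟩
    M * (M * (2 * M))  ∎
    where
    open ≤-Reasoning
    few : ∀ m k → 1 ≤ k → ∑ (range1 x) (λ p → 𝟙 (exceptional? m k p)) ≤ 2 * m
    few m k k≥1 with k <? m
    ... | no ¬k<m = ≤-trans (≤-reflexive (∑-zero (range1 x) (λ _ → refl))) z≤n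
    ... | yes k<m = ≮⇒≥ (λ 2m<c → <⇒≱ (≤-<-trans (m∸n≤m (m ^ (2 * m)) (k ^ (2 * m))) (^-monoʳ-< m (≤-trans (s≤s k≥1) k<m) 2m<c))
        (≤-trans (≤-reflexive (cong (m ^_) (∑-cong (range1 x) (λ {p} _ → 𝟙-cong _ (prime? p ×-dec (m <? p ×-dec p ∣? gap m k)) proj₂ (λ c → k<m , c)))))
          (few-prime-divisors m x (gap m k) (m<n⇒0<n∸m (^-monoˡ-< (2 * m) {{m*n≢0 2 m {{_}} {{>-nonZero (≤-trans k≥1 (<⇒≤ k<m))}}}} k<m)))))

good? : ∀ p → Dec (Prime p × Good p)
good? p = prime? p ×-dec (Err p ^ 1000 ≤? p ^ 831)

goodPrimes : ℕ → List ℕ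
goodPrimes x = filter good? (range1 x)

∑-𝟙< : ∀ c x → ∑ (range1 x) (λ p → 𝟙 (p <? c)) ≤ c
∑-𝟙< c zero    = z≤n
∑-𝟙< c (suc x) with suc x <? c
... | yes sx<c = ≤-trans (∑-bound (range1 (suc x)) 1 (λ {p} _ → 𝟙≤1 (p <? c))) (≤-trans (≤-reflexive (trans (*-identityʳ _) (length-applyUpTo suc (suc x)))) (<⇒≤ sx<c))
... | no sx≮c  = ≤-trans (≤-reflexive (trans (∑-range1-suc x) (trans (cong (∑ (range1 x) (λ p → 𝟙 (p <? c)) +_) (𝟙-no (suc x <? c) sx≮c)) (+-identityʳ _)))) (∑-𝟙< c x)

-- Every prime up to x is good, below the threshold `p₀`, or exceptional for some pair (m , k).
primes≤ : ∀ x τ → x < (τ + 1) ^ 1000 →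
          length (filter prime? (range1 x)) ≤ length (goodPrimes x) + (p₀ + τ ^ 300 * (τ ^ 300 * (2 * τ ^ 300)))
primes≤ x τ x<τ = begin
  length (filter prime? (range1 x))  ≡⟨ length-filter prime? (range1 x) ⟩
  ∑ (range1 x) (λ p → 𝟙 (prime? p))  ≤⟨ ∑-mono (range1 x) (λ {p} p∈ → 𝟙≤ (prime? p) (cover p (proj₂ (range1⁻ p∈)))) ⟩
  ∑ (range1 x) (λ p → 𝟙 (good? p) + (𝟙 (p <? p₀) + exceptions M p))  ≡⟨ trans (∑-+ (range1 x)) (cong₂ _+_ (sym (length-filter good? (range1 x))) (∑-+ (range1 x))) ⟩
  length (goodPrimes x) + (∑ (range1 x) (λ p → 𝟙 (p <? p₀)) + ∑ (range1 x) (exceptions M))  ≤⟨ +-monoʳ-≤ (length (goodPrimes x)) (+-mono-≤ (∑-𝟙< p₀ x) (∑-exceptions M x)) ⟩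
  length (goodPrimes x) + (p₀ + M * (M * (2 * M)))  ∎
  where
  open ≤-Reasoning
  M = τ ^ 300
  cover : ∀ p → p ≤ x → Prime p → 1 ≤ 𝟙 (good? p) + (𝟙 (p <? p₀) + exceptions M p)
  cover p p≤x pr = decide (exceptions M p) refl (p <? p₀)
    where
    decide : ∀ e → exceptions M p ≡ e → (D : Dec (p < p₀)) → 1 ≤ 𝟙 (good? p) + (𝟙 D + e)
    decide (suc e) _    D         = ≤-trans (s≤s z≤n) (≤-trans (m≤n+m (suc e) (𝟙 D)) (m≤n+m (𝟙 D + suc e) (𝟙 (good? p))))
    decide zero    none (yes _)   = m≤n+m 1 (𝟙 (good? p))
    decide zero    none (no p≮p₀) = ≤-trans (≤-reflexive (sym (𝟙-yes (good? p)
      (pr , nonExceptional⇒good p τ pr (≮⇒≥ p≮p₀) (≤-<-trans p≤x x<τ) (no-exceptions⇒ M p pr none))))) (m≤m+n _ 0)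

module Counting (x τ L : ℕ) (τ≥1003 : 1003 ≤ τ) (τ≥p₀ : p₀ ≤ τ)
                (x≥τ : τ ^ 1000 ≤ x) (x<τ : x < (τ + 1) ^ 1000) (2^L≤x : 2 ^ L ≤ x) (x<2^ : x < 2 ^ suc L) where

  private
    G E π K : ℕ
    G = length (goodPrimes x)
    E = p₀ + τ ^ 300 * (τ ^ 300 * (2 * τ ^ 300))
    π = length (filter prime? (range1 x))
    K = (x ∸ 1) / 2

    τ≥2 : 2 ≤ τ
    τ≥2 = ≤-trans (≤ᵇ⇒≤ 2 1003 tt) τ≥1003

    open Powers τ τ≥2

    instance _ = >-nonZero (<⇒≤ τ≥2)

    τ≤x : τ ≤ x
    τ≤x = ≤-trans (≤-reflexive (sym (*-identityʳ τ))) (≤-trans (^-monoʳ-≤ τ (≤ᵇ⇒≤ 1 1000 tt)) x≥τ)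

    x≥1 : 1 ≤ x
    x≥1 = ≤-trans (<⇒≤ τ≥2) τ≤x

    L≥1 : 1 ≤ L
    L≥1 = n≢0⇒n>0 (λ { refl → <⇒≱ x<2^ (≤-trans τ≥2 τ≤x) })

    2K+1≤x : suc (K + K) ≤ x
    2K+1≤x = ≤-trans (s≤s (≤-trans (≤-reflexive (ring K)) (m/n*n≤m (x ∸ 1) 2))) (≤-reflexive (m+[n∸m]≡n x≥1))
      where
      ring : ∀ k → k + k ≡ k * 2
      ring = solve-∀

    x≤2K+2 : x ≤ 2 * K + 2
    x≤2K+2 = begin
      x  ≡⟨ m+[n∸m]≡n x≥1 ⟨
      suc (x ∸ 1)  ≡⟨ cong suc (m≡m%n+[m/n]*n (x ∸ 1) 2) ⟩
      suc ((x ∸ 1) % 2) + K * 2  ≤⟨ +-monoˡ-≤ (K * 2) (m%n<n (x ∸ 1) 2) ⟩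
      2 + K * 2  ≡⟨ ring K ⟩
      2 * K + 2  ∎
      where
      open ≤-Reasoning
      ring : ∀ k → 2 + k * 2 ≡ 2 * k + 2
      ring = solve-∀

    K≤ : K ≤ suc L * π
    K≤ = 2^-cancel-≤ (≤-trans (chebyshev x x≥1 K 2K+1≤x) (≤-trans (^-monoˡ-≤ π (<⇒≤ x<2^)) (≤-reflexive (^-*-assoc 2 (suc L) π))))

    L≤ : suc L ≤ τ ^ 2
    L≤ = begin
      suc L  ≤⟨ +-mono-≤ (<⇒≤ τ≥2) (2^-cancel-≤ (≤-trans 2^L≤x (≤-trans (<⇒≤ x<τ) (≤-trans (^-monoˡ-≤ 1000 (≤-trans (≤-reflexive (+-comm τ 1)) (n<2^n τ))) (≤-reflexive (^-*-assoc 2 τ 1000)))))) ⟩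
      τ + τ * 1000  ≡⟨ *-suc τ 1000 ⟨
      τ * 1001  ≤⟨ *-monoʳ-≤ τ (≤-trans (≤ᵇ⇒≤ 1001 1003 tt) τ≥1003) ⟩
      τ * τ  ≡⟨ cong (τ *_) (*-identityʳ τ) ⟨
      τ ^ 2  ∎
      where open ≤-Reasoning

    4≤τ : 4 ≤ τ ^ 1
    4≤τ = ≤-trans (≤-trans (≤ᵇ⇒≤ 4 1003 tt) τ≥1003) (≤-reflexive (sym (*-identityʳ τ)))

    E≤ : E ≤ τ ^ 902
    E≤ = +-^ 901 (^-up 1 901 (≤ᵇ⇒≤ 1 901 tt) (≤-trans τ≥p₀ (≤-reflexive (sym (*-identityʳ τ)))))
      (*-^ 300 601 (≤-refl {τ ^ 300}) (*-^ 300 301 (≤-refl {τ ^ 300}) (2*-^ 300 ≤-refl)))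

    error≤ : 4 * (suc L * E) + 4 ≤ x
    error≤ = ≤-trans (+-^ 905 (*-^ 1 904 4≤τ (*-^ 2 902 L≤ E≤)) (^-up 1 905 (≤ᵇ⇒≤ 1 905 tt) 4≤τ)) (≤-trans (^-monoʳ-≤ τ (≤ᵇ⇒≤ 906 1000 tt)) x≥τ)

  -- Chebyshev's bound gives 2 x ≤ 4 (L + 1) (G + E) + 4. The part with E is at most τ^906 ≤ x and
  -- is absorbed by one of the two x; then L + 1 ≤ 2 L.
  many : x ≤ 8 * (L * G)
  many = ≤-trans (+-cancelʳ-≤ x x (4 * (suc L * G)) (begin
    x + x  ≡⟨ cong (x +_) (+-identityʳ x) ⟨
    2 * x  ≤⟨ *-monoʳ-≤ 2 (≤-trans x≤2K+2 (+-monoˡ-≤ 2 (*-monoʳ-≤ 2 (≤-trans K≤ (*-monoʳ-≤ (suc L) (primes≤ x τ x<τ)))))) ⟩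
    2 * (2 * (suc L * (G + E)) + 2)  ≡⟨ ring₁ (suc L) G E ⟩
    4 * (suc L * G) + (4 * (suc L * E) + 4)  ≤⟨ +-monoʳ-≤ (4 * (suc L * G)) error≤ ⟩
    4 * (suc L * G) + x  ∎))
    (≤-trans (*-monoʳ-≤ 4 (*-monoˡ-≤ G (≤-trans (+-monoˡ-≤ L L≥1) (≤-reflexive (cong (L +_) (sym (+-identityʳ L))))))) (≤-reflexive (ring₂ L G)))
    where
    open ≤-Reasoning
    ring₁ : ∀ l g e → 2 * (2 * (l * (g + e)) + 2) ≡ 4 * (l * g) + (4 * (l * e) + 4)
    ring₁ = solve-∀
    ring₂ : ∀ l g → 4 * (2 * l * g) ≡ 8 * (l * g)
    ring₂ = solve-∀

-- Comparison with x / ln x, and the two stated bounds.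

c : ℚ
c = (ℤ.+ 1) ℚ./ 16

-- If s ≤ L / 2, then exp s ≤ 2^L ≤ x. If s ≥ L / 2, then 16 G s ≥ 8 L G ≥ x, against G s < x / 16;
-- hence c = 1 / (2 · 8).
xOverLn : ∀ x L G → 2 ^ L ≤ x → x ≤ 8 * (L * G) → XOverLnBound c x G
xOverLn x L G 2^L≤x x≤ s Gs<cx with ℚP.≤-total s 0ℚ
... | inj₁ s≤0 = inj₁ s≤0
... | inj₂ 0≤s with ℚP.≤-total (ℕ→ℚ 2 ℚ.* s) (ℕ→ℚ L)
...   | inj₁ 2s≤L = inj₂ (λ N → ℚP.≤-trans (expPartial≤2^ s L 0≤s 2s≤L N) (ℕ→ℚ-mono 2^L≤x))
...   | inj₂ L≤2s = ⊥-elim (ℚP.<-irrefl refl (ℚP.<-≤-trans 16Gs<x x≤16Gs))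
  where
  16Gs<x : ℕ→ℚ 16 ℚ.* (ℕ→ℚ G ℚ.* s) ℚ.< ℕ→ℚ x
  16Gs<x = subst (ℕ→ℚ 16 ℚ.* (ℕ→ℚ G ℚ.* s) ℚ.<_) (trans (sym (ℚP.*-assoc (ℕ→ℚ 16) c (ℕ→ℚ x))) (trans (cong (ℚ._* ℕ→ℚ x) (ℕ→ℚ-inverse 15)) (ℚP.*-identityˡ (ℕ→ℚ x))))
    (ℚP.*-monoʳ-<-pos (ℕ→ℚ 16) Gs<cx)
  x≤16Gs : ℕ→ℚ x ℚ.≤ ℕ→ℚ 16 ℚ.* (ℕ→ℚ G ℚ.* s)
  x≤16Gs = begin
    ℕ→ℚ x  ≤⟨ ℕ→ℚ-mono (≤-trans x≤ (≤-reflexive (ring L G))) ⟩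
    ℕ→ℚ (8 * G * L)  ≡⟨ ℕ→ℚ-* (8 * G) L ⟩
    ℕ→ℚ (8 * G) ℚ.* ℕ→ℚ L  ≤⟨ ℚP.*-monoˡ-≤-nonNeg (ℕ→ℚ (8 * G)) {{ℚ.nonNegative (0≤ℕ→ℚ (8 * G))}} L≤2s ⟩
    ℕ→ℚ (8 * G) ℚ.* (ℕ→ℚ 2 ℚ.* s)  ≡⟨ ℚP.*-assoc (ℕ→ℚ (8 * G)) (ℕ→ℚ 2) s ⟨
    ℕ→ℚ (8 * G) ℚ.* ℕ→ℚ 2 ℚ.* s  ≡⟨ cong (ℚ._* s) (ℕ→ℚ-* (8 * G) 2) ⟨
    ℕ→ℚ (8 * G * 2) ℚ.* s  ≡⟨ cong (λ k → ℕ→ℚ k ℚ.* s) (ring₂ G) ⟩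
    ℕ→ℚ (16 * G) ℚ.* s  ≡⟨ cong (ℚ._* s) (ℕ→ℚ-* 16 G) ⟩
    ℕ→ℚ 16 ℚ.* ℕ→ℚ G ℚ.* s  ≡⟨ ℚP.*-assoc (ℕ→ℚ 16) (ℕ→ℚ G) s ⟩
    ℕ→ℚ 16 ℚ.* (ℕ→ℚ G ℚ.* s)  ∎
    where
    open ℚP.≤-Reasoning
    ring : ∀ l g → 8 * (l * g) ≡ 8 * g * l
    ring = solve-∀
    ring₂ : ∀ g → 8 * g * 2 ≡ 16 * g
    ring₂ = solve-∀

good-many : ∀ {P : ℕ → Set} → (∀ p → Prime p → Good p → P p) → ManyPrimes P
good-many {P} good⇒P = c , ℚP.positive⁻¹ c , τ₀ ^ 1000 , λ x x₀≤x → goodPrimes x , unique x , members x , bound x x₀≤x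
  where
  τ₀ = 1003 + p₀
  unique : ∀ x → Unique (goodPrimes x)
  unique x = Unique.filter⁺ good? (Unique.applyUpTo⁺₁ suc x (λ i<j _ eq → <⇒≢ i<j (suc-injective eq)))
  members : ∀ x → All (λ p → Prime p × p ≤ x × P p) (goodPrimes x)
  members x = All.tabulate (λ {p} p∈ → let (p∈r , pr , good) = ∈-filter⁻ good? {xs = range1 x} p∈ in pr , proj₂ (range1⁻ p∈r) , good⇒P p pr good)
  bound : ∀ x → τ₀ ^ 1000 ≤ x → XOverLnBound c x (length (goodPrimes x))
  bound x x₀≤x = let (τ , lo , hi) = root 1000 x in conclude τ lo hi
    where
    conclude : ∀ τ → τ ^ 1000 ≤ x → x < (τ + 1) ^ 1000 → XOverLnBound c x (length (goodPrimes x))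
    conclude τ lo hi = let (L , loL , hiL) = log 2 ≤-refl x x≥1 in
      xOverLn x L (length (goodPrimes x)) loL (Counting.many x τ L (≤-trans (m≤m+n 1003 p₀) τ₀≤τ) (≤-trans (m≤n+m p₀ 1003) τ₀≤τ) lo hi loL hiL)
      where
      τ₀≤τ : τ₀ ≤ τ
      τ₀≤τ = <root 1000 τ₀ τ x₀≤x hi
      x≥1 : 1 ≤ x
      x≥1 = ≤-trans (m^n>0 τ {{>-nonZero (≤-trans (s≤s z≤n) τ₀≤τ)}} 1000) lo

power-weaken : ∀ {e p} j k j' k' → NonZero p → e ^ k ≤ p ^ j → j * k' ≤ j' * k → .{{_ : NonZero k}} → e ^ k' ≤ p ^ j'
power-weaken {e} {p} j k j' k' p≢0 le j*k'≤ = ^-cancelˡ-≤ k (begin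
  (e ^ k') ^ k  ≡⟨ ^-swap e k' k ⟩
  (e ^ k) ^ k'  ≤⟨ ^-monoˡ-≤ k' le ⟩
  (p ^ j) ^ k'  ≡⟨ ^-*-assoc p j k' ⟩
  p ^ (j * k')  ≤⟨ ^-monoʳ-≤ p {{p≢0}} j*k'≤ ⟩
  p ^ (j' * k)  ≡⟨ ^-*-assoc p j' k ⟨
  (p ^ j') ^ k  ∎)
  where open ≤-Reasoning

good⇒BoundO : ∀ p → Prime p → Good p → BoundO 1 p
-- 831 · 6 = 4986 and 5 · 1000 = 5000, that is 0.831 ≤ 5/6.
good⇒BoundO p pr good = ≤-trans (power-weaken {Err p} {p} 831 1000 5 6 (prime⇒nonZero pr) good (≤ᵇ⇒≤ 4986 5000 tt)) (≤-reflexive (sym (+-identityʳ (p ^ 5))))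

1≤^ℚ : ∀ {s} → 1ℚ ℚ.≤ s → ∀ k → 1ℚ ℚ.≤ s ^ℚ k
1≤^ℚ 1≤s zero    = ℚP.≤-refl
1≤^ℚ {s} 1≤s (suc k) = subst (ℚ._≤ s ℚ.* (s ^ℚ k)) (ℚP.*-identityˡ 1ℚ)
  (*-mono-≤-nonNeg (ℚP.≤-trans (0≤ℕ→ℚ 1) 1≤s) (0≤ℕ→ℚ 1) 1≤s (1≤^ℚ 1≤s k))

-- For s ≥ 2 the power s^k is at least 1, so A s^k ≥ A ≥ B. The threshold 2 matches the summand 2 in
-- 2 + ln p: it puts s - 2 in the case `q ≤ 0` of `_≤ln_`.
small-s : ∀ A B k s → B ≤ A → ℕ→ℚ A ℚ.* (s ^ℚ k) ℚ.< ℕ→ℚ B → s ℚ.≤ ℕ→ℚ 2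
small-s A B k s B≤A lt = [ (λ s≤2 → s≤2) , (λ 2≤s → ⊥-elim (ℚP.<-irrefl refl (ℚP.<-≤-trans lt (ℚP.≤-trans (ℕ→ℚ-mono B≤A)
  (subst (ℚ._≤ ℕ→ℚ A ℚ.* (s ^ℚ k)) (ℚP.*-identityʳ (ℕ→ℚ A)) (ℚP.*-monoˡ-≤-nonNeg (ℕ→ℚ A) {{ℚ.nonNegative (0≤ℕ→ℚ A)}}
    (1≤^ℚ (ℚP.≤-trans (ℕ→ℚ-mono {1} {2} (s≤s z≤n)) 2≤s) k))))))) ]′ (ℚP.≤-total s (ℕ→ℚ 2))

good⇒BoundExplicit : ∀ p → Prime p → Good p → BoundExplicit p
good⇒BoundExplicit p pr good s 0≤s lt = inj₁ (subst (s ℚ.- ℕ→ℚ 2 ℚ.≤_) (ℚP.+-inverseʳ (ℕ→ℚ 2)) (ℚP.+-monoˡ-≤ (ℚ.- ℕ→ℚ 2)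
    (small-s (p ^ 8313 * (d (p ∸ 1) ^ 3) ^ 10000) (Err p ^ 10000) 10000 s (bound 8313 10000 (≤ᵇ⇒≤ 8310000 8313000 tt)) lt)))
  where
  d≥1 : 1 ≤ d (p ∸ 1)
  d≥1 = d-mono-∣ (∸-monoˡ-≤ 1 (prime≥2 pr)) (1∣ (p ∸ 1))
  bound : ∀ j' k' → 831 * k' ≤ j' * 1000 → Err p ^ k' ≤ p ^ j' * (d (p ∸ 1) ^ 3) ^ k'
  bound j' k' le = ≤-trans (power-weaken {Err p} {p} 831 1000 j' k' (prime⇒nonZero pr) good le)
    (m≤m*n (p ^ j') ((d (p ∸ 1) ^ 3) ^ k') {{m^n≢0 (d (p ∸ 1) ^ 3) k' {{m^n≢0 (d (p ∸ 1)) 3 {{>-nonZero d≥1}}}}}})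

theorem4 : (Σ[ C ∈ ℕ ] ManyPrimes (BoundO C)) × ManyPrimes BoundExplicit
theorem4 = (1 , good-many good⇒BoundO) , good-many good⇒BoundExplicit
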